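{- Let $q=p^n$ be a power of an odd prime $p$ with $q\equiv 3 \pmod 4$ and $q\ge 27535^2$. Let $\mathcal{U}=\{0,\pm1\}$ if $p=3$ and $\mathcal{U}=\{0,\pm 1,\pm\frac{1}{3}\}$ if $p\neq 3$. Then for every $u\in\mathbb{F}_q\setminus\mathcal{U}$ with $\eta(1+u)=\eta(1-u)$, the differential uniformity of $F_{2,u}(x)=x^2\big(1+u\eta(x)\big)$ over $\mathbb{F}_q$ equals $4$.
   Context: $\eta$ denotes the quadratic character of $\mathbb{F}_q$: $\eta(0)=0$, $\eta(x)=1$ if $x$ is a nonzero square, $\eta(x)=-1$ if $x$ is a non-square. For a function $f:\mathbb{F}_q\to\mathbb{F}_q$ and $a,b\in\mathbb{F}_q$, $\delta_f(a,b)=\#\{x\in\mathbb{F}_q: f(x+a)-f(x)=b\}$, and the differential uniformity of $f$ is $\delta_f=\max_{a\in\mathbb{F}_q^*,\,b\in\mathbb{F}_q}\delta_f(a,b)$. -}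

module Defs where

open import Level using (0ℓ)
open import Data.Nat as ℕ using (ℕ; _⊔_)
open import Data.Fin using (Fin)
open import Data.List as List using (List; length; filter; foldr; tabulate; map; concatMap)
open import Data.List.Relation.Unary.Any using (any?)
open import Data.Product using (∃; _×_; _,_)
open import Relation.Nullary using (¬_; yes; no)
open import Relation.Nullary.Decidable using (¬?)
open import Relation.Binary using (DecidableEquality)
open import Relation.Binary.PropositionalEquality using (_≡_; _≢_)
open import Algebra.Structures using (IsCommutativeRing)
open import Function.Bundles using (_↔_; Inverse)

record FiniteField : Set₁ where
  infixl 7 _*_
  infixl 6 _+_ _-_
  field
    Carrier : Set
    _+_ _*_ : Carrier → Carrier → Carrier
    -_      : Carrier → Carrier
    0# 1#   : Carrier
    isCommutativeRing : IsCommutativeRing _≡_ _+_ _*_ -_ 0# 1#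
    _≟_     : DecidableEquality Carrier
    0≢1     : 0# ≢ 1#
    _⁻¹     : Carrier → Carrier
    inverseʳ : ∀ x → x ≢ 0# → x * (x ⁻¹) ≡ 1#
    size    : ℕ
    enumeration : Fin size ↔ Carrier

  _-_ : Carrier → Carrier → Carrier
  x - y = x + (- y)

  elements : List Carrier
  elements = tabulate (Inverse.to enumeration)

  η : Carrier → Carrier
  η x with x ≟ 0#
  ... | yes _ = 0#
  ... | no _ with any? (λ y → (y * y) ≟ x) elements
  ...   | yes _ = 1#
  ...   | no _  = - 1#

  δ : (Carrier → Carrier) → Carrier → Carrier → ℕ
  δ f a b = length (filter (λ x → (f (x + a) - f x) ≟ b) elements)

  nonzero : List Carrier
  nonzero = filter (λ a → ¬? (a ≟ 0#)) elements

  diffUniformity : (Carrier → Carrier) → ℕ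
  diffUniformity f =
    foldr _⊔_ 0 (concatMap (λ a → map (λ b → δ f a b) elements) nonzero)

  F₂ : Carrier → Carrier → Carrier
  F₂ u x = (x * x) * (1# + u * η x)

  three : Carrier
  three = 1# + 1# + 1#

{-# OPTIONS --safe #-}
module Submission where

-- Let χ be the quadratic character. After scaling, a solution of F(x + a) - F(x) = b is a y with
-- F(y + 1) - F(y - 1) = 4c. For each choice of signs of y + 1 and y - 1 this equation has degree 1 (equal signs) or 2
-- (opposite signs), and the signs of c ± (1 + u), c ± (1 - u) exclude more than four solutions.
--
-- Four solutions, two for each choice of opposite signs, are y = (- 1 ± s) / u and (1 ± t) / u, where s² + t² = 2(1 - u²).
-- Since 1 - u² is a square, this conic is parametrised by a rational function, and one needs a parameter at which eight
-- pairwise coprime quadratic polynomials take prescribed signs. Expanding the product of the 1 ± χ(hᵢ), it suffices to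
-- bound the sums of χ(f) for products f of the hᵢ, of degree at most 32.
--
-- The bound is Stepanov's: by the pigeonhole principle there is R = Σ (aⱼ + bⱼ f^((q - 1) / 2)) X^(jq) ≠ 0 vanishing to
-- high order wherever f^((q - 1) / 2) = ε. Vanishing is tested by substituting X + f(X) Z, which serves as a Taylor
-- expansion in any characteristic. R ≠ 0 because a² f = f(0) b² has no nonzero solution when f has a simple factor.

open import Defs
open import Level using (0ℓ)
open import Algebra.Bundles using (CommutativeRing; RawRing)
open import Algebra.Structures using (IsCommutativeRing)
import Algebra.Solver.Ring
open import Algebra.Solver.Ring.AlmostCommutativeRing using (fromCommutativeRing; _-Raw-AlmostCommutative⟶_)
open import Data.Nat as ℕ using (ℕ; zero; suc; z≤n; s≤s)
import Data.Nat.Properties as ℕₚ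
import Data.Nat.Combinatorics as Comb
open import Data.Nat.Divisibility using (_∣_; divides; ∣⇒≤; ∣1⇒≡1; m∣m*n)
open import Data.Nat.DivMod using (m/n*n≡m; m≡m%n+[m/n]*n)
open import Data.Nat.Primality using (Prime; euclidsLemma; prime⇒nonZero; prime⇒nonTrivial)
import Data.Nat.Tactic.RingSolver as ℕ-Solver
open import Data.Integer as ℤ using (ℤ; -[1+_]; 0ℤ; 1ℤ; -1ℤ) renaming (+_ to pos)
import Data.Integer.Properties as ℤₚ
import Data.Integer.Tactic.RingSolver as ℤ-Solver
open import Data.Fin as Fin using (Fin; zero; suc; toℕ; fromℕ; fromℕ<; inject₁; punchIn; funToFin; finToFun; remQuot)
open import Data.Fin.Patterns using (0F; 1F; 2F; 3F; 4F; 5F)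
import Data.Fin.Properties as Finₚ
open import Data.Fin.Permutation using (Permutation; permutation)
open import Data.List as List using (List; []; _∷_; _++_; length; map; filter; foldr; drop)
import Data.List.Properties as Listₚ
open import Data.List.Membership.Propositional using (_∈_)
open import Data.List.Membership.Propositional.Properties using (∈-tabulate⁺; ∈-∃++; ∈-++⁻; ∈-++⁺ˡ; ∈-++⁺ʳ; ∈-filter⁺; ∈-map⁺; ∈-concatMap⁺)
open import Data.List.Relation.Unary.All as All using (All; []; _∷_)
import Data.List.Relation.Unary.All.Properties as Allₚ
open import Data.List.Relation.Unary.AllPairs as AllPairs using (AllPairs; []; _∷_)
import Data.List.Relation.Unary.AllPairs.Properties as AllPairsₚ
open import Data.List.Relation.Unary.Any as Any using (here; there; any?)
open import Data.List.Relation.Unary.Unique.Propositional using (Unique)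
import Data.List.Relation.Unary.Unique.Propositional.Properties as Uniqueₚ
open import Data.Maybe using (Maybe; just; nothing)
open import Data.Product using (∃; ∃₂; Σ; _×_; _,_; proj₁; proj₂; uncurry)
open import Data.Sum using (_⊎_; inj₁; inj₂; [_,_]′)
open import Data.Unit using (⊤; tt)
open import Data.Empty using (⊥; ⊥-elim)
open import Function using (_∘_)
open import Function.Bundles using (Inverse)
open import Relation.Nullary using (¬_; Dec; yes; no)
open import Relation.Nullary.Decidable using (¬?)
open import Relation.Binary.PropositionalEquality as ≡ using (_≡_; _≢_)
import Relation.Binary.Reflection as Reflection

-- Up to sign, the eight conditions prescribe the characters of the linear forms s ± (1 ± u) and t ±
-- (1 ± u) at a point of the conic. They can be prescribed independently when none of the eight
-- lines is tangent to the conic and no two meet on it: each line then pulls back to a quadratic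
-- with two simple roots, shared with no other line. Tangency means (1 + u)(1 - 3u) = 0 or (1 - u)(1
-- + 3u) = 0, which is where u = ±1/3 is excluded; common points on the conic are excluded by u ≠ 0,
-- ±1. Since q ≡ 3 (mod 4), -1 is a non-square, so the denominator 1 + x² of the parametrisation has
-- no zero in the field. Clearing it gives each condition degree 4, hence the degree 8 · 4 = 32, and
-- there are 2⁸ = 256 products. If 2μ is the order of vanishing, a sum is at most about 65q / (2μ),
-- subject to 67μ² < 8q up to lower terms. The 256 errors together stay below q once √q exceeds
-- roughly 24100; q ≥ 27535² leaves room for a fixed μ.

Ring : Set₁
Ring = CommutativeRing 0ℓ 0ℓ

-- Ring identities with integer coefficients

infix  8 :-_
infixl 7 _:*_
infixl 6 _:+_ _:-_
infix  4 _:=_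
infix  10 κ_

-- Unlike the polynomials of the library solver, these expressions do not depend on the ring.
data Expr (n : ℕ) : Set where
  κ_        : ℕ → Expr n
  varᵉ         : Fin n → Expr n
  _:+_ _:*_ : Expr n → Expr n → Expr n
  :-_       : Expr n → Expr n

_:-_ : ∀ {n} → Expr n → Expr n → Expr n
x :- y = x :+ :- y

_:=_ : ∀ {n} → Expr n → Expr n → Expr n × Expr n
_:=_ = _,_

module IntegerSolver (R : Ring) where
  open CommutativeRing R
  open import Algebra.Properties.Semiring.Mult.TCOptimised semiring
    using (×-homo-+; ×1-homo-*; 1+×) renaming (_×_ to _⊗_)
  open import Algebra.Properties.Ring ring using (-‿distribˡ-*; -‿distribʳ-*; -0#≈0#; -‿involutive)
  open import Algebra.Properties.AbelianGroup +-abelianGroup using (⁻¹-∙-comm)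
  open import Relation.Binary.Reasoning.Setoid setoid

  private
    -- Coefficients are taken from ℤ because equality is decidable there. The multiple `⊗` satisfies
    -- 1 ⊗ x = x by computation, so `κ 1` denotes `1#` itself and `κ 2` denotes `1# + 1#`, the forms
    -- in which constants occur in the goals.
    ⟦_⟧ : ℤ → Carrier
    ⟦ pos n ⟧      = n ⊗ 1#
    ⟦ -[1+ n ] ⟧ = - (suc n ⊗ 1#)

    cancel-1# : ∀ x y → x - y ≈ (1# + x) - (1# + y)
    cancel-1# x y = sym (begin
      (1# + x) + - (1# + y)       ≈⟨ +-congˡ (sym (⁻¹-∙-comm 1# y)) ⟩
      (1# + x) + (- 1# + - y)     ≈⟨ +-congʳ (+-comm 1# x) ⟩
      (x + 1#) + (- 1# + - y)     ≈⟨ +-assoc x 1# _ ⟩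
      x + (1# + (- 1# + - y))     ≈⟨ +-congˡ (sym (+-assoc 1# (- 1#) (- y))) ⟩
      x + ((1# + - 1#) + - y)     ≈⟨ +-congˡ (+-congʳ (-‿inverseʳ 1#)) ⟩
      x + (0# + - y)              ≈⟨ +-congˡ (+-identityˡ _) ⟩
      x + - y                     ∎)

    ⊖-homo : ∀ m n → ⟦ m ℤ.⊖ n ⟧ ≈ m ⊗ 1# - n ⊗ 1#
    ⊖-homo m zero = sym (trans (+-congˡ -0#≈0#) (+-identityʳ _))
    ⊖-homo zero (suc n) = sym (+-identityˡ _)
    ⊖-homo (suc m) (suc n) = begin
      ⟦ suc m ℤ.⊖ suc n ⟧             ≡⟨ ≡.cong ⟦_⟧ (ℤₚ.[1+m]⊖[1+n]≡m⊖n m n) ⟩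
      ⟦ m ℤ.⊖ n ⟧                     ≈⟨ ⊖-homo m n ⟩
      m ⊗ 1# - n ⊗ 1#                 ≈⟨ cancel-1# _ _ ⟩
      (1# + m ⊗ 1#) - (1# + n ⊗ 1#)   ≈⟨ +-cong (sym (1+× m 1#)) (-‿cong (sym (1+× n 1#))) ⟩
      suc m ⊗ 1# - suc n ⊗ 1#         ∎

    -homo : ∀ i → ⟦ ℤ.- i ⟧ ≈ - ⟦ i ⟧
    -homo (pos zero)    = sym -0#≈0#
    -homo (pos (suc n)) = refl
    -homo -[1+ n ]    = sym (-‿involutive _)

    +homo : ∀ i j → ⟦ i ℤ.+ j ⟧ ≈ ⟦ i ⟧ + ⟦ j ⟧
    +homo (pos m) (pos n) = ×-homo-+ 1# m n
    +homo (pos m) -[1+ n ] = ⊖-homo m (suc n)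
    +homo -[1+ m ] (pos n) = trans (⊖-homo n (suc m)) (+-comm _ _)
    +homo -[1+ m ] -[1+ n ] = begin
      - (suc (suc (m ℕ.+ n)) ⊗ 1#)      ≡⟨ ≡.cong (λ k → - (k ⊗ 1#)) (≡.cong suc (≡.sym (ℕₚ.+-suc m n))) ⟩
      - ((suc m ℕ.+ suc n) ⊗ 1#)        ≈⟨ -‿cong (×-homo-+ 1# (suc m) (suc n)) ⟩
      - (suc m ⊗ 1# + suc n ⊗ 1#)       ≈⟨ sym (⁻¹-∙-comm _ _) ⟩
      - (suc m ⊗ 1#) + - (suc n ⊗ 1#)   ∎

    *homo⁺ : ∀ i n → ⟦ i ℤ.* pos n ⟧ ≈ ⟦ i ⟧ * ⟦ pos n ⟧
    *homo⁺ (pos m) n = trans (reflexive (≡.cong ⟦_⟧ (≡.sym (ℤₚ.pos-* m n)))) (×1-homo-* m n)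
    *homo⁺ -[1+ m ] n = begin
      ⟦ (ℤ.- pos (suc m)) ℤ.* pos n ⟧   ≡⟨ ≡.cong ⟦_⟧ (≡.sym (ℤₚ.neg-distribˡ-* (pos (suc m)) (pos n))) ⟩
      ⟦ ℤ.- (pos (suc m) ℤ.* pos n) ⟧   ≈⟨ -homo (pos (suc m) ℤ.* pos n) ⟩
      - ⟦ pos (suc m) ℤ.* pos n ⟧       ≈⟨ -‿cong (*homo⁺ (pos (suc m)) n) ⟩
      - (⟦ pos (suc m) ⟧ * ⟦ pos n ⟧)   ≈⟨ -‿distribˡ-* _ _ ⟩
      - ⟦ pos (suc m) ⟧ * ⟦ pos n ⟧     ∎

    *homo : ∀ i j → ⟦ i ℤ.* j ⟧ ≈ ⟦ i ⟧ * ⟦ j ⟧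
    *homo i (pos n) = *homo⁺ i n
    *homo i -[1+ n ] = begin
      ⟦ i ℤ.* (ℤ.- pos (suc n)) ⟧     ≡⟨ ≡.cong ⟦_⟧ (≡.sym (ℤₚ.neg-distribʳ-* i (pos (suc n)))) ⟩
      ⟦ ℤ.- (i ℤ.* pos (suc n)) ⟧     ≈⟨ -homo (i ℤ.* pos (suc n)) ⟩
      - ⟦ i ℤ.* pos (suc n) ⟧         ≈⟨ -‿cong (*homo⁺ i (suc n)) ⟩
      - (⟦ i ⟧ * ⟦ pos (suc n) ⟧)     ≈⟨ -‿distribʳ-* _ _ ⟩
      ⟦ i ⟧ * - ⟦ pos (suc n) ⟧       ∎

    ℤ-raw : RawRing 0ℓ 0ℓ
    ℤ-raw = record { Carrier = ℤ ; _≈_ = _≡_ ; _+_ = ℤ._+_ ; _*_ = ℤ._*_ ; -_ = ℤ.-_ ; 0# = pos 0 ; 1# = pos 1 }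

    morphism : ℤ-raw -Raw-AlmostCommutative⟶ fromCommutativeRing R
    morphism = record
      { ⟦_⟧ = ⟦_⟧ ; +-homo = +homo ; *-homo = *homo ; -‿homo = -homo ; 0-homo = refl ; 1-homo = refl }

    _≟c_ : ∀ i j → Maybe (⟦ i ⟧ ≈ ⟦ j ⟧)
    i ≟c j with i ℤ.≟ j
    ... | yes eq = just (reflexive (≡.cong ⟦_⟧ eq))
    ... | no _   = nothing

  private
    open module RingSolver = Algebra.Solver.Ring ℤ-raw (fromCommutativeRing R) morphism _≟c_
      using (Polynomial; con; op; var; [+]; [*])

    translate : ∀ {n} → Expr n → Polynomial n
    translate (κ k)    = con (pos k)
    translate (varᵉ i)    = var i
    translate (x :+ y) = op [+] (translate x) (translate y)
    translate (x :* y) = op [*] (translate x) (translate y)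
    translate (:- x)   = RingSolver.:- translate x

  open Reflection setoid varᵉ
    (λ e → RingSolver.⟦ translate e ⟧) (λ e → RingSolver.⟦ translate e ⟧↓) (λ e → RingSolver.correct (translate e))
    public using (solve)

-- Divisibility, Bezout coprimality and ring homomorphisms

module Divisibility (R : Ring) where
  open CommutativeRing R
  open IntegerSolver R
  open import Algebra.Properties.CommutativeSemiring.Exp commutativeSemiring using (_^_)
  open import Relation.Binary.Reasoning.Setoid setoid

  infix 4 _∥_
  record _∥_ (x y : Carrier) : Set where
    constructor divides
    field
      quotient : Carrier
      equality : y ≈ x * quotient
  open _∥_ public

  record Coprime (x y : Carrier) : Set where
    constructor bezout
    field
      s t : Carrier
      identity : s * x + t * y ≈ 1#

  ∥-respʳ : ∀ {x y z} → y ≈ z → x ∥ y → x ∥ z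
  ∥-respʳ y≈z (divides k e) = divides k (trans (sym y≈z) e)

  Coprime-sym : ∀ {x y} → Coprime x y → Coprime y x
  Coprime-sym (bezout s t e) = bezout t s (trans (+-comm _ _) e)

  Coprime-respʳ : ∀ {x y z} → y ≈ z → Coprime x y → Coprime x z
  Coprime-respʳ y≈z (bezout s t e) = bezout s t (trans (+-congˡ (*-congˡ (sym y≈z))) e)

  Coprime-1 : ∀ x → Coprime x 1#
  Coprime-1 x = bezout 0# 1# (solve 1 (λ a → κ 0 :* a :+ κ 1 :* κ 1 := κ 1) refl x)

  Coprime-* : ∀ {x y z} → Coprime x y → Coprime x z → Coprime x (y * z)
  Coprime-* {x} {y} {z} (bezout s t e) (bezout s′ t′ e′) =
    bezout (s * (s′ * x + t′ * z) + t * y * s′) (t * t′) (begin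
      (s * (s′ * x + t′ * z) + t * y * s′) * x + t * t′ * (y * z)
        ≈⟨ solve 7 (λ x y z s t s′ t′ → (s :* (s′ :* x :+ t′ :* z) :+ t :* y :* s′) :* x :+ t :* t′ :* (y :* z)
                     := (s :* x :+ t :* y) :* (s′ :* x :+ t′ :* z)) refl x y z s t s′ t′ ⟩
      (s * x + t * y) * (s′ * x + t′ * z) ≈⟨ *-cong e e′ ⟩
      1# * 1#                             ≈⟨ *-identityˡ 1# ⟩
      1#                                  ∎)

  Coprime-^ : ∀ {x y} n → Coprime x y → Coprime x (y ^ n)
  Coprime-^ {x} zero    c = Coprime-1 x
  Coprime-^     (suc n) c = Coprime-* c (Coprime-^ n c)

  Coprime-cancel : ∀ {x y z} → Coprime x y → x ∥ y * z → x ∥ z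
  Coprime-cancel {x} {y} {z} (bezout s t e) (divides k e′) = divides (s * z + t * k) (begin
    z                            ≈⟨ sym (*-identityˡ z) ⟩
    1# * z                       ≈⟨ *-congʳ (sym e) ⟩
    (s * x + t * y) * z          ≈⟨ solve 5 (λ x y z s t → (s :* x :+ t :* y) :* z := s :* x :* z :+ t :* (y :* z)) refl x y z s t ⟩
    s * x * z + t * (y * z)      ≈⟨ +-congˡ (*-congˡ e′) ⟩
    s * x * z + t * (x * k)      ≈⟨ solve 5 (λ x z s t k → s :* x :* z :+ t :* (x :* k) := x :* (s :* z :+ t :* k)) refl x z s t k ⟩
    x * (s * z + t * k)          ∎)

  -- Substitute the expression for z into the Bezout relation of x and z. Pairwise coprimality of
  -- the quadratics is obtained in this way: eliminating between two of them leaves a nonzero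
  -- constant times a power of 1 + x², which is coprime to the first.
  Coprime-ideal : ∀ {x y z} a b → Coprime x z → z ≈ a * x + b * y → Coprime x y
  Coprime-ideal {x} {y} {z} a b (bezout s t e) z≈ = bezout (s + t * a) (t * b) (begin
    (s + t * a) * x + t * b * y   ≈⟨ solve 6 (λ x y s t a b → (s :+ t :* a) :* x :+ t :* b :* y := s :* x :+ t :* (a :* x :+ b :* y)) refl x y s t a b ⟩
    s * x + t * (a * x + b * y)   ≈⟨ +-congˡ (*-congˡ (sym z≈)) ⟩
    s * x + t * z                 ≈⟨ e ⟩
    1#                            ∎)

record Hom (R S : Ring) : Set where
  private
    module R = CommutativeRing R
    module S = CommutativeRing S
  field
    ⟦_⟧    : R.Carrier → S.Carrier
    ⟦⟧-cong : ∀ {x y} → x R.≈ y → ⟦ x ⟧ S.≈ ⟦ y ⟧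
    +-homo : ∀ x y → ⟦ x R.+ y ⟧ S.≈ ⟦ x ⟧ S.+ ⟦ y ⟧
    *-homo : ∀ x y → ⟦ x R.* y ⟧ S.≈ ⟦ x ⟧ S.* ⟦ y ⟧
    0-homo : ⟦ R.0# ⟧ S.≈ S.0#
    1-homo : ⟦ R.1# ⟧ S.≈ S.1#

  open import Algebra.Properties.CommutativeSemiring.Exp R.commutativeSemiring using () renaming (_^_ to _^ᴿ_)
  open import Algebra.Properties.CommutativeSemiring.Exp S.commutativeSemiring using () renaming (_^_ to _^ˢ_)

  ^-homo : ∀ x n → ⟦ x ^ᴿ n ⟧ S.≈ ⟦ x ⟧ ^ˢ n
  ^-homo x zero    = 1-homo
  ^-homo x (suc n) = S.trans (*-homo x (x ^ᴿ n)) (S.*-congˡ (^-homo x n))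

  -‿homo : ∀ x → ⟦ R.- x ⟧ S.≈ S.- ⟦ x ⟧
  -‿homo x = inverseʳ-unique ⟦ x ⟧ ⟦ R.- x ⟧
    (S.trans (S.sym (+-homo x (R.- x))) (S.trans (⟦⟧-cong (R.-‿inverseʳ x)) 0-homo))
    where open import Algebra.Properties.Group S.+-group using (inverseʳ-unique)

  sub-homo : ∀ x y → ⟦ x R.- y ⟧ S.≈ ⟦ x ⟧ S.- ⟦ y ⟧
  sub-homo x y = S.trans (+-homo x (R.- y)) (S.+-congˡ (-‿homo y))

idHom : ∀ R → Hom R R
idHom R = record { ⟦_⟧ = λ x → x ; ⟦⟧-cong = λ e → e ; +-homo = λ _ _ → refl ; *-homo = λ _ _ → refl ; 0-homo = refl ; 1-homo = refl }
  where open CommutativeRing R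

infixr 9 _∘ʰ_
_∘ʰ_ : ∀ {R S T} → Hom S T → Hom R S → Hom R T
_∘ʰ_ {R} {S} {T} g f = record
  { ⟦_⟧ = λ x → G.⟦ F.⟦ x ⟧ ⟧
  ; ⟦⟧-cong = λ e → G.⟦⟧-cong (F.⟦⟧-cong e)
  ; +-homo = λ x y → trans (G.⟦⟧-cong (F.+-homo x y)) (G.+-homo _ _)
  ; *-homo = λ x y → trans (G.⟦⟧-cong (F.*-homo x y)) (G.*-homo _ _)
  ; 0-homo = trans (G.⟦⟧-cong F.0-homo) G.0-homo
  ; 1-homo = trans (G.⟦⟧-cong F.1-homo) G.1-homo
  }
  where
  open CommutativeRing T
  module G = Hom g
  module F = Hom f

-- Polynomials over a commutative ring and their evaluation

module Polynomials (R : Ring) where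
  open CommutativeRing R
  open IntegerSolver R
  open import Algebra.Properties.Ring ring using (-0#≈0#)
  open import Relation.Binary.Reasoning.Setoid setoid

  Poly : Set
  Poly = List Carrier

  coef : Poly → ℕ → Carrier
  coef []      _       = 0#
  coef (a ∷ p) zero    = a
  coef (a ∷ p) (suc n) = coef p n

  infix 4 _≈ₚ_
  -- Trailing zeros cannot be stripped, as a general ring has no zero test (it may itself be a ring
  -- of polynomials). Lists therefore represent polynomials non-uniquely and are compared by
  -- coefficients.
  record _≈ₚ_ (p q : Poly) : Set where
    constructor mk
    field at : ∀ n → coef p n ≈ coef q n
  open _≈ₚ_ public

  infixl 6 _+ₚ_
  infixl 7 _*ₚ_ _·_

  C : Carrier → Poly
  C a = a ∷ []

  Series : Set
  Series = ℕ → Carrier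

  tail : Series → Series
  tail A n = A (suc n)

  infixl 7 _⊛_
  -- The Cauchy product, by recursion on the index. For infinite sequences the ring laws involve no
  -- case distinction on lengths; `coef-*` transfers them to lists.
  _⊛_ : Series → Series → Series
  (A ⊛ B) zero    = A 0 * B 0
  (A ⊛ B) (suc n) = A 0 * B (suc n) + (tail A ⊛ B) n

  ⊛-cong : ∀ {A A′ B B′} → (∀ n → A n ≈ A′ n) → (∀ n → B n ≈ B′ n) → ∀ n → (A ⊛ B) n ≈ (A′ ⊛ B′) n
  ⊛-cong a b zero    = *-cong (a 0) (b 0)
  ⊛-cong a b (suc n) = +-cong (*-cong (a 0) (b (suc n))) (⊛-cong (λ k → a (suc k)) b n)

  ⊛-zeroˡ : ∀ {A} → (∀ n → A n ≈ 0#) → ∀ B n → (A ⊛ B) n ≈ 0#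
  ⊛-zeroˡ z B zero    = trans (*-congʳ (z 0)) (zeroˡ _)
  ⊛-zeroˡ z B (suc n) = trans (+-cong (trans (*-congʳ (z 0)) (zeroˡ _)) (⊛-zeroˡ (λ k → z (suc k)) B n)) (+-identityˡ _)

  ⊛-distribʳ : ∀ A A′ B n → ((λ k → A k + A′ k) ⊛ B) n ≈ (A ⊛ B) n + (A′ ⊛ B) n
  ⊛-distribʳ A A′ B zero    = distribʳ _ _ _
  ⊛-distribʳ A A′ B (suc n) = trans (+-congˡ (⊛-distribʳ (tail A) (tail A′) B n))
    (solve 5 (λ a a′ b x y → (a :+ a′) :* b :+ (x :+ y) := (a :* b :+ x) :+ (a′ :* b :+ y)) refl (A 0) (A′ 0) (B (suc n)) _ _)

  ⊛-scaleˡ : ∀ a A B n → ((λ k → a * A k) ⊛ B) n ≈ a * (A ⊛ B) n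
  ⊛-scaleˡ a A B zero    = *-assoc _ _ _
  ⊛-scaleˡ a A B (suc n) = trans (+-congˡ (⊛-scaleˡ a (tail A) B n))
    (solve 4 (λ a x y z → a :* x :* y :+ a :* z := a :* (x :* y :+ z)) refl a (A 0) (B (suc n)) _)

  ⊛-suc : ∀ A B n → (A ⊛ B) (suc n) ≈ (A ⊛ tail B) n + A (suc n) * B 0
  ⊛-suc A B zero    = refl
  ⊛-suc A B (suc n) = trans (+-congˡ (⊛-suc (tail A) B n)) (sym (+-assoc _ _ _))

  ⊛-comm : ∀ A B n → (A ⊛ B) n ≈ (B ⊛ A) n
  ⊛-comm A B zero    = *-comm _ _
  ⊛-comm A B (suc n) = begin
    A 0 * B (suc n) + (tail A ⊛ B) n   ≈⟨ +-cong (*-comm _ _) (⊛-comm (tail A) B n) ⟩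
    B (suc n) * A 0 + (B ⊛ tail A) n   ≈⟨ +-comm _ _ ⟩
    (B ⊛ tail A) n + B (suc n) * A 0   ≈⟨ sym (⊛-suc B A n) ⟩
    (B ⊛ A) (suc n)                    ∎

  ⊛-assoc : ∀ A B D n → ((A ⊛ B) ⊛ D) n ≈ (A ⊛ (B ⊛ D)) n
  ⊛-assoc A B D zero    = *-assoc _ _ _
  ⊛-assoc A B D (suc n) = begin
    A 0 * B 0 * D (suc n) + (tail (A ⊛ B) ⊛ D) n
      ≈⟨ +-congˡ (⊛-distribʳ (λ k → A 0 * tail B k) (tail A ⊛ B) D n) ⟩
    A 0 * B 0 * D (suc n) + (((λ k → A 0 * tail B k) ⊛ D) n + ((tail A ⊛ B) ⊛ D) n)
      ≈⟨ +-congˡ (+-cong (⊛-scaleˡ (A 0) (tail B) D n) (⊛-assoc (tail A) B D n)) ⟩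
    A 0 * B 0 * D (suc n) + (A 0 * (tail B ⊛ D) n + (tail A ⊛ (B ⊛ D)) n)
      ≈⟨ solve 5 (λ a b d x y → a :* b :* d :+ (a :* x :+ y) := a :* (b :* d :+ x) :+ y) refl (A 0) (B 0) (D (suc n)) _ _ ⟩
    A 0 * (B ⊛ D) (suc n) + (tail A ⊛ (B ⊛ D)) n ∎

  opaque
    _+ₚ_ : Poly → Poly → Poly
    []      +ₚ q       = q
    (a ∷ p) +ₚ []      = a ∷ p
    (a ∷ p) +ₚ (b ∷ q) = a + b ∷ p +ₚ q

    -ₚ_ : Poly → Poly
    -ₚ_ = map (λ a → - a)

    _·_ : Carrier → Poly → Poly
    a · p = map (a *_) p

    _*ₚ_ : Poly → Poly → Poly
    []      *ₚ q = []
    (a ∷ p) *ₚ q = a · q +ₚ (0# ∷ p *ₚ q)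

    X : Poly
    X = 0# ∷ 1# ∷ []

    X-Deg< : length X ℕ.≤ 2
    X-Deg< = s≤s (s≤s z≤n)

    coef-+ : ∀ p q n → coef (p +ₚ q) n ≈ coef p n + coef q n
    coef-+ []      q       n       = sym (+-identityˡ _)
    coef-+ (a ∷ p) []      n       = sym (+-identityʳ _)
    coef-+ (a ∷ p) (b ∷ q) zero    = refl
    coef-+ (a ∷ p) (b ∷ q) (suc n) = coef-+ p q n

    coef-neg : ∀ p n → coef (-ₚ p) n ≈ - coef p n
    coef-neg []      n       = sym -0#≈0#
    coef-neg (a ∷ p) zero    = refl
    coef-neg (a ∷ p) (suc n) = coef-neg p n

    coef-· : ∀ a p n → coef (a · p) n ≈ a * coef p n
    coef-· a []      n       = sym (zeroʳ a)
    coef-· a (b ∷ p) zero    = refl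
    coef-· a (b ∷ p) (suc n) = coef-· a p n

    coef-* : ∀ p q n → coef (p *ₚ q) n ≈ (coef p ⊛ coef q) n
    coef-* []      q n       = sym (⊛-zeroˡ (λ _ → refl) (coef q) n)
    coef-* (a ∷ p) q zero    = trans (coef-+ (a · q) _ 0) (trans (+-identityʳ _) (coef-· a q 0))
    coef-* (a ∷ p) q (suc n) = trans (coef-+ (a · q) _ (suc n)) (+-cong (coef-· a q (suc n)) (coef-* p q n))

    ≈ₚ-refl : ∀ {p} → p ≈ₚ p
    ≈ₚ-refl = mk λ _ → refl

    ≈ₚ-sym : ∀ {p q} → p ≈ₚ q → q ≈ₚ p
    ≈ₚ-sym (mk e) = mk λ n → sym (e n)

    ≈ₚ-trans : ∀ {p q r} → p ≈ₚ q → q ≈ₚ r → p ≈ₚ r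
    ≈ₚ-trans (mk e) (mk f) = mk λ n → trans (e n) (f n)

    *ₚ-cong : ∀ {p p′ q q′} → p ≈ₚ p′ → q ≈ₚ q′ → p *ₚ q ≈ₚ p′ *ₚ q′
    *ₚ-cong {p} {p′} {q} {q′} (mk e) (mk f) = mk λ n →
      trans (coef-* p q n) (trans (⊛-cong e f n) (sym (coef-* p′ q′ n)))

    *ₚ-comm : ∀ p q → p *ₚ q ≈ₚ q *ₚ p
    *ₚ-comm p q = mk λ n → trans (coef-* p q n) (trans (⊛-comm (coef p) (coef q) n) (sym (coef-* q p n)))

    *ₚ-distribʳ : ∀ r p q → (p +ₚ q) *ₚ r ≈ₚ p *ₚ r +ₚ q *ₚ r
    *ₚ-distribʳ r p q = mk λ n → begin
      coef ((p +ₚ q) *ₚ r) n                           ≈⟨ coef-* (p +ₚ q) r n ⟩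
      (coef (p +ₚ q) ⊛ coef r) n                       ≈⟨ ⊛-cong (coef-+ p q) (λ _ → refl) n ⟩
      ((λ k → coef p k + coef q k) ⊛ coef r) n         ≈⟨ ⊛-distribʳ (coef p) (coef q) (coef r) n ⟩
      (coef p ⊛ coef r) n + (coef q ⊛ coef r) n        ≈⟨ +-cong (sym (coef-* p r n)) (sym (coef-* q r n)) ⟩
      coef (p *ₚ r) n + coef (q *ₚ r) n                ≈⟨ sym (coef-+ (p *ₚ r) (q *ₚ r) n) ⟩
      coef (p *ₚ r +ₚ q *ₚ r) n                        ∎

    *ₚ-assoc : ∀ p q r → (p *ₚ q) *ₚ r ≈ₚ p *ₚ (q *ₚ r)
    *ₚ-assoc p q r = mk λ n → begin
      coef ((p *ₚ q) *ₚ r) n             ≈⟨ coef-* (p *ₚ q) r n ⟩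
      (coef (p *ₚ q) ⊛ coef r) n         ≈⟨ ⊛-cong (coef-* p q) (λ _ → refl) n ⟩
      ((coef p ⊛ coef q) ⊛ coef r) n     ≈⟨ ⊛-assoc (coef p) (coef q) (coef r) n ⟩
      (coef p ⊛ (coef q ⊛ coef r)) n     ≈⟨ ⊛-cong (λ _ → refl) (λ k → sym (coef-* q r k)) n ⟩
      (coef p ⊛ coef (q *ₚ r)) n         ≈⟨ sym (coef-* p (q *ₚ r) n) ⟩
      coef (p *ₚ (q *ₚ r)) n             ∎

    C-* : ∀ a q → C a *ₚ q ≈ₚ a · q
    C-* a q = mk λ n → trans (coef-+ (a · q) (0# ∷ []) n) (trans (+-congˡ (coef-0∷[] n)) (+-identityʳ _))
      where
      coef-0∷[] : ∀ n → coef (0# ∷ []) n ≈ 0#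
      coef-0∷[] zero    = refl
      coef-0∷[] (suc n) = refl

    *ₚ-identityˡ : ∀ p → C 1# *ₚ p ≈ₚ p
    *ₚ-identityˡ p = ≈ₚ-trans (C-* 1# p) (mk λ n → trans (coef-· 1# p n) (*-identityˡ _))

    +ₚ-comm : ∀ p q → p +ₚ q ≈ₚ q +ₚ p
    +ₚ-comm p q = mk λ n → trans (coef-+ p q n) (trans (+-comm _ _) (sym (coef-+ q p n)))

    isCR : IsCommutativeRing _≈ₚ_ _+ₚ_ _*ₚ_ -ₚ_ [] (C 1#)
    isCR = record
      { isRing = record
        { +-isAbelianGroup = record
          { isGroup = record
            { isMonoid = record
              { isSemigroup = record
                { isMagma = record
                  { isEquivalence = record { refl = ≈ₚ-refl ; sym = ≈ₚ-sym ; trans = ≈ₚ-trans }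
                  ; ∙-cong = λ {p} {p′} {q} {q′} e f → mk λ n →
                      trans (coef-+ p q n) (trans (+-cong (at e n) (at f n)) (sym (coef-+ p′ q′ n)))
                  }
                ; assoc = λ p q r → mk λ n → begin
                    coef (p +ₚ q +ₚ r) n              ≈⟨ trans (coef-+ (p +ₚ q) r n) (+-congʳ (coef-+ p q n)) ⟩
                    coef p n + coef q n + coef r n    ≈⟨ +-assoc _ _ _ ⟩
                    coef p n + (coef q n + coef r n)  ≈⟨ sym (trans (coef-+ p (q +ₚ r) n) (+-congˡ (coef-+ q r n))) ⟩
                    coef (p +ₚ (q +ₚ r)) n            ∎
                }
              ; identity = (λ p → ≈ₚ-refl) , (λ p → +ₚ-comm p [])
              }
            ; inverse = (λ p → mk λ n → trans (coef-+ (-ₚ p) p n) (trans (+-congʳ (coef-neg p n)) (-‿inverseˡ _)))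
                      , (λ p → mk λ n → trans (coef-+ p (-ₚ p) n) (trans (+-congˡ (coef-neg p n)) (-‿inverseʳ _)))
            ; ⁻¹-cong = λ {p} {q} e → mk λ n → trans (coef-neg p n) (trans (-‿cong (at e n)) (sym (coef-neg q n)))
            }
          ; comm = +ₚ-comm
          }
        ; *-cong = *ₚ-cong
        ; *-assoc = *ₚ-assoc
        ; *-identity = *ₚ-identityˡ , (λ p → ≈ₚ-trans (*ₚ-comm p (C 1#)) (*ₚ-identityˡ p))
        ; distrib = (λ r p q → ≈ₚ-trans (*ₚ-comm r (p +ₚ q)) (≈ₚ-trans (*ₚ-distribʳ r p q)
                       (mk λ n → trans (coef-+ (p *ₚ r) (q *ₚ r) n)
                         (trans (+-cong (at (*ₚ-comm p r) n) (at (*ₚ-comm q r) n)) (sym (coef-+ (r *ₚ p) (r *ₚ q) n))))))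
                  , *ₚ-distribʳ
        }
      ; *-comm = *ₚ-comm
      }

  polyRing : Ring
  polyRing = record { isCommutativeRing = isCR }

  opaque
    unfolding _+ₚ_ _*ₚ_ _·_

    C-+-homo : ∀ x y → C (x + y) ≈ₚ C x +ₚ C y
    C-+-homo x y = ≈ₚ-refl

    C-*-homo : ∀ x y → C (x * y) ≈ₚ C x *ₚ C y
    C-*-homo x y = ≈ₚ-sym (C-* x (C y))

  constants : Hom R polyRing
  constants = record
    { ⟦_⟧ = C
    ; ⟦⟧-cong = λ e → mk λ { zero → e ; (suc n) → refl }
    ; +-homo = C-+-homo
    ; *-homo = C-*-homo
    ; 0-homo = mk λ { zero → refl ; (suc n) → refl }
    ; 1-homo = ≈ₚ-refl
    }

  private module P = CommutativeRing polyRing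

  opaque
    unfolding _+ₚ_ _*ₚ_ _·_ X

    shift : ∀ p → 0# ∷ p ≈ₚ X *ₚ p
    shift p = mk λ n → sym (begin
      coef (X *ₚ p) n                            ≈⟨ coef-+ (0# · p) _ n ⟩
      coef (0# · p) n + coef (0# ∷ C 1# *ₚ p) n  ≈⟨ +-cong (trans (coef-· 0# p n) (zeroˡ _)) (rest n) ⟩
      0# + coef (0# ∷ p) n                       ≈⟨ +-identityˡ _ ⟩
      coef (0# ∷ p) n                            ∎)
      where
      rest : ∀ n → coef (0# ∷ C 1# *ₚ p) n ≈ coef (0# ∷ p) n
      rest zero    = refl
      rest (suc n) = at (*ₚ-identityˡ p) n

    horner : ∀ a p → a ∷ p ≈ₚ C a +ₚ X *ₚ p
    horner a p = P.trans (mk λ { zero → sym (+-identityʳ a) ; (suc n) → refl }) (P.+-congˡ {C a} (shift p))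

  open import Algebra.Properties.CommutativeSemiring.Exp P.commutativeSemiring using () renaming (_^_ to _^ₚ_)
  open Divisibility polyRing using (_∥_; divides)

  X^-divides : ∀ M p → (∀ l → l ℕ.< M → coef p l ≈ 0#) → X ^ₚ M ∥ p
  X^-divides zero    p       z = divides p (P.sym (P.*-identityˡ p))
  X^-divides (suc M) []      z = divides [] (P.sym (P.zeroʳ (X ^ₚ suc M)))
  X^-divides (suc M) (a ∷ p) z with X^-divides M p (λ l l<M → z (suc l) (s≤s l<M))
  ... | divides k e = divides k (P.trans (mk λ { zero → z 0 (s≤s z≤n) ; (suc n) → refl })
                        (P.trans (shift p) (P.trans (P.*-congˡ {X} e) (P.sym (P.*-assoc X (X ^ₚ M) k)))))

  coef-X^* : ∀ M p l → l ℕ.< M → coef (X ^ₚ M *ₚ p) l ≈ 0#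
  coef-X^* (suc M) p l       l<M with at (P.trans (P.*-assoc X (X ^ₚ M) p) (P.sym (shift (X ^ₚ M *ₚ p)))) l
  coef-X^* (suc M) p zero    l<M       | e = e
  coef-X^* (suc M) p (suc l) (s≤s l<M) | e = trans e (coef-X^* M p l l<M)

  X^*-cancel : ∀ M p → X ^ₚ M *ₚ p ≈ₚ [] → p ≈ₚ []
  X^*-cancel zero    p e = P.trans (P.sym (P.*-identityˡ p)) e
  X^*-cancel (suc M) p e = X^*-cancel M p (mk λ n →
    at (P.trans (shift (X ^ₚ M *ₚ p)) (P.trans (P.sym (P.*-assoc X (X ^ₚ M) p)) e)) (suc n))

  opaque
    unfolding _+ₚ_ _*ₚ_ _·_ -ₚ_

    length-+ : ∀ {n} p q → length p ℕ.≤ n → length q ℕ.≤ n → length (p +ₚ q) ℕ.≤ n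
    length-+ []      q       a       b       = b
    length-+ (_ ∷ p) []      a       b       = a
    length-+ (_ ∷ p) (_ ∷ q) (s≤s a) (s≤s b) = s≤s (length-+ p q a b)

    length-· : ∀ {n} a p → length p ℕ.≤ n → length (a · p) ℕ.≤ n
    length-· a []      l       = z≤n
    length-· a (b ∷ p) (s≤s l) = s≤s (length-· a p l)

    length-neg : ∀ {n} p → length p ℕ.≤ n → length (-ₚ p) ℕ.≤ n
    length-neg []      l       = z≤n
    length-neg (b ∷ p) (s≤s l) = s≤s (length-neg p l)

    length-* : ∀ {m n} p q → length p ℕ.≤ suc m → length q ℕ.≤ suc n → length (p *ₚ q) ℕ.≤ suc (m ℕ.+ n)
    length-* []      q a b = z≤n
    length-* {m} {n} (c ∷ []) q a b =
      length-+ (c · q) (0# ∷ []) (length-· c q (ℕₚ.≤-trans b (s≤s (ℕₚ.m≤n+m n m)))) (s≤s z≤n)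
    length-* {suc m} {n} (c ∷ p@(_ ∷ _)) q (s≤s a) b =
      length-+ (c · q) (0# ∷ p *ₚ q) (length-· c q (ℕₚ.≤-trans b (s≤s (ℕₚ.m≤n+m n (suc m))))) (s≤s (length-* p q a b))

  length-^ : ∀ {m} p k → length p ℕ.≤ suc m → length (p ^ₚ k) ℕ.≤ suc (k ℕ.* m)
  length-^     p zero    l = s≤s z≤n
  length-^ {m} p (suc k) l = length-* p (p ^ₚ k) l (length-^ {m} p k l)

  -- A bound on `length` sees trailing zeros, this one is invariant under `≈ₚ`. Lengths control
  -- polynomials that are constructed explicitly, `Deg<` serves when a factor is divided out.
  Deg< : ℕ → Poly → Set
  Deg< D p = ∀ n → D ℕ.≤ n → coef p n ≈ 0#

  Deg<-length : ∀ {D} p → length p ℕ.≤ D → Deg< D p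
  Deg<-length []      _       _       _       = refl
  Deg<-length (a ∷ p) (s≤s l) (suc n) (s≤s d) = Deg<-length p l n d

  Deg<-resp : ∀ {D p q} → p ≈ₚ q → Deg< D p → Deg< D q
  Deg<-resp e d n D≤n = trans (sym (at e n)) (d n D≤n)

  Deg<-mono : ∀ {D E p} → D ℕ.≤ E → Deg< D p → Deg< E p
  Deg<-mono D≤E d n E≤n = d n (ℕₚ.≤-trans D≤E E≤n)

  Deg<0 : ∀ {p} → Deg< 0 p → p ≈ₚ []
  Deg<0 d = mk λ n → d n z≤n

  ⊛-top : ∀ k n {A B} → (∀ i → k ℕ.< i → A i ≈ 0#) → (∀ i → n ℕ.< i → B i ≈ 0#) → (A ⊛ B) (k ℕ.+ n) ≈ A k * B n
  ⊛-top zero    zero    a b = refl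
  ⊛-top zero    (suc n) {A} {B} a b = trans (+-congˡ (⊛-zeroˡ (λ i → a (suc i) (s≤s z≤n)) B n)) (+-identityʳ _)
  ⊛-top (suc k) n {A} {B} a b = begin
    A 0 * B (suc (k ℕ.+ n)) + (tail A ⊛ B) (k ℕ.+ n)
      ≈⟨ +-cong (trans (*-congˡ (b (suc (k ℕ.+ n)) (s≤s (ℕₚ.m≤n+m n k)))) (zeroʳ _)) (⊛-top k n (λ i k<i → a (suc i) (s≤s k<i)) b) ⟩
    0# + A (suc k) * B n   ≈⟨ +-identityˡ _ ⟩
    A (suc k) * B n        ∎

module Evaluation {R S : Ring} (ι : Hom R S) (s : CommutativeRing.Carrier S) where
  private module R = CommutativeRing R
  open CommutativeRing S
  open IntegerSolver S
  open Polynomials R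
  open Hom ι
  open import Relation.Binary.Reasoning.Setoid setoid

  ev : Poly → Carrier
  ev []      = 0#
  ev (a ∷ p) = ⟦ a ⟧ + s * ev p

  ev-cong : ∀ p q → p ≈ₚ q → ev p ≈ ev q
  ev-cong []      []      e = refl
  ev-cong []      (b ∷ q) e = sym (trans (+-cong (trans (⟦⟧-cong (R.sym (at e 0))) 0-homo)
                                (trans (*-congˡ (sym (ev-cong [] q (mk λ n → at e (suc n))))) (zeroʳ s))) (+-identityˡ 0#))
  ev-cong (a ∷ p) []      e = trans (+-cong (trans (⟦⟧-cong (at e 0)) 0-homo)
                                (trans (*-congˡ (ev-cong p [] (mk λ n → at e (suc n)))) (zeroʳ s))) (+-identityˡ 0#)
  ev-cong (a ∷ p) (b ∷ q) e = +-cong (⟦⟧-cong (at e 0)) (*-congˡ (ev-cong p q (mk λ n → at e (suc n))))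

  opaque
    unfolding _+ₚ_ _*ₚ_ _·_

    ev-+ : ∀ p q → ev (p +ₚ q) ≈ ev p + ev q
    ev-+ []      q       = sym (+-identityˡ _)
    ev-+ (a ∷ p) []      = sym (+-identityʳ _)
    ev-+ (a ∷ p) (b ∷ q) = trans (+-cong (+-homo a b) (*-congˡ (ev-+ p q)))
      (solve 5 (λ a b s x y → (a :+ b) :+ s :* (x :+ y) := (a :+ s :* x) :+ (b :+ s :* y)) refl ⟦ a ⟧ ⟦ b ⟧ s (ev p) (ev q))

    ev-· : ∀ a p → ev (a · p) ≈ ⟦ a ⟧ * ev p
    ev-· a []      = sym (zeroʳ _)
    ev-· a (b ∷ p) = trans (+-cong (*-homo a b) (*-congˡ (ev-· a p)))
      (solve 4 (λ a b s x → a :* b :+ s :* (a :* x) := a :* (b :+ s :* x)) refl ⟦ a ⟧ ⟦ b ⟧ s (ev p))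

    ev-* : ∀ p q → ev (p *ₚ q) ≈ ev p * ev q
    ev-* []      q = sym (zeroˡ _)
    ev-* (a ∷ p) q = begin
      ev (a · q +ₚ (R.0# ∷ p *ₚ q))           ≈⟨ ev-+ (a · q) _ ⟩
      ev (a · q) + (⟦ R.0# ⟧ + s * ev (p *ₚ q)) ≈⟨ +-cong (ev-· a q) (+-cong 0-homo (*-congˡ (ev-* p q))) ⟩
      ⟦ a ⟧ * ev q + (0# + s * (ev p * ev q)) ≈⟨ solve 4 (λ a x s y → a :* x :+ (κ 0 :+ s :* (y :* x)) := (a :+ s :* y) :* x) refl ⟦ a ⟧ (ev q) s (ev p) ⟩
      (⟦ a ⟧ + s * ev p) * ev q               ∎

  ev-C : ∀ a → ev (C a) ≈ ⟦ a ⟧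
  ev-C a = trans (+-congˡ (zeroʳ s)) (+-identityʳ _)

  opaque
    unfolding X

    ev-X : ev X ≈ s
    ev-X = trans (+-cong 0-homo (*-congˡ (ev-C R.1#))) (trans (+-identityˡ _) (trans (*-congˡ 1-homo) (*-identityʳ s)))

  evHom : Hom polyRing S
  evHom = record
    { ⟦_⟧ = ev ; ⟦⟧-cong = ev-cong _ _ ; +-homo = ev-+ ; *-homo = ev-* ; 0-homo = refl
    ; 1-homo = trans (ev-C R.1#) 1-homo }

ev-natural : ∀ {R S T} (ι : Hom R S) (θ : Hom S T) (ι′ : Hom R T) s t →
  let open CommutativeRing T in
  (∀ a → Hom.⟦_⟧ θ (Hom.⟦_⟧ ι a) ≈ Hom.⟦_⟧ ι′ a) → Hom.⟦_⟧ θ s ≈ t →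
  ∀ p → Hom.⟦_⟧ θ (Evaluation.ev ι s p) ≈ Evaluation.ev ι′ t p
ev-natural {T = T} ι θ ι′ s t e f []      = Hom.0-homo θ
ev-natural {T = T} ι θ ι′ s t e f (a ∷ p) =
  trans (Hom.+-homo θ _ _) (+-cong (e a) (trans (Hom.*-homo θ _ _) (*-cong f (ev-natural ι θ ι′ s t e f p))))
  where open CommutativeRing T

ev-X-id : ∀ R → let open Polynomials R in ∀ p → Evaluation.ev constants X p ≈ₚ p
ev-X-id R []      = Polynomials.≈ₚ-refl R
ev-X-id R (a ∷ p) = P.trans (P.+-congˡ {C a} (P.*-congˡ {X} (ev-X-id R p))) (P.sym (horner a p))
  where
  open Polynomials R
  module P = CommutativeRing polyRing

-- Finite fields, roots of polynomials, and quadratics as simple factors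

module Field (K : FiniteField) where
  open FiniteField K public

  KR : Ring
  KR = record { isCommutativeRing = isCommutativeRing }

  open CommutativeRing KR public
    using (*-comm; *-assoc; +-comm; +-assoc; *-identityˡ; *-identityʳ; +-identityˡ; +-identityʳ; zeroˡ; zeroʳ
          ; commutativeSemiring; +-commutativeMonoid; *-commutativeMonoid; semiring; distribˡ; distribʳ; -‿inverseʳ; -‿inverseˡ)
  open import Algebra.Properties.CommutativeSemiring.Exp commutativeSemiring public using (_^_; ^-homo-*; ^-distrib-*; ^-assocʳ)
  open IntegerSolver KR public using () renaming (solve to ring)
  open ≡ using (refl; sym; trans; cong; cong₂) public

  *-cancelˡ : ∀ {a x y} → a ≢ 0# → a * x ≡ a * y → x ≡ y
  *-cancelˡ {a} {x} {y} a≢0 e = trans (lem x) (trans (cong (a ⁻¹ *_) e) (sym (lem y)))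
    where
    lem : ∀ z → z ≡ a ⁻¹ * (a * z)
    lem z = trans (trans (sym (*-identityˡ z)) (cong (_* z) (trans (sym (inverseʳ a a≢0)) (*-comm a _)))) (*-assoc _ _ _)

  *-zero : ∀ {a x} → a ≢ 0# → a * x ≡ 0# → x ≡ 0#
  *-zero a≢0 e = *-cancelˡ a≢0 (trans e (sym (zeroʳ _)))

  *≢0 : ∀ {x y} → x ≢ 0# → y ≢ 0# → x * y ≢ 0#
  *≢0 x≢0 y≢0 e = y≢0 (*-zero x≢0 e)

  *≢0⁻¹ˡ : ∀ {x y} → x * y ≢ 0# → x ≢ 0#
  *≢0⁻¹ˡ {y = y} n e = n (trans (cong (_* y) e) (zeroˡ y))

  square≡0 : ∀ {x} → x * x ≡ 0# → x ≡ 0#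
  square≡0 {x} e with x ≟ 0#
  ... | yes x≡0 = x≡0
  ... | no x≢0  = *-zero x≢0 e

  -≡0 : ∀ {x y} → x - y ≡ 0# → x ≡ y
  -≡0 {x} {y} e = trans (ring 2 (λ x y → x := (x :- y) :+ y) refl x y) (trans (cong (_+ y) e) (+-identityˡ y))

  ≡-0 : ∀ {x y} → x ≡ y → x - y ≡ 0#
  ≡-0 {x} refl = -‿inverseʳ x

  -x≢0 : ∀ {x} → x ≢ 0# → - x ≢ 0#
  -x≢0 {x} n e = n (trans (ring 1 (λ x → x := :- (:- x)) refl x) (trans (cong -_ e) (ring 0 (:- κ 0 := κ 0) refl)))

  ^≢0 : ∀ {x} n → x ≢ 0# → x ^ n ≢ 0#
  ^≢0 zero    _   e = 0≢1 (sym e)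
  ^≢0 (suc n) x≢0   = *≢0 x≢0 (^≢0 n x≢0)

module FieldPoly (K : FiniteField) where
  open Field K
  open Polynomials KR public
  module P = CommutativeRing polyRing
  open import Algebra.Properties.CommutativeSemiring.Exp P.commutativeSemiring public
    using () renaming (_^_ to _^ₚ_; ^-distrib-* to ^ₚ-distrib-*; ^-homo-* to ^ₚ-homo-*; ^-congˡ to ^ₚ-cong)
  open Divisibility polyRing public
  open IntegerSolver polyRing public using () renaming (solve to ringₚ)
  open Evaluation (idHom KR) public using () renaming (ev to eval; evHom to evalHom; ev-* to eval-*; ev-C to eval-C)
  module C = Hom constants
  open import Relation.Binary.Reasoning.Setoid P.setoid

  -- Descent from the length of t: the top coefficient of t, multiplied by `coef h k`, is the top
  -- coefficient of the product, and it vanishes as long as its index is beyond the bound.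
  Deg<-cancel : ∀ {h} k → Deg< (suc k) h → coef h k ≢ 0# →
                ∀ D t → Deg< (k ℕ.+ D) (h *ₚ t) → Deg< D t
  Deg<-cancel {h} k dh lead D t d = down (length t) (Deg<-mono {p = t} (ℕₚ.m≤n+m _ D) (Deg<-length t ℕₚ.≤-refl))
    where
    down : ∀ j → Deg< (D ℕ.+ j) t → Deg< D t
    down zero    dt = ≡.subst (λ E → Deg< E t) (ℕₚ.+-identityʳ D) dt
    down (suc j) dt = down j dt′
      where
      top : coef h k * coef t (D ℕ.+ j) ≡ 0#
      top = trans (sym (⊛-top k (D ℕ.+ j) dh (λ i l → dt i (≡.subst (ℕ._≤ i) (sym (ℕₚ.+-suc D j)) l))))
              (trans (sym (coef-* h t _)) (d _ (ℕₚ.+-monoʳ-≤ k (ℕₚ.m≤m+n D j))))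
      dt′ : Deg< (D ℕ.+ j) t
      dt′ n l with ℕₚ.m≤n⇒m<n∨m≡n l
      ... | inj₁ l′   = dt n (≡.subst (ℕ._≤ n) (sym (ℕₚ.+-suc D j)) l′)
      ... | inj₂ refl = *-zero lead top

  cancel-zero : ∀ {h} k → Deg< (suc k) h → coef h k ≢ 0# → ∀ t → h *ₚ t ≈ₚ [] → t ≈ₚ []
  cancel-zero k dh lead t e = Deg<0 (Deg<-cancel k dh lead 0 t (λ n _ → at e n))

  Coprime-unit : ∀ {p q} s t c → c ≢ 0# → s *ₚ p +ₚ t *ₚ q ≈ₚ C c → Coprime p q
  Coprime-unit {p} {q} s t c c≢0 e = bezout (C (c ⁻¹) *ₚ s) (C (c ⁻¹) *ₚ t) (begin
    C (c ⁻¹) *ₚ s *ₚ p +ₚ C (c ⁻¹) *ₚ t *ₚ q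
      ≈⟨ ringₚ 5 (λ k s t p q → k :* s :* p :+ k :* t :* q := k :* (s :* p :+ t :* q)) P.refl (C (c ⁻¹)) s t p q ⟩
    C (c ⁻¹) *ₚ (s *ₚ p +ₚ t *ₚ q)   ≈⟨ P.*-congˡ e ⟩
    C (c ⁻¹) *ₚ C c                  ≈⟨ P.sym (C.*-homo (c ⁻¹) c) ⟩
    C (c ⁻¹ * c)                     ≈⟨ C.⟦⟧-cong (trans (*-comm _ c) (inverseʳ c c≢0)) ⟩
    C 1#                             ∎)

  lin : Carrier → Poly
  lin a = - a ∷ 1# ∷ []

  lin-Deg : ∀ a → Deg< 2 (lin a)
  lin-Deg a = Deg<-length (lin a) ℕₚ.≤-refl

  opaque
   unfolding _+ₚ_ _*ₚ_ _·_ -ₚ_ X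

   lin≈ : ∀ a → lin a ≈ₚ X +ₚ P.- C a
   lin≈ a = mk λ { zero → sym (+-identityˡ _) ; (suc zero) → refl ; (suc (suc n)) → refl }

   lin-Coprime : ∀ {a b} → a ≢ b → Coprime (lin a) (lin b)
   lin-Coprime {a} {b} a≢b = Coprime-unit (C 1#) (C (- 1#)) (b - a) (λ e → a≢b (sym (-≡0 e)))
    (mk λ { zero → ring 2 (λ a b → (κ 1 :* (:- a) :+ κ 0) :+ ((:- κ 1) :* (:- b) :+ κ 0) := b :- a) refl a b
          ; (suc zero) → ring 0 (κ 1 :* κ 1 :+ (:- κ 1) :* κ 1 := κ 0) refl ; (suc (suc n)) → refl })

  lin^-Coprime : ∀ {a b} M → a ≢ b → Coprime (lin a ^ₚ M) (lin b ^ₚ M)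
  lin^-Coprime M a≢b = Coprime-^ M (Coprime-sym (Coprime-^ M (Coprime-sym (lin-Coprime a≢b))))

  Deg<-lin^ : ∀ a M D t → Deg< D (lin a ^ₚ M *ₚ t) → Deg< (D ℕ.∸ M) t
  Deg<-lin^ a zero    D t d = Deg<-resp (P.*-identityˡ t) d
  Deg<-lin^ a (suc M) zero    t d =
    ≡.subst (λ E → Deg< E t) (ℕₚ.0∸n≡0 M) (Deg<-lin^ a M 0 t
      (Deg<-cancel 1 (lin-Deg a) (λ e → 0≢1 (sym e)) 0 _ (Deg<-mono {p = lin a *ₚ (lin a ^ₚ M *ₚ t)} z≤n (Deg<-resp (P.*-assoc (lin a) (lin a ^ₚ M) t) d))))
  Deg<-lin^ a (suc M) (suc D) t d = Deg<-lin^ a M D t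
      (Deg<-cancel 1 (lin-Deg a) (λ e → 0≢1 (sym e)) D _ (Deg<-resp (P.*-assoc (lin a) (lin a ^ₚ M) t) d))

  -- Powers of distinct linear factors are coprime, so they can be divided out one after the other.
  -- Each division lowers the degree bound by M, and the hypothesis says that the bound reaches 0.
  many-roots : ∀ M xs → Unique xs → ∀ D p → All (λ x → lin x ^ₚ M ∥ p) xs → Deg< D p →
               D ℕ.≤ length xs ℕ.* M → p ≈ₚ []
  many-roots M []       _         D p _                   d D≤0 = Deg<0 (Deg<-mono {p = p} D≤0 d)
  many-roots M (x ∷ xs) (x∉ ∷ un) D p (divides k e ∷ dvs) d D≤  =
    P.trans e (P.trans (P.*-congˡ k≈0) (P.zeroʳ _))
    where
    dvs′ : ∀ {ys} → All (x ≢_) ys → All (λ y → lin y ^ₚ M ∥ p) ys → All (λ y → lin y ^ₚ M ∥ k) ys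
    dvs′ []       []       = []
    dvs′ (n ∷ ns) (v ∷ vs) = Coprime-cancel (lin^-Coprime M (λ y≡x → n (sym y≡x))) (∥-respʳ e v) ∷ dvs′ ns vs
    k≈0 : k ≈ₚ []
    k≈0 = many-roots M xs un (D ℕ.∸ M) k (dvs′ x∉ dvs) (Deg<-lin^ x M D k (Deg<-resp e d))
            (ℕₚ.≤-trans (ℕₚ.∸-monoˡ-≤ M D≤) (ℕₚ.≤-reflexive (ℕₚ.m+n∸m≡n M (length xs ℕ.* M))))

  remainder : ∀ x p → ∃ λ k → p ≈ₚ lin x *ₚ k +ₚ C (eval x p)
  remainder x []      = [] , P.sym (P.trans (P.+-cong (P.zeroʳ (lin x)) C.0-homo) (P.+-identityˡ []))
  remainder x (a ∷ p) with remainder x p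
  ... | k , e = X *ₚ k +ₚ C r , (begin
    a ∷ p                                        ≈⟨ horner a p ⟩
    C a +ₚ X *ₚ p                                ≈⟨ P.+-congˡ (P.*-congˡ e) ⟩
    C a +ₚ X *ₚ (lin x *ₚ k +ₚ C r)              ≈⟨ ringₚ 6 (λ a x l k r y → a :+ x :* (l :* k :+ r) := l :* (x :* k) :+ (x :- y) :* r :+ (a :+ y :* r)) P.refl (C a) X (lin x) k (C r) (C x) ⟩
    lin x *ₚ (X *ₚ k) +ₚ (X +ₚ P.- C x) *ₚ C r +ₚ (C a +ₚ C x *ₚ C r)
      ≈⟨ P.+-cong (P.+-congˡ (P.*-congʳ (P.sym (lin≈ x)))) (P.sym (P.trans (C.+-homo a (x * r)) (P.+-congˡ (C.*-homo x r)))) ⟩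
    lin x *ₚ (X *ₚ k) +ₚ lin x *ₚ C r +ₚ C (a + x * r)
      ≈⟨ P.+-congʳ (P.sym (P.distribˡ (lin x) (X *ₚ k) (C r))) ⟩
    lin x *ₚ (X *ₚ k +ₚ C r) +ₚ C (a + x * r)    ∎)
    where r = eval x p

  root-divides : ∀ x p → eval x p ≡ 0# → lin x ^ₚ 1 ∥ p
  root-divides x p z with remainder x p
  ... | k , e = divides k (begin
    p                                     ≈⟨ e ⟩
    lin x *ₚ k +ₚ C (eval x p)            ≈⟨ P.+-congˡ (P.trans (C.⟦⟧-cong z) C.0-homo) ⟩
    lin x *ₚ k +ₚ []                      ≈⟨ P.+-identityʳ _ ⟩
    lin x *ₚ k                            ≈⟨ P.*-congʳ (P.sym (P.*-identityʳ (lin x))) ⟩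
    lin x ^ₚ 1 *ₚ k                       ∎)

  roots-bound : ∀ {xs} → Unique xs → ∀ D p → Deg< D p → ¬ (p ≈ₚ []) → All (λ x → eval x p ≡ 0#) xs → length xs ℕ.< D
  roots-bound {xs} un D p d p≉0 zs = ℕₚ.≰⇒> λ D≤ → p≉0
    (many-roots 1 xs un D p (All.map (root-divides _ p) zs) d (≡.subst (D ℕ.≤_) (sym (ℕₚ.*-identityʳ _)) D≤))

  record Quadratic : Set where
    constructor quadratic
    field
      a₀ a₁ a₂ : Carrier
      a₂≢0 : a₂ ≢ 0#
      disc≢0 : a₁ * a₁ - (1# + 1# + 1# + 1#) * (a₀ * a₂) ≢ 0#

  quad : Quadratic → Poly
  quad h = a₀ ∷ a₁ ∷ a₂ ∷ []
    where open Quadratic h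

  module _ (h : Quadratic) where
    open Quadratic h
    private
      H = quad h

      H-Deg : Deg< 3 H
      H-Deg = Deg<-length H ℕₚ.≤-refl

    quad-cancel : ∀ t → H *ₚ t ≈ₚ [] → t ≈ₚ []
    quad-cancel = cancel-zero {H} 2 H-Deg a₂≢0

    quad-Deg : ∀ D t → Deg< (2 ℕ.+ D) (H *ₚ t) → Deg< D t
    quad-Deg = Deg<-cancel {H} 2 H-Deg a₂≢0

    H≈ : H ≈ₚ C a₀ +ₚ X *ₚ C a₁ +ₚ X *ₚ (X *ₚ C a₂)
    H≈ = P.trans (horner a₀ (a₁ ∷ a₂ ∷ [])) (P.trans (P.+-congˡ (P.*-congˡ (horner a₁ (C a₂))))
           (ringₚ 4 (λ x a b c → a :+ x :* (b :+ x :* c) := a :+ x :* b :+ x :* (x :* c)) P.refl X (C a₀) (C a₁) (C a₂)))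

    quad-remainder : ∀ p → ∃ λ k → ∃₂ λ β α → p ≈ₚ H *ₚ k +ₚ (C β +ₚ X *ₚ C α)
    quad-remainder [] = [] , 0# , 0# , P.sym (begin
      H *ₚ [] +ₚ (C 0# +ₚ X *ₚ C 0#)   ≈⟨ P.+-cong (P.zeroʳ H) (P.+-cong C.0-homo (P.*-congˡ C.0-homo)) ⟩
      [] +ₚ ([] +ₚ X *ₚ [])            ≈⟨ P.trans (P.+-identityˡ _) (P.trans (P.+-identityˡ _) (P.zeroʳ X)) ⟩
      []                               ∎)
    quad-remainder (a ∷ p) with quad-remainder p
    ... | k , β , α , e = X *ₚ k +ₚ C γ , a + - (γ * a₀) , β + - (γ * a₁) , (begin
      a ∷ p                                        ≈⟨ horner a p ⟩
      C a +ₚ X *ₚ p                                ≈⟨ P.+-congˡ (P.*-congˡ e) ⟩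
      C a +ₚ X *ₚ (H *ₚ k +ₚ (C β +ₚ X *ₚ C α))    ≈⟨ P.+-congˡ (P.*-congˡ (P.+-congˡ (P.+-congˡ (P.*-congˡ Cα≈)))) ⟩
      C a +ₚ X *ₚ (H *ₚ k +ₚ (C β +ₚ X *ₚ (C γ *ₚ C a₂)))
        ≈⟨ ringₚ 9 (λ a x h k b g a₀ a₁ a₂ → a :+ x :* (h :* k :+ (b :+ x :* (g :* a₂)))
             := h :* (x :* k) :+ (a₀ :+ x :* a₁ :+ x :* (x :* a₂)) :* g :+ ((a :- g :* a₀) :+ x :* (b :- g :* a₁)))
             P.refl (C a) X H k (C β) (C γ) (C a₀) (C a₁) (C a₂) ⟩
      H *ₚ (X *ₚ k) +ₚ (C a₀ +ₚ X *ₚ C a₁ +ₚ X *ₚ (X *ₚ C a₂)) *ₚ C γ +ₚ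
        ((C a +ₚ P.- (C γ *ₚ C a₀)) +ₚ X *ₚ (C β +ₚ P.- (C γ *ₚ C a₁)))
        ≈⟨ P.+-cong
             (P.trans (P.+-congˡ (P.*-congʳ (P.sym H≈))) (P.sym (P.distribˡ H (X *ₚ k) (C γ))))
             (P.+-cong (lower a a₀) (P.*-congˡ (lower β a₁))) ⟩
      H *ₚ (X *ₚ k +ₚ C γ) +ₚ (C (a + - (γ * a₀)) +ₚ X *ₚ C (β + - (γ * a₁))) ∎)
      where
      γ = α * a₂ ⁻¹
      Cα≈ : C α ≈ₚ C γ *ₚ C a₂
      Cα≈ = P.trans (C.⟦⟧-cong (trans (sym (*-identityʳ α)) (trans (cong (α *_) (trans (sym (inverseʳ a₂ a₂≢0)) (*-comm a₂ _))) (sym (*-assoc α _ a₂))))) (C.*-homo γ a₂)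
      lower : ∀ b c → C b +ₚ P.- (C γ *ₚ C c) ≈ₚ C (b + - (γ * c))
      lower b c = P.sym (P.trans (C.sub-homo b (γ * c)) (P.+-congˡ (P.-‿cong (C.*-homo γ c))))

    private
      linear-multiple : ∀ β α k → C β +ₚ X *ₚ C α ≈ₚ H *ₚ k → β ≡ 0# × α ≡ 0#
      linear-multiple β α k e = at z 0 , at z 1
        where
        e′ : β ∷ α ∷ [] ≈ₚ H *ₚ k
        e′ = P.trans (horner β (C α)) e
        k≈0 : k ≈ₚ []
        k≈0 = Deg<0 (quad-Deg 0 k (Deg<-resp e′ (Deg<-length (β ∷ α ∷ []) ℕₚ.≤-refl)))
        z : β ∷ α ∷ [] ≈ₚ []
        z = P.trans e′ (P.trans (P.*-congˡ k≈0) (P.zeroʳ H))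

      -- α²X² + 2αβX + β² is a multiple of H only if it is proportional to H, whose discriminant is not 0.
      linear-square : ∀ β α k → (C β +ₚ X *ₚ C α) *ₚ (C β +ₚ X *ₚ C α) ≈ₚ H *ₚ k → β ≡ 0# × α ≡ 0#
      linear-square β α k e = β≡0 , α≡0
        where
        γ = α * α
        -- With ρ = β + αX, these are the coefficients of a₂ρ² - α²H. The quadratic terms cancel,
        -- and what remains is a linear multiple of H, hence 0.
        δ₀ = a₂ * (β * β) + - (γ * a₀)
        δ₁ = a₂ * (α * β + α * β) + - (γ * a₁)
        step : C δ₀ +ₚ X *ₚ C δ₁ ≈ₚ H *ₚ (C a₂ *ₚ k +ₚ P.- C γ)
        step = begin
          C δ₀ +ₚ X *ₚ C δ₁
            ≈⟨ P.+-cong (P.trans (C.sub-homo (a₂ * (β * β)) _) (P.+-cong (P.trans (C.*-homo a₂ (β * β)) (P.*-congˡ (C.*-homo β β))) (P.-‿cong (P.trans (C.*-homo γ a₀) (P.*-congʳ (C.*-homo α α))))))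
                 (P.*-congˡ (P.trans (C.sub-homo (a₂ * (α * β + α * β)) _) (P.+-cong (P.trans (C.*-homo a₂ (α * β + α * β)) (P.*-congˡ (P.trans (C.+-homo (α * β) (α * β)) (P.+-cong (C.*-homo α β) (C.*-homo α β))))) (P.-‿cong (P.trans (C.*-homo γ a₁) (P.*-congʳ (C.*-homo α α))))))) ⟩
          (C a₂ *ₚ (C β *ₚ C β) +ₚ P.- (C α *ₚ C α *ₚ C a₀)) +ₚ X *ₚ (C a₂ *ₚ (C α *ₚ C β +ₚ C α *ₚ C β) +ₚ P.- (C α *ₚ C α *ₚ C a₁))
            ≈⟨ ringₚ 6 (λ x b a a₀ a₁ a₂ → (a₂ :* (b :* b) :- a :* a :* a₀) :+ x :* (a₂ :* (a :* b :+ a :* b) :- a :* a :* a₁)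
                 := a₂ :* ((b :+ x :* a) :* (b :+ x :* a)) :- (a₀ :+ x :* a₁ :+ x :* (x :* a₂)) :* (a :* a)) P.refl X (C β) (C α) (C a₀) (C a₁) (C a₂) ⟩
          C a₂ *ₚ ((C β +ₚ X *ₚ C α) *ₚ (C β +ₚ X *ₚ C α)) +ₚ P.- ((C a₀ +ₚ X *ₚ C a₁ +ₚ X *ₚ (X *ₚ C a₂)) *ₚ (C α *ₚ C α))
            ≈⟨ P.+-cong (P.*-congˡ e) (P.-‿cong (P.*-cong (P.sym H≈) (P.sym (C.*-homo α α)))) ⟩
          C a₂ *ₚ (H *ₚ k) +ₚ P.- (H *ₚ C γ)
            ≈⟨ ringₚ 4 (λ a h k g → a :* (h :* k) :- h :* g := h :* (a :* k :- g)) P.refl (C a₂) H k (C γ) ⟩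
          H *ₚ (C a₂ *ₚ k +ₚ P.- C γ) ∎
        z = linear-multiple δ₀ δ₁ _ step
        α≡0 : α ≡ 0#
        α≡0 with α ≟ 0#
        ... | yes α≡0 = α≡0
        -- α⁴ times the discriminant is the combination `Y * δ₀ - δ₁ * Z`, so it vanishes with `δ₀`
        -- and `δ₁`.
        ... | no α≢0 = ⊥-elim (disc≢0 (*-zero (*≢0 (*≢0 α≢0 α≢0) (*≢0 α≢0 α≢0)) (from-identity
              (ring 5 (λ a b a₀ a₁ a₂ → a :* a :* (a :* a) :* (a₁ :* a₁ :- κ 4 :* (a₀ :* a₂))
                := κ 4 :* a₂ :* (a :* a) :* (a₂ :* (b :* b) :- a :* a :* a₀)
                   :- (a₂ :* (a :* b :+ a :* b) :- a :* a :* a₁) :* (a₂ :* (a :* b :+ a :* b) :+ a :* a :* a₁)) refl α β a₀ a₁ a₂))))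
          where
          Y = (1# + 1# + 1# + 1#) * a₂ * (α * α)
          Z = a₂ * (α * β + α * β) + α * α * a₁
          from-identity : α * α * (α * α) * (a₁ * a₁ - (1# + 1# + 1# + 1#) * (a₀ * a₂)) ≡ Y * δ₀ - δ₁ * Z →
                   α * α * (α * α) * (a₁ * a₁ - (1# + 1# + 1# + 1#) * (a₀ * a₂)) ≡ 0#
          from-identity eq = trans eq (trans (cong₂ (λ m n → Y * m - n * Z) (proj₁ z) (proj₂ z))
                        (ring 2 (λ y z → y :* κ 0 :- κ 0 :* z := κ 0) refl Y Z))
        β≡0 : β ≡ 0#
        β≡0 = square≡0 (*-zero a₂≢0 (trans (trans (ring 3 (λ a₂ b a₀ → a₂ :* (b :* b) := a₂ :* (b :* b) :- κ 0 :* κ 0 :* a₀) refl a₂ β a₀)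
                (cong (λ m → a₂ * (β * β) - m * m * a₀) (sym α≡0))) (proj₁ z)))

    -- H may split over the field, so primality cannot be invoked; a nonzero discriminant replaces
    -- it. If ρ is the remainder of r modulo H, then H divides ρ², and `linear-square` forces ρ = 0.
    quad-∥-square : ∀ r → H ∥ r *ₚ r → H ∥ r
    quad-∥-square r (divides t e) with quad-remainder r
    ... | k , β , α , er = divides k (begin
        r                                       ≈⟨ er ⟩
        H *ₚ k +ₚ (C β +ₚ X *ₚ C α)             ≈⟨ P.+-congˡ ρ≈0 ⟩
        H *ₚ k +ₚ []                            ≈⟨ P.+-identityʳ _ ⟩
        H *ₚ k                                  ∎)
      where
      ρ = C β +ₚ X *ₚ C α
      z : β ≡ 0# × α ≡ 0#
      z = linear-square β α (t +ₚ P.- (k *ₚ (H *ₚ k +ₚ ρ +ₚ ρ))) (begin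
        ρ *ₚ ρ      ≈⟨ ringₚ 3 (λ h k r → r :* r := (h :* k :+ r) :* (h :* k :+ r) :- h :* (k :* (h :* k :+ r :+ r))) P.refl H k ρ ⟩
        (H *ₚ k +ₚ ρ) *ₚ (H *ₚ k +ₚ ρ) +ₚ P.- (H *ₚ (k *ₚ (H *ₚ k +ₚ ρ +ₚ ρ)))
          ≈⟨ P.+-congʳ (P.trans (P.*-cong (P.sym er) (P.sym er)) e) ⟩
        H *ₚ t +ₚ P.- (H *ₚ (k *ₚ (H *ₚ k +ₚ ρ +ₚ ρ)))
          ≈⟨ ringₚ 3 (λ h t s → h :* t :- h :* s := h :* (t :- s)) P.refl H t _ ⟩
        H *ₚ (t +ₚ P.- (k *ₚ (H *ₚ k +ₚ ρ +ₚ ρ))) ∎)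
      ρ≈0 : ρ ≈ₚ []
      ρ≈0 = P.trans (P.+-cong (P.trans (C.⟦⟧-cong (proj₁ z)) C.0-homo) (P.trans (P.*-congˡ (P.trans (C.⟦⟧-cong (proj₂ z)) C.0-homo)) (P.zeroʳ X))) (P.+-identityˡ [])

    private
      diff : ∀ {x y} → x +ₚ P.- y ≈ₚ [] → x ≈ₚ y
      diff {x} {y} z = P.trans (ringₚ 2 (λ x y → x := x :- y :+ y) P.refl x y) (P.trans (P.+-congʳ z) (P.+-identityˡ y))

      module Descent (f g : Poly) (c : Carrier) (f≈ : f ≈ₚ H *ₚ g) (cop : Coprime H g) (c≢0 : c ≢ 0#)
                     (p r : Poly) (e : p *ₚ p *ₚ f ≈ₚ C c *ₚ (r *ₚ r)) where
        H∥rr : H ∥ r *ₚ r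
        H∥rr = divides (C (c ⁻¹) *ₚ (p *ₚ p *ₚ g)) (begin
          r *ₚ r                              ≈⟨ P.sym (P.*-identityˡ _) ⟩
          C 1# *ₚ (r *ₚ r)                    ≈⟨ P.*-congʳ (P.trans (C.⟦⟧-cong (trans (sym (inverseʳ c c≢0)) (*-comm c _))) (C.*-homo (c ⁻¹) c)) ⟩
          C (c ⁻¹) *ₚ C c *ₚ (r *ₚ r)         ≈⟨ P.*-assoc (C (c ⁻¹)) (C c) _ ⟩
          C (c ⁻¹) *ₚ (C c *ₚ (r *ₚ r))       ≈⟨ P.*-congˡ (P.trans (P.sym e) (P.*-congˡ f≈)) ⟩
          C (c ⁻¹) *ₚ (p *ₚ p *ₚ (H *ₚ g))    ≈⟨ ringₚ 4 (λ c p h g → c :* (p :* p :* (h :* g)) := h :* (c :* (p :* p :* g))) P.refl (C (c ⁻¹)) p H g ⟩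
          H *ₚ (C (c ⁻¹) *ₚ (p *ₚ p *ₚ g))    ∎)

        H∥r : H ∥ r
        H∥r = quad-∥-square r H∥rr

        r₁ = quotient H∥r

        Hr₁ : C c *ₚ (H *ₚ r₁ *ₚ (H *ₚ r₁)) ≈ₚ C c *ₚ (r *ₚ r)
        Hr₁ = P.*-congˡ (P.sym (P.*-cong (equality H∥r) (equality H∥r)))

        gpp≈ : g *ₚ (p *ₚ p) ≈ₚ H *ₚ (C c *ₚ (r₁ *ₚ r₁))
        gpp≈ = diff (quad-cancel _ (begin
          H *ₚ (g *ₚ (p *ₚ p) +ₚ P.- (H *ₚ (C c *ₚ (r₁ *ₚ r₁))))
            ≈⟨ ringₚ 5 (λ h g p c r → h :* (g :* (p :* p) :- h :* (c :* (r :* r))) := p :* p :* (h :* g) :- c :* (h :* r :* (h :* r))) P.refl H g p (C c) r₁ ⟩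
          p *ₚ p *ₚ (H *ₚ g) +ₚ P.- (C c *ₚ (H *ₚ r₁ *ₚ (H *ₚ r₁)))
            ≈⟨ P.+-cong (P.trans (P.*-congˡ (P.sym f≈)) e) (P.-‿cong Hr₁) ⟩
          C c *ₚ (r *ₚ r) +ₚ P.- (C c *ₚ (r *ₚ r)) ≈⟨ P.-‿inverseʳ _ ⟩
          [] ∎))

        H∥p : H ∥ p
        H∥p = quad-∥-square p (Coprime-cancel cop (divides (C c *ₚ (r₁ *ₚ r₁)) gpp≈))

        p₁ = quotient H∥p

        e₁ : p₁ *ₚ p₁ *ₚ f ≈ₚ C c *ₚ (r₁ *ₚ r₁)
        e₁ = diff (quad-cancel _ (quad-cancel _ (begin
          H *ₚ (H *ₚ (p₁ *ₚ p₁ *ₚ f +ₚ P.- (C c *ₚ (r₁ *ₚ r₁))))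
            ≈⟨ ringₚ 5 (λ h p f c r → h :* (h :* (p :* p :* f :- c :* (r :* r))) := h :* p :* (h :* p) :* f :- c :* (h :* r :* (h :* r))) P.refl H p₁ f (C c) r₁ ⟩
          H *ₚ p₁ *ₚ (H *ₚ p₁) *ₚ f +ₚ P.- (C c *ₚ (H *ₚ r₁ *ₚ (H *ₚ r₁)))
            ≈⟨ P.+-cong (P.*-congʳ (P.sym (P.*-cong (equality H∥p) (equality H∥p)))) (P.-‿cong Hr₁) ⟩
          p *ₚ p *ₚ f +ₚ P.- (C c *ₚ (r *ₚ r))     ≈⟨ P.+-congʳ e ⟩
          C c *ₚ (r *ₚ r) +ₚ P.- (C c *ₚ (r *ₚ r)) ≈⟨ P.-‿inverseʳ _ ⟩
          [] ∎)))

    -- Infinite descent on degrees: H divides r, hence p, and both can be divided by H.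
    non-square : ∀ f g c → f ≈ₚ H *ₚ g → Coprime H g → c ≢ 0# →
                 ∀ D p r → Deg< D p → Deg< D r → p *ₚ p *ₚ f ≈ₚ C c *ₚ (r *ₚ r) → p ≈ₚ [] × r ≈ₚ []
    non-square f g c f≈ cop c≢0 zero    p r dp dr e = Deg<0 dp , Deg<0 dr
    non-square f g c f≈ cop c≢0 (suc D) p r dp dr e = lift H∥p (proj₁ rec) , lift H∥r (proj₂ rec)
      where
      open Descent f g c f≈ cop c≢0 p r e
      lower : ∀ {s} (d : H ∥ s) → Deg< (suc D) s → Deg< D (quotient d)
      lower d ds = quad-Deg D (quotient d) (Deg<-mono {p = H *ₚ quotient d} (ℕₚ.n≤1+n _) (Deg<-resp (equality d) ds))
      lift : ∀ {s} (d : H ∥ s) → quotient d ≈ₚ [] → s ≈ₚ []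
      lift d z = P.trans (equality d) (P.trans (P.*-congˡ z) (P.zeroʳ H))
      rec = non-square f g c f≈ cop c≢0 D p₁ r₁ (lower H∥p dp) (lower H∥r dr) e₁

-- The Frobenius map, the characteristic, and Fermat's theorem

prime∣! : ∀ {p} → Prime p → ∀ k → p ∣ k ℕ.! → p ℕ.≤ k
prime∣! pr zero    d = ⊥-elim (ℕ.nonTrivial⇒≢1 {{prime⇒nonTrivial pr}} (∣1⇒≡1 d))
prime∣! pr (suc k) d with euclidsLemma (suc k) (k ℕ.!) pr d
... | inj₁ p∣1+k = ∣⇒≤ p∣1+k
... | inj₂ p∣k!  = ℕₚ.m≤n⇒m≤1+n (prime∣! pr k p∣k!)

-- The prime divides p! = C(p, k) · k! · (p - k)!, but neither of the two smaller factorials.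
prime∣C : ∀ {p} → Prime p → ∀ k → 0 ℕ.< k → k ℕ.< p → p ∣ p Comb.C k
prime∣C {suc p} pr k 0<k k<p with euclidsLemma (suc p Comb.C k) (k ℕ.! ℕ.* (suc p ℕ.∸ k) ℕ.!) pr p∣C*D
  where
  instance _ = k ℕₚ.!* (suc p ℕ.∸ k) !≢0
  p∣C*D : suc p ∣ (suc p Comb.C k) ℕ.* (k ℕ.! ℕ.* (suc p ℕ.∸ k) ℕ.!)
  p∣C*D = ≡.subst (suc p ∣_)
    (≡.sym (≡.trans (≡.cong (ℕ._* (k ℕ.! ℕ.* (suc p ℕ.∸ k) ℕ.!)) (Comb.nCk≡n!/k![n-k]! (ℕₚ.<⇒≤ k<p)))
                    (m/n*n≡m (Comb.k![n∸k]!∣n! (ℕₚ.<⇒≤ k<p)))))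
    (m∣m*n (p ℕ.!))
... | inj₁ p∣C = p∣C
... | inj₂ p∣D with euclidsLemma (k ℕ.!) ((suc p ℕ.∸ k) ℕ.!) pr p∣D
...   | inj₁ p∣k! = ⊥-elim (ℕₚ.<⇒≱ k<p (prime∣! pr k p∣k!))
...   | inj₂ p∣[p-k]! = ⊥-elim (ℕₚ.<⇒≱ (ℕₚ.∸-monoʳ-< 0<k (ℕₚ.<⇒≤ k<p)) (prime∣! pr _ p∣[p-k]!))

module Frobenius (R : Ring) where
  open CommutativeRing R hiding (zero)
  open import Algebra.Properties.Semiring.Mult semiring using (×-congʳ; ×-assocˡ; ×-assoc-*; ×-homo-1) renaming (_×_ to _⊗_)
  open import Algebra.Properties.Semiring.Sum semiring using (sum; sum-cong-≋; sum-init-last; sum-replicate-zero)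
  open import Algebra.Properties.CommutativeSemiring.Exp commutativeSemiring using (_^_; ^-congˡ; ^-assocʳ)
  open import Algebra.Properties.CommutativeSemiring.Binomial commutativeSemiring using (binomialTerm; theorem)
  open import Relation.Binary.Reasoning.Setoid setoid

  module _ {p} (pr : Prime p) (p≈0 : p ⊗ 1# ≈ 0#) where
    multiple≈0 : ∀ n z → p ∣ n → n ⊗ z ≈ 0#
    multiple≈0 n z (divides m ≡.refl) = begin
      (m ℕ.* p) ⊗ z           ≈⟨ sym (×-assocˡ z m p) ⟩
      m ⊗ (p ⊗ z)             ≈⟨ ×-congʳ m (×-congʳ p (sym (*-identityˡ z))) ⟩
      m ⊗ (p ⊗ (1# * z))      ≈⟨ ×-congʳ m (sym (×-assoc-* p 1# z)) ⟩
      m ⊗ ((p ⊗ 1#) * z)      ≈⟨ ×-congʳ m (trans (*-congʳ p≈0) (zeroˡ z)) ⟩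
      m ⊗ 0#                  ≈⟨ m⊗0 m ⟩
      0#                      ∎
      where
      m⊗0 : ∀ m → m ⊗ 0# ≈ 0#
      m⊗0 zero    = refl
      m⊗0 (suc m) = trans (+-identityˡ _) (m⊗0 m)

    frobenius₁ : ∀ x y → (x + y) ^ p ≈ x ^ p + y ^ p
    frobenius₁ x y = helper p ≡.refl
      where
      helper : ∀ p′ → p ≡ p′ → (x + y) ^ p ≈ x ^ p + y ^ p
      helper zero ≡.refl with () ← prime⇒nonZero pr
      helper (suc p-1) ≡.refl = begin
        (x + y) ^ p                              ≈⟨ theorem p x y ⟩
        t zero + sum (t ∘ suc)                   ≈⟨ +-congˡ (sum-init-last (t ∘ suc)) ⟩
        t zero + (sum (t ∘ suc ∘ inject₁) + t (suc (fromℕ p-1))) ≈⟨ +-cong t-zero (+-cong mid t-last) ⟩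
        y ^ p + (0# + x ^ p)                     ≈⟨ +-congˡ (+-identityˡ _) ⟩
        y ^ p + x ^ p                            ≈⟨ +-comm _ _ ⟩
        x ^ p + y ^ p                            ∎
        where
        t = binomialTerm x y p
        t-zero : t zero ≈ y ^ p
        t-zero = trans (×-homo-1 _) (*-identityˡ _)
        t-last : t (suc (fromℕ p-1)) ≈ x ^ p
        t-last rewrite Finₚ.toℕ-fromℕ p-1 | Comb.nCn≡1 p | ℕₚ.n∸n≡0 p-1 = trans (×-homo-1 _) (*-identityʳ _)
        mid : sum (t ∘ suc ∘ inject₁) ≈ 0#
        mid = trans (sum-cong-≋ {p-1} (λ i → multiple≈0 _ _ (prime∣C pr (toℕ (suc (inject₁ i))) (s≤s z≤n)
                (s≤s (≡.subst (ℕ._< p-1) (≡.sym (Finₚ.toℕ-inject₁ i)) (Finₚ.toℕ<n i))))))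
              (sum-replicate-zero p-1)

    frobenius : ∀ n x y → (x + y) ^ (p ℕ.^ n) ≈ x ^ (p ℕ.^ n) + y ^ (p ℕ.^ n)
    frobenius zero    x y = distribʳ 1# x y
    frobenius (suc n) x y = begin
      (x + y) ^ (p ℕ.* p ℕ.^ n)                          ≈⟨ sym (^-assocʳ _ p (p ℕ.^ n)) ⟩
      ((x + y) ^ p) ^ (p ℕ.^ n)                          ≈⟨ ^-congˡ (p ℕ.^ n) (frobenius₁ x y) ⟩
      (x ^ p + y ^ p) ^ (p ℕ.^ n)                        ≈⟨ frobenius n (x ^ p) (y ^ p) ⟩
      (x ^ p) ^ (p ℕ.^ n) + (y ^ p) ^ (p ℕ.^ n)          ≈⟨ +-cong (^-assocʳ x p (p ℕ.^ n)) (^-assocʳ y p (p ℕ.^ n)) ⟩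
      x ^ (p ℕ.* p ℕ.^ n) + y ^ (p ℕ.* p ℕ.^ n)          ∎

module FiniteFieldTheory (K : FiniteField) where
  open Field K
  open Inverse enumeration using (to; from; strictlyInverseˡ; strictlyInverseʳ)
  open import Algebra.Properties.Semiring.Mult semiring using (×-homo-1; ×1-homo-*) renaming (_×_ to _⊗_)
  import Algebra.Properties.CommutativeMonoid.Sum as BigOp
  private
    module Σ₊ = BigOp +-commutativeMonoid
    module Π* = BigOp *-commutativeMonoid

    bijection : (f g : Carrier → Carrier) → (∀ x → f (g x) ≡ x) → (∀ x → g (f x) ≡ x) → Permutation size size
    bijection f g fg gf = permutation (from ∘ f ∘ to) (from ∘ g ∘ to)
      (λ i → trans (cong (from ∘ f) (strictlyInverseˡ _)) (trans (cong from (fg (to i))) (strictlyInverseʳ i)))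
      (λ i → trans (cong (from ∘ g) (strictlyInverseˡ _)) (trans (cong from (gf (to i))) (strictlyInverseʳ i)))

    +-cancel : ∀ {a b} → a ≡ a + b → b ≡ 0#
    +-cancel {a} {b} e = trans (ring 2 (λ a b → b := (a :+ b) :- a) refl a b) (≡-0 (sym e))

  -- Translation by 1 permutes the field, so the sum of all elements is unchanged when q · 1 is
  -- added to it.
  size⊗1 : size ⊗ 1# ≡ 0#
  size⊗1 = +-cancel (begin
    Σ₊.sum to                                  ≡⟨ Σ₊.sum-permute to shift₁ ⟩
    Σ₊.sum (λ i → to (from (to i + 1#)))       ≡⟨ Σ₊.sum-cong-≗ (λ i → strictlyInverseˡ (to i + 1#)) ⟩
    Σ₊.sum (λ i → to i + 1#)                   ≡⟨ Σ₊.∑-distrib-+ to (λ _ → 1#) ⟩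
    Σ₊.sum to + Σ₊.sum {size} (λ _ → 1#)       ≡⟨ cong (Σ₊.sum to +_) (Σ₊.sum-replicate size) ⟩
    Σ₊.sum to + size ⊗ 1#                      ∎)
    where
    open ≡.≡-Reasoning
    shift₁ = bijection (_+ 1#) (_- 1#)
      (λ x → ring 1 (λ x → x :- κ 1 :+ κ 1 := x) refl x) (λ x → ring 1 (λ x → (x :+ κ 1) :- κ 1 := x) refl x)

  characteristic : ∀ {p} n → size ≡ p ℕ.^ n → p ⊗ 1# ≡ 0#
  characteristic {p} n e with (p ⊗ 1#) ≟ 0#
  ... | yes z = z
  ... | no nz = ⊥-elim (pow n (trans (cong (_⊗ 1#) (sym e)) size⊗1))
    where
    pow : ∀ n → (p ℕ.^ n) ⊗ 1# ≢ 0#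
    pow zero    z = 0≢1 (sym (trans (sym (×-homo-1 1#)) z))
    pow (suc n) z = *≢0 nz (pow n) (trans (sym (×1-homo-* p (p ℕ.^ n))) z)

  -- Multiplication by x permutes the nonzero elements. As the products run over the whole field,
  -- `t` replaces the element 0 by the harmless factor 1. Of the q factors x, the one at the index 0
  -- goes into `r` and the others into `s`; comparing the products of t(xy) and t(y) shows that the
  -- latter multiply to 1.
  fermat : ∀ x → x ^ size ≡ x
  fermat x with x ≟ 0#
  ... | yes refl = 0^ size from
    where
    0^ : ∀ n → (Carrier → Fin n) → 0# ^ n ≡ 0#
    0^ zero    f with () ← f 0#
    0^ (suc n) f = zeroˡ _
  ... | no x≢0 = begin
      x ^ size                            ≡⟨ sym (Π*.sum-replicate size) ⟩
      Π*.sum {size} (λ _ → x)             ≡⟨ Π*.sum-cong-≗ (λ i → s*r (to i)) ⟩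
      Π*.sum (λ i → s (to i) * r (to i))  ≡⟨ Π*.∑-distrib-+ (s ∘ to) (r ∘ to) ⟩
      Π*.sum (s ∘ to) * Π*.sum (r ∘ to)   ≡⟨ cong₂ _*_ Πs Πr ⟩
      1# * x                              ≡⟨ *-identityˡ x ⟩
      x                                   ∎
    where
    open ≡.≡-Reasoning
    t s r : Carrier → Carrier
    t y with y ≟ 0#
    ... | yes _ = 1#
    ... | no _  = y
    s y with y ≟ 0#
    ... | yes _ = 1#
    ... | no _  = x
    r y with y ≟ 0#
    ... | yes _ = x
    ... | no _  = 1#
    s*r : ∀ y → x ≡ s y * r y
    s*r y with y ≟ 0#
    ... | yes _ = sym (*-identityˡ x)
    ... | no _  = sym (*-identityʳ x)
    t≢0 : ∀ y → t y ≢ 0#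
    t≢0 y with y ≟ 0#
    ... | yes _  = λ e → 0≢1 (sym e)
    ... | no y≢0 = y≢0
    t-mult : ∀ y → t (x * y) ≡ s y * t y
    t-mult y with y ≟ 0# | (x * y) ≟ 0#
    ... | yes _    | yes _  = sym (*-identityˡ 1#)
    ... | yes refl | no n   = ⊥-elim (n (zeroʳ x))
    ... | no n     | yes z  = ⊥-elim (*≢0 x≢0 n z)
    ... | no _     | no _   = refl
    r≡1 : ∀ y → y ≢ 0# → r y ≡ 1#
    r≡1 y n with y ≟ 0#
    ... | yes z = ⊥-elim (n z)
    ... | no _  = refl
    r0 : r 0# ≡ x
    r0 with 0# ≟ 0#
    ... | yes _ = refl
    ... | no n  = ⊥-elim (n refl)
    Πt≢0 : ∀ n (f : Fin n → Carrier) → (∀ i → f i ≢ 0#) → Π*.sum f ≢ 0#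
    Πt≢0 zero    f nz e = 0≢1 (sym e)
    Πt≢0 (suc n) f nz   = *≢0 (nz zero) (Πt≢0 n (f ∘ suc) (nz ∘ suc))
    mult = bijection (x *_) (x ⁻¹ *_)
      (λ y → trans (sym (*-assoc _ _ _)) (trans (cong (_* y) (inverseʳ x x≢0)) (*-identityˡ y)))
      (λ y → trans (sym (*-assoc _ _ _)) (trans (cong (_* y) (trans (*-comm _ x) (inverseʳ x x≢0))) (*-identityˡ y)))
    T = Π*.sum (t ∘ to)
    Πs : Π*.sum (s ∘ to) ≡ 1#
    Πs = *-cancelˡ (Πt≢0 size (t ∘ to) (t≢0 ∘ to)) (begin
      T * Π*.sum (s ∘ to)                        ≡⟨ *-comm T _ ⟩
      Π*.sum (s ∘ to) * T                        ≡⟨ sym (Π*.∑-distrib-+ (s ∘ to) (t ∘ to)) ⟩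
      Π*.sum (λ i → s (to i) * t (to i))         ≡⟨ Π*.sum-cong-≗ (λ i → trans (sym (t-mult (to i))) (cong t (sym (strictlyInverseˡ (x * to i))))) ⟩
      Π*.sum (λ i → t (to (from (x * to i))))    ≡⟨ sym (Π*.sum-permute (t ∘ to) mult) ⟩
      T                                          ≡⟨ sym (*-identityʳ T) ⟩
      T * 1#                                     ∎)
    isolate : ∀ n (f : Fin n → Carrier) i → (∀ j → j ≢ i → f j ≡ 1#) → Π*.sum f ≡ f i
    isolate (suc n) f i f≡1 = begin
      Π*.sum f                                   ≡⟨ Π*.sum-remove {i = i} f ⟩
      f i * Π*.sum (f ∘ punchIn i)               ≡⟨ cong (f i *_) (trans (Π*.sum-cong-≗ (λ j → f≡1 (punchIn i j) (Finₚ.punchInᵢ≢i i j))) (Π*.sum-replicate-zero n)) ⟩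
      f i * 1#                                   ≡⟨ *-identityʳ _ ⟩
      f i                                        ∎
    Πr : Π*.sum (r ∘ to) ≡ x
    Πr = trans (isolate size (r ∘ to) (from 0#) (λ j j≢ → r≡1 (to j) (λ z → j≢ (trans (sym (strictlyInverseʳ j)) (cong from z)))))
           (trans (cong r (strictlyInverseˡ 0#)) r0)

-- Stepanov's method

funToFin-injective : ∀ {m n} (f g : Fin m → Fin n) → funToFin f ≡ funToFin g → ∀ i → f i ≡ g i
funToFin-injective f g e i =
  ≡.trans (≡.sym (Finₚ.finToFun-funToFin f i)) (≡.trans (≡.cong (λ z → finToFun z i) e) (Finₚ.finToFun-funToFin g i))

remQuot-injective : ∀ {m} n (i j : Fin (m ℕ.* n)) → remQuot {m} n i ≡ remQuot {m} n j → i ≡ j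
remQuot-injective {m} n i j e =
  ≡.trans (≡.sym (Finₚ.combine-remQuot {m} n i)) (≡.trans (≡.cong (uncurry Fin.combine) e) (Finₚ.combine-remQuot {m} n j))

-- Bivariate polynomials Σ aₗ(X) Zˡ with deg aₗ ≤ d + l k.
module Filtration (R : Ring) (k : ℕ) where
  private
    module L = Polynomials R
    module B = Polynomials L.polyRing
  open import Algebra.Properties.CommutativeSemiring.Exp (CommutativeRing.commutativeSemiring B.polyRing) using (_^_)

  Filt : ℕ → B.Poly → Set
  Filt d []      = ⊤
  Filt d (a ∷ P) = length a ℕ.≤ suc d × Filt (d ℕ.+ k) P

  Filt-mono : ∀ {d e} P → d ℕ.≤ e → Filt d P → Filt e P
  Filt-mono []      d≤e _        = tt
  Filt-mono (a ∷ P) d≤e (la , F) = ℕₚ.≤-trans la (s≤s d≤e) , Filt-mono P (ℕₚ.+-monoˡ-≤ k d≤e) F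

  Filt-coef : ∀ {d} P → Filt d P → ∀ l → length (B.coef P l) ℕ.≤ suc (d ℕ.+ l ℕ.* k)
  Filt-coef     []      _        l       = z≤n
  Filt-coef {d} (a ∷ P) (la , F) zero    = ℕₚ.≤-trans la (s≤s (ℕₚ.m≤m+n d 0))
  Filt-coef {d} (a ∷ P) (la , F) (suc l) = ≡.subst (λ n → length (B.coef P l) ℕ.≤ suc n) (ℕₚ.+-assoc d k (l ℕ.* k)) (Filt-coef P F l)

  opaque
    unfolding L._+ₚ_ L._*ₚ_ L._·_

    Filt-+ : ∀ {d} P Q → Filt d P → Filt d Q → Filt d (P B.+ₚ Q)
    Filt-+ []      Q       F        G        = G
    Filt-+ (a ∷ P) []      F        G        = F
    Filt-+ (a ∷ P) (b ∷ Q) (la , F) (lb , G) = L.length-+ a b la lb , Filt-+ P Q F G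

    Filt-· : ∀ {d e} a Q → length a ℕ.≤ suc d → Filt e Q → Filt (d ℕ.+ e) (a B.· Q)
    Filt-·         a []      la F        = tt
    Filt-· {d} {e} a (b ∷ Q) la (lb , F) = L.length-* a b la lb
      , ≡.subst (λ n → Filt n (a B.· Q)) (≡.sym (ℕₚ.+-assoc d e k)) (Filt-· a Q la F)

    Filt-* : ∀ {d e} P Q → Filt d P → Filt e Q → Filt (d ℕ.+ e) (P B.*ₚ Q)
    Filt-*         []      Q F        G = tt
    Filt-* {d} {e} (a ∷ P) Q (la , F) G = Filt-+ (a B.· Q) _ (Filt-· a Q la G)
      (z≤n , ≡.subst (λ n → Filt n (P B.*ₚ Q))
               (≡.trans (ℕₚ.+-assoc d k e) (≡.trans (≡.cong (d ℕ.+_) (ℕₚ.+-comm k e)) (≡.sym (ℕₚ.+-assoc d e k)))) (Filt-* P Q F G))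

  Filt-C : ∀ {d} a → length a ℕ.≤ suc d → Filt d (B.C a)
  Filt-C a la = la , tt

  Filt-^ : ∀ P n → Filt 0 P → Filt 0 (P ^ n)
  Filt-^ P zero    F = Filt-C (L.C (CommutativeRing.1# R)) (s≤s z≤n)
  Filt-^ P (suc n) F = Filt-* P (P ^ n) F (Filt-^ P n F)

module PolyFrobenius (K : FiniteField) {p : ℕ} (pr : Prime p) (n : ℕ) (q≡ : FiniteField.size K ≡ p ℕ.^ n) where
  open Field K
  open FiniteFieldTheory K
  open FieldPoly K
  open import Algebra.Properties.Semiring.Mult semiring using () renaming (_×_ to _⊗_)
  open import Algebra.Properties.Semiring.Mult P.semiring using () renaming (_×_ to _⊗ₚ_)
  open import Relation.Binary.Reasoning.Setoid P.setoid

  private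
    C-⊗ : ∀ m → m ⊗ₚ C 1# ≈ₚ C (m ⊗ 1#)
    C-⊗ zero    = P.sym C.0-homo
    C-⊗ (suc m) = P.trans (P.+-congˡ (C-⊗ m)) (P.sym (C.+-homo 1# (m ⊗ 1#)))

  frobeniusₚ : ∀ F G → (F +ₚ G) ^ₚ size ≈ₚ F ^ₚ size +ₚ G ^ₚ size
  frobeniusₚ F G = ≡.subst (λ q → (F +ₚ G) ^ₚ q ≈ₚ F ^ₚ q +ₚ G ^ₚ q) (sym q≡)
    (Frobenius.frobenius polyRing pr (P.trans (C-⊗ p) (P.trans (C.⟦⟧-cong (characteristic n q≡)) C.0-homo)) n F G)

  frobenius-C : ∀ a F → (C a +ₚ F) ^ₚ size ≈ₚ C a +ₚ F ^ₚ size
  frobenius-C a F = P.trans (frobeniusₚ (C a) F) (P.+-congʳ (P.trans (P.sym (C.^-homo a size)) (C.⟦⟧-cong (fermat a))))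

  -- The q-th power is additive, fixes constants and sends X to X^q. Modulo X^q only the constant
  -- term survives, which is how f^q is replaced by f(0) in the proof that R does not vanish.
  frobenius-X : ∀ F → ∃ λ T → F ^ₚ size ≈ₚ C (coef F 0) +ₚ X ^ₚ size *ₚ T
  frobenius-X F = drop 1 F ^ₚ size , (begin
    F ^ₚ size                                       ≈⟨ ^ₚ-cong size (split F) ⟩
    (C (coef F 0) +ₚ X *ₚ drop 1 F) ^ₚ size         ≈⟨ frobenius-C (coef F 0) (X *ₚ drop 1 F) ⟩
    C (coef F 0) +ₚ (X *ₚ drop 1 F) ^ₚ size         ≈⟨ P.+-congˡ (^ₚ-distrib-* X (drop 1 F) size) ⟩
    C (coef F 0) +ₚ X ^ₚ size *ₚ drop 1 F ^ₚ size   ∎)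
    where
    split : ∀ F → F ≈ₚ C (coef F 0) +ₚ X *ₚ drop 1 F
    split []      = P.sym (P.trans (P.+-cong C.0-homo (P.zeroʳ X)) (P.+-identityˡ []))
    split (a ∷ F) = horner a F

module Stepanov (K : FiniteField) {p : ℕ} (pr : Prime p) (n : ℕ) (q≡ : FiniteField.size K ≡ p ℕ.^ n)
                (h : ℕ) (q≡2h+1 : FiniteField.size K ≡ suc (h ℕ.+ h)) where
  open Field K
  open FiniteFieldTheory K
  open FieldPoly K
  open PolyFrobenius K pr n q≡
  open Inverse enumeration using (to; from; strictlyInverseˡ; strictlyInverseʳ)

  q = size

  module B = Polynomials polyRing
  module BR = CommutativeRing B.polyRing
  open import Algebra.Properties.CommutativeSemiring.Exp BR.commutativeSemiring using () renaming (_^_ to _^ᴮ_)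
  module BC = Hom B.constants
  open IntegerSolver B.polyRing using () renaming (solve to ringᴮ)

  Block : Set
  Block = Poly × Poly

  module _ (f : Poly) where
    R : List Block → Poly
    R []             = []
    R ((a , b) ∷ bs) = (a +ₚ f ^ₚ h *ₚ b) +ₚ X ^ₚ q *ₚ R bs

    Zero : Block → Set
    Zero (a , b) = a ≈ₚ [] × b ≈ₚ []

    Short : ℕ → Block → Set
    Short A (a , b) = length a ℕ.≤ suc A × length b ℕ.≤ suc A

    module _ (m A : ℕ) (lf : length f ℕ.≤ suc m) where
      length-R : ∀ bs → All (Short A) bs → length (R bs) ℕ.≤ suc (h ℕ.* m ℕ.+ A ℕ.+ length bs ℕ.* q)
      length-R []             []             = z≤n
      length-R ((a , b) ∷ bs) ((la , lb) ∷ ls) =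
        length-+ (a +ₚ f ^ₚ h *ₚ b) (X ^ₚ q *ₚ R bs)
          (length-+ a (f ^ₚ h *ₚ b)
            (ℕₚ.≤-trans la (s≤s (ℕₚ.≤-trans (ℕₚ.m≤n+m A (h ℕ.* m)) (ℕₚ.m≤m+n _ _))))
            (ℕₚ.≤-trans (length-* (f ^ₚ h) b (length-^ f h lf) lb) (s≤s (ℕₚ.m≤m+n _ _))))
          (ℕₚ.≤-trans (length-* (X ^ₚ q) (R bs) (length-^ X q X-Deg<) (length-R bs ls))
            (s≤s (ℕₚ.≤-reflexive (trans (cong (ℕ._+ (h ℕ.* m ℕ.+ A ℕ.+ length bs ℕ.* q)) (ℕₚ.*-identityʳ q))
              (trans (ℕₚ.+-comm q _) (trans (ℕₚ.+-assoc (h ℕ.* m ℕ.+ A) _ q) (cong (h ℕ.* m ℕ.+ A ℕ.+_) (ℕₚ.+-comm _ q))))))))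

    module Nonvanishing (m A : ℕ) (lf : length f ℕ.≤ suc m) (size-bound : A ℕ.+ A ℕ.+ m ℕ.< q)
                        (H : Quadratic) (g : Poly) (f≈ : f ≈ₚ quad H *ₚ g) (cop : Coprime (quad H) g) (f0≢0 : coef f 0 ≢ 0#) where
      open import Relation.Binary.Reasoning.Setoid P.setoid
      private
        f₀ = coef f 0
        T = proj₁ (frobenius-X f)
        G = f ^ₚ h

        f^2h+1 : G *ₚ G *ₚ f ≈ₚ C f₀ +ₚ X ^ₚ q *ₚ T
        f^2h+1 = begin
          G *ₚ G *ₚ f                   ≈⟨ P.*-congʳ (P.sym (^ₚ-homo-* f h h)) ⟩
          f ^ₚ (h ℕ.+ h) *ₚ f           ≈⟨ P.*-comm _ f ⟩
          f ^ₚ suc (h ℕ.+ h)            ≡⟨ cong (f ^ₚ_) (sym q≡2h+1) ⟩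
          f ^ₚ q                        ≈⟨ proj₂ (frobenius-X f) ⟩
          C f₀ +ₚ X ^ₚ q *ₚ T           ∎

        module _ (a b : Poly) (la : length a ℕ.≤ suc A) (lb : length b ℕ.≤ suc A) where
          E = a *ₚ a *ₚ f +ₚ P.- (C f₀ *ₚ (b *ₚ b))

          length-E : length E ℕ.≤ q
          length-E = length-+ (a *ₚ a *ₚ f) _
            (ℕₚ.≤-trans (length-* (a *ₚ a) f (length-* a a la la) lf) size-bound)
            (length-neg _ (ℕₚ.≤-trans (length-* {0} (C f₀) (b *ₚ b) (s≤s z≤n) (length-* b b lb lb)) (ℕₚ.≤-trans (s≤s (ℕₚ.m≤m+n (A ℕ.+ A) m)) size-bound)))

          -- Modulo X^q the hypothesis reads a + f^h b ≡ 0. Multiplying by (a - f^h b) f and using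
          -- f^(2h + 1) = f^q ≡ f(0) gives E ≡ 0. By `size-bound` the degree of E is below q, so the
          -- congruence is an equality.
          square-identity : ∀ S → (a +ₚ G *ₚ b) +ₚ X ^ₚ q *ₚ S ≈ₚ [] → a *ₚ a *ₚ f ≈ₚ C f₀ *ₚ (b *ₚ b)
          square-identity S e = P.trans (ringₚ 2 (λ x y → x := (x :- y) :+ y) P.refl _ (C f₀ *ₚ (b *ₚ b)))
                                  (P.trans (P.+-congʳ E≈0) (P.+-identityˡ _))
            where
            U = (a +ₚ G *ₚ b) +ₚ X ^ₚ q *ₚ S
            S′ = (G *ₚ b +ₚ G *ₚ b +ₚ X ^ₚ q *ₚ S) *ₚ S
            E≈ : E ≈ₚ X ^ₚ q *ₚ (T *ₚ (b *ₚ b) +ₚ S′ *ₚ f)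
            E≈ = begin
              E ≈⟨ ringₚ 7 (λ a b g x s f f₀ → a :* a :* f :- f₀ :* (b :* b) :=
                     ((a :+ g :* b) :+ x :* s) :* (a :- g :* b :- x :* s) :* f :+ (g :* g :* f :* (b :* b) :- f₀ :* (b :* b) :+ x :* ((g :* b :+ g :* b :+ x :* s) :* s :* f)))
                     P.refl a b G (X ^ₚ q) S f (C f₀) ⟩
              U *ₚ (a +ₚ P.- (G *ₚ b) +ₚ P.- (X ^ₚ q *ₚ S)) *ₚ f +ₚ (G *ₚ G *ₚ f *ₚ (b *ₚ b) +ₚ P.- (C f₀ *ₚ (b *ₚ b)) +ₚ X ^ₚ q *ₚ (S′ *ₚ f))
                ≈⟨ P.+-cong
                     (P.*-congʳ (P.*-congʳ e))
                     (P.+-congʳ (P.+-congʳ (P.*-congʳ f^2h+1))) ⟩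
              P.0# *ₚ (a +ₚ P.- (G *ₚ b) +ₚ P.- (X ^ₚ q *ₚ S)) *ₚ f +ₚ ((C f₀ +ₚ X ^ₚ q *ₚ T) *ₚ (b *ₚ b) +ₚ P.- (C f₀ *ₚ (b *ₚ b)) +ₚ X ^ₚ q *ₚ (S′ *ₚ f))
                ≈⟨ ringₚ 7 (λ z f f₀ x t b s → κ 0 :* z :* f :+ ((f₀ :+ x :* t) :* b :- f₀ :* b :+ x :* (s :* f)) := x :* (t :* b :+ s :* f))
                     P.refl (a +ₚ P.- (G *ₚ b) +ₚ P.- (X ^ₚ q *ₚ S)) f (C f₀) (X ^ₚ q) T (b *ₚ b) S′ ⟩
              X ^ₚ q *ₚ (T *ₚ (b *ₚ b) +ₚ S′ *ₚ f) ∎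
            E≈0 : E ≈ₚ []
            E≈0 = mk λ i → by-size i (i ℕₚ.<? q)
              where
              by-size : ∀ i → Dec (i ℕ.< q) → coef E i ≡ 0#
              by-size i (yes i<q) = trans (at E≈ i) (coef-X^* q _ i i<q)
              by-size i (no i≮q)  = Deg<-length E length-E i (ℕₚ.≮⇒≥ i≮q)

      -- The lowest block is zero by `square-identity` and `non-square`; then X^q is cancelled and
      -- the argument repeated for the next block.
      nonvanishing : ∀ bs → All (Short A) bs → R bs ≈ₚ [] → All Zero bs
      nonvanishing []             []               e = []
      nonvanishing ((a , b) ∷ bs) ((la , lb) ∷ ls) e = zero-ab ∷ nonvanishing bs ls (X^*-cancel q (R bs) (begin
          X ^ₚ q *ₚ R bs
            ≈⟨ ringₚ 2 (λ x r → x :* r := (κ 0 :+ κ 0) :+ x :* r) P.refl (X ^ₚ q) (R bs) ⟩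
          (P.0# +ₚ P.0#) +ₚ X ^ₚ q *ₚ R bs
            ≈⟨ P.+-congʳ (P.+-cong (P.sym (proj₁ zero-ab)) (P.sym (P.trans (P.*-congˡ (proj₂ zero-ab)) (P.zeroʳ G)))) ⟩
          (a +ₚ G *ₚ b) +ₚ X ^ₚ q *ₚ R bs ≈⟨ e ⟩
          [] ∎))
        where
        zero-ab : a ≈ₚ [] × b ≈ₚ []
        zero-ab = non-square H f g f₀ f≈ cop f0≢0 (suc A) a b (Deg<-length a la) (Deg<-length b lb) (square-identity a b la lb (R bs) e)

    -- p(Y) for Y = X + f(X) Z: since f(Y) = f(X) W with W a polynomial in X and Z, the values of
    -- f^h at a zero of f^h - ε become ε W^h.
    module Expansion (k : ℕ) (lf : length f ℕ.≤ k) (ε : Carrier) where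
      open Filtration KR k

      ι : Hom KR B.polyRing
      ι = B.constants ∘ʰ constants

      Y : B.Poly
      Y = X ∷ f ∷ []

      open Evaluation ι Y using () renaming (ev to at-Y)

      -- Made to satisfy p(Y) = p(X) + f Z · `divided-difference p`. The recursion results from
      -- writing the factor Y of Y · p(Y) as X + f Z.
      divided-difference : Poly → B.Poly
      divided-difference []      = []
      divided-difference (a ∷ p) = B.C X B.*ₚ divided-difference p B.+ₚ at-Y p

      W V : B.Poly
      W = C 1# ∷ divided-difference f
      V = W ^ᴮ h

      -- R with X replaced by Y, f^h by ε V and X^q by X. The last replacement is legitimate since
      -- X^q ≡ x modulo (X - x)^q and the coefficient X will be evaluated at x. One bivariate
      -- polynomial thus handles all x with f(x)^h = ε, and the linear conditions imposed on it do
      -- not depend on their number.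
      Q : List Block → B.Poly
      Q []             = []
      Q ((a , b) ∷ bs) = (at-Y a B.+ₚ B.C (C ε) B.*ₚ (at-Y b B.*ₚ V)) B.+ₚ B.C X B.*ₚ Q bs

      Filt-Y : Filt 1 Y
      Filt-Y = X-Deg< , ℕₚ.m≤n⇒m≤1+n (ℕₚ.m≤n⇒m≤1+n lf) , tt

      Filt-at-Y : ∀ d p → length p ℕ.≤ d → Filt d (at-Y p)
      Filt-at-Y d       []      l       = tt
      Filt-at-Y (suc d) (a ∷ p) (s≤s l) =
        Filt-+ (B.C (C a)) (Y B.*ₚ at-Y p) (Filt-C (C a) (s≤s z≤n)) (Filt-* Y (at-Y p) Filt-Y (Filt-at-Y d p l))

      Filt-divided-difference : ∀ d p → length p ℕ.≤ d → Filt d (divided-difference p)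
      Filt-divided-difference d       []      l       = tt
      Filt-divided-difference (suc d) (a ∷ p) (s≤s l) =
        Filt-+ (B.C X B.*ₚ divided-difference p) (at-Y p)
          (Filt-* (B.C X) (divided-difference p) (Filt-C X X-Deg<) (Filt-divided-difference d p l))
          (Filt-mono (at-Y p) (ℕₚ.n≤1+n d) (Filt-at-Y d p l))

      -- W has weight 0, because a factor Z pays for degree k. Hence so has every power of it:
      -- although h is about q / 2, the degree of the coefficient of Z^l in V stays below a bound
      -- free of h. This is what keeps the linear system small.
      Filt-V : Filt 0 V
      Filt-V = Filt-^ W h (s≤s z≤n , Filt-divided-difference k f lf)

      Filt-Q : ∀ A bs → All (Short A) bs → Filt (suc A ℕ.+ length bs) (Q bs)
      Filt-Q A []             []               = tt
      Filt-Q A ((a , b) ∷ bs) ((la , lb) ∷ ls) =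
        Filt-+ (at-Y a B.+ₚ B.C (C ε) B.*ₚ (at-Y b B.*ₚ V)) (B.C X B.*ₚ Q bs)
          (Filt-mono (at-Y a B.+ₚ B.C (C ε) B.*ₚ (at-Y b B.*ₚ V)) (ℕₚ.m≤m+n (suc A) _)
            (Filt-+ (at-Y a) _ (Filt-at-Y (suc A) a la)
              (≡.subst (λ d → Filt d (B.C (C ε) B.*ₚ (at-Y b B.*ₚ V))) (ℕₚ.+-identityʳ (suc A))
                (Filt-* {0} (B.C (C ε)) (at-Y b B.*ₚ V) (Filt-C (C ε) (s≤s z≤n)) (Filt-* (at-Y b) V (Filt-at-Y (suc A) b lb) Filt-V)))))
          (≡.subst (λ d → Filt d (B.C X B.*ₚ Q bs)) (sym (ℕₚ.+-suc (suc A) (length bs)))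
            (Filt-* (B.C X) (Q bs) (Filt-C X X-Deg<) (Filt-Q A bs ls)))

      at-Y-expansion : ∀ p → at-Y p B.≈ₚ B.C p B.+ₚ B.C f B.*ₚ (B.X B.*ₚ divided-difference p)
      at-Y-expansion []      = BR.sym (BR.trans (BR.+-cong BC.0-homo
        (BR.trans (BR.*-congˡ (BR.zeroʳ B.X)) (BR.zeroʳ (B.C f)))) (BR.+-identityˡ []))
      at-Y-expansion (a ∷ p) = begin
        B.C (C a) B.+ₚ Y B.*ₚ at-Y p
          ≈⟨ BR.+-congˡ (BR.*-congʳ (B.horner X (B.C f))) ⟩
        B.C (C a) B.+ₚ (B.C X B.+ₚ B.X B.*ₚ B.C f) B.*ₚ at-Y p
          ≈⟨ ringᴮ 5 (λ a x z f y → a :+ (x :+ z :* f) :* y := a :+ x :* y :+ f :* (z :* y)) BR.refl (B.C (C a)) (B.C X) B.X (B.C f) (at-Y p) ⟩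
        B.C (C a) B.+ₚ B.C X B.*ₚ at-Y p B.+ₚ B.C f B.*ₚ (B.X B.*ₚ at-Y p)
          ≈⟨ BR.+-congʳ (BR.+-congˡ (BR.*-congˡ (at-Y-expansion p))) ⟩
        B.C (C a) B.+ₚ B.C X B.*ₚ (B.C p B.+ₚ B.C f B.*ₚ (B.X B.*ₚ D)) B.+ₚ B.C f B.*ₚ (B.X B.*ₚ at-Y p)
          ≈⟨ ringᴮ 7 (λ a x p f z d y → a :+ x :* (p :+ f :* (z :* d)) :+ f :* (z :* y) := (a :+ x :* p) :+ f :* (z :* (x :* d :+ y))) BR.refl
                (B.C (C a)) (B.C X) (B.C p) (B.C f) B.X D (at-Y p) ⟩
        (B.C (C a) B.+ₚ B.C X B.*ₚ B.C p) B.+ₚ B.C f B.*ₚ (B.X B.*ₚ (B.C X B.*ₚ D B.+ₚ at-Y p))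
          ≈⟨ BR.+-congʳ
                (BR.sym (BR.trans (BC.⟦⟧-cong (horner a p)) (BR.trans (BC.+-homo (C a) (X *ₚ p)) (BR.+-congˡ (BC.*-homo X p))))) ⟩
        B.C (a ∷ p) B.+ₚ B.C f B.*ₚ (B.X B.*ₚ (B.C X B.*ₚ D B.+ₚ at-Y p)) ∎
        where
        open import Relation.Binary.Reasoning.Setoid BR.setoid
        D = divided-difference p

      f-at-Y : at-Y f B.≈ₚ B.C f B.*ₚ W
      f-at-Y = BR.trans (at-Y-expansion f) (BR.trans
        (ringᴮ 2 (λ f d → f :+ f :* d := f :* (κ 1 :+ d)) BR.refl (B.C f) (B.X B.*ₚ divided-difference f))
        (BR.*-congˡ (BR.sym (B.horner (C 1#) (divided-difference f)))))

      module Specialise (0<h : 0 ℕ.< h) (ε≢0 : ε ≢ 0#) (x : Carrier) (fx^h : eval x f ^ h ≡ ε) where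
        open import Relation.Binary.Reasoning.Setoid P.setoid
        private
          c = eval x f

          c≢0 : c ≢ 0#
          c≢0 z = ε≢0 (trans (sym fx^h) (trans (cong (_^ h) z) (0^ 0<h)))
            where
            0^ : ∀ {j} → 0 ℕ.< j → 0# ^ j ≡ 0#
            0^ (s≤s _) = zeroˡ _

          ζ = C (c ⁻¹) *ₚ lin x

        -- Coefficients are evaluated at x, and Z becomes (X - x) / f(x), so that Y = X + f Z
        -- becomes x + (X - x) = X. Powers of Z turn into powers of X - x, up to constants.
        θ : Hom B.polyRing polyRing
        θ = Evaluation.evHom (constants ∘ʰ evalHom x) ζ

        module θ = Hom θ

        θ-C : ∀ g → θ.⟦ B.C g ⟧ ≈ₚ C (eval x g)
        θ-C = Evaluation.ev-C (constants ∘ʰ evalHom x) ζ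

        θ-CX : θ.⟦ B.C X ⟧ ≈ₚ C x
        θ-CX = P.trans (θ-C X) (C.⟦⟧-cong (Evaluation.ev-X (idHom KR) x))

        θ-CC : ∀ a → θ.⟦ B.C (C a) ⟧ ≈ₚ C a
        θ-CC a = P.trans (θ-C (C a)) (C.⟦⟧-cong (eval-C x a))

        X≈ : X ≈ₚ C x +ₚ lin x
        X≈ = P.trans (ringₚ 2 (λ x c → x := c :+ (x :- c)) P.refl X (C x)) (P.+-congˡ (P.sym (lin≈ x)))

        cζ : C c *ₚ ζ ≈ₚ lin x
        cζ = begin
          C c *ₚ (C (c ⁻¹) *ₚ lin x)   ≈⟨ P.sym (P.*-assoc (C c) (C (c ⁻¹)) (lin x)) ⟩
          C c *ₚ C (c ⁻¹) *ₚ lin x     ≈⟨ P.*-congʳ (P.trans (P.sym (C.*-homo c (c ⁻¹))) (C.⟦⟧-cong (inverseʳ c c≢0))) ⟩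
          C 1# *ₚ lin x                ≈⟨ P.*-identityˡ (lin x) ⟩
          lin x                        ∎

        θ-Y : θ.⟦ Y ⟧ ≈ₚ X
        θ-Y = begin
          θ.⟦ Y ⟧                               ≈⟨ θ.⟦⟧-cong (B.horner X (B.C f)) ⟩
          θ.⟦ B.C X B.+ₚ B.X B.*ₚ B.C f ⟧       ≈⟨ P.trans (θ.+-homo (B.C X) _) (P.+-congˡ (θ.*-homo B.X (B.C f))) ⟩
          θ.⟦ B.C X ⟧ +ₚ θ.⟦ B.X ⟧ *ₚ θ.⟦ B.C f ⟧ ≈⟨ P.+-cong θ-CX (P.*-cong (Evaluation.ev-X (constants ∘ʰ evalHom x) ζ) (θ-C f)) ⟩
          C x +ₚ ζ *ₚ C c                       ≈⟨ P.+-congˡ (P.trans (P.*-comm ζ (C c)) cζ) ⟩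
          C x +ₚ lin x                          ≈⟨ P.sym X≈ ⟩
          X                                     ∎

        θ-at-Y : ∀ p → θ.⟦ at-Y p ⟧ ≈ₚ p
        θ-at-Y p = P.trans (ev-natural ι θ constants Y X θ-CC θ-Y p) (ev-X-id KR p)

        θ-V : C ε *ₚ θ.⟦ V ⟧ ≈ₚ f ^ₚ h
        θ-V = P.sym (begin
          f ^ₚ h                              ≈⟨ ^ₚ-cong h (P.sym (θ-at-Y f)) ⟩
          θ.⟦ at-Y f ⟧ ^ₚ h                   ≈⟨ ^ₚ-cong h (P.trans (θ.⟦⟧-cong f-at-Y) (P.trans (θ.*-homo (B.C f) W) (P.*-congʳ (θ-C f)))) ⟩
          (C c *ₚ θ.⟦ W ⟧) ^ₚ h               ≈⟨ ^ₚ-distrib-* (C c) θ.⟦ W ⟧ h ⟩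
          C c ^ₚ h *ₚ θ.⟦ W ⟧ ^ₚ h            ≈⟨ P.*-cong (P.trans (P.sym (C.^-homo c h)) (C.⟦⟧-cong fx^h)) (P.sym (θ.^-homo W h)) ⟩
          C ε *ₚ θ.⟦ V ⟧                      ∎)

        X^q : X ^ₚ q ≈ₚ C x +ₚ lin x ^ₚ q
        X^q = P.trans (^ₚ-cong q X≈) (frobenius-C x (lin x))

        -- The only discrepancy between R and the image of Q comes from X^q = x + (X - x)^q. It is a
        -- multiple of (X - x)^q, which does not affect vanishing to an order M ≤ q.
        R-Q : ∀ bs → ∃ λ S → R bs ≈ₚ θ.⟦ Q bs ⟧ +ₚ lin x ^ₚ q *ₚ S
        R-Q []             = [] , P.sym (P.trans (P.+-identityˡ _) (P.zeroʳ (lin x ^ₚ q)))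
        R-Q ((a , b) ∷ bs) with R-Q bs
        ... | S , e = R bs +ₚ C x *ₚ S , (begin
          (a +ₚ f ^ₚ h *ₚ b) +ₚ X ^ₚ q *ₚ R bs
            ≈⟨ P.+-congˡ (P.*-congʳ X^q) ⟩
          (a +ₚ f ^ₚ h *ₚ b) +ₚ (C x +ₚ lin x ^ₚ q) *ₚ R bs
            ≈⟨ ringₚ 4 (λ u x l r → u :+ (x :+ l) :* r := u :+ x :* r :+ l :* r) P.refl (a +ₚ f ^ₚ h *ₚ b) (C x) (lin x ^ₚ q) (R bs) ⟩
          (a +ₚ f ^ₚ h *ₚ b) +ₚ C x *ₚ R bs +ₚ lin x ^ₚ q *ₚ R bs
            ≈⟨ P.+-congʳ (P.+-congˡ (P.*-congˡ e)) ⟩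
          (a +ₚ f ^ₚ h *ₚ b) +ₚ C x *ₚ (θ.⟦ Q bs ⟧ +ₚ lin x ^ₚ q *ₚ S) +ₚ lin x ^ₚ q *ₚ R bs
            ≈⟨ ringₚ 6 (λ u x t l s r → u :+ x :* (t :+ l :* s) :+ l :* r := (u :+ x :* t) :+ l :* (r :+ x :* s)) P.refl
                 (a +ₚ f ^ₚ h *ₚ b) (C x) θ.⟦ Q bs ⟧ (lin x ^ₚ q) S (R bs) ⟩
          ((a +ₚ f ^ₚ h *ₚ b) +ₚ C x *ₚ θ.⟦ Q bs ⟧) +ₚ lin x ^ₚ q *ₚ (R bs +ₚ C x *ₚ S)
            ≈⟨ P.+-congʳ (P.sym θQ) ⟩
          θ.⟦ Q ((a , b) ∷ bs) ⟧ +ₚ lin x ^ₚ q *ₚ (R bs +ₚ C x *ₚ S) ∎)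
          where
          term : θ.⟦ B.C (C ε) B.*ₚ (at-Y b B.*ₚ V) ⟧ ≈ₚ f ^ₚ h *ₚ b
          term = begin
            θ.⟦ B.C (C ε) B.*ₚ (at-Y b B.*ₚ V) ⟧      ≈⟨ P.trans (θ.*-homo (B.C (C ε)) _) (P.*-cong (θ-CC ε) (P.trans (θ.*-homo (at-Y b) V) (P.*-congʳ (θ-at-Y b)))) ⟩
            C ε *ₚ (b *ₚ θ.⟦ V ⟧)                     ≈⟨ ringₚ 3 (λ e b v → e :* (b :* v) := e :* v :* b) P.refl (C ε) b θ.⟦ V ⟧ ⟩
            C ε *ₚ θ.⟦ V ⟧ *ₚ b                       ≈⟨ P.*-congʳ θ-V ⟩
            f ^ₚ h *ₚ b                               ∎
          θQ : θ.⟦ Q ((a , b) ∷ bs) ⟧ ≈ₚ (a +ₚ f ^ₚ h *ₚ b) +ₚ C x *ₚ θ.⟦ Q bs ⟧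
          θQ = P.trans (θ.+-homo (at-Y a B.+ₚ B.C (C ε) B.*ₚ (at-Y b B.*ₚ V)) (B.C X B.*ₚ Q bs))
                 (P.+-cong
                   (P.trans (θ.+-homo (at-Y a) _) (P.+-cong (θ-at-Y a) term))
                   (P.trans (θ.*-homo (B.C X) (Q bs)) (P.*-congʳ θ-CX)))

        vanishing : ∀ M bs → M ℕ.≤ q → (∀ l → l ℕ.< M → B.coef (Q bs) l ≈ₚ []) → lin x ^ₚ M ∥ R bs
        vanishing M bs M≤q z with R-Q bs | B.X^-divides M (Q bs) z
        ... | S , e | Divisibility.divides T eT = divides (C (c ⁻¹) ^ₚ M *ₚ θ.⟦ T ⟧ +ₚ lin x ^ₚ (q ℕ.∸ M) *ₚ S) (begin
          R bs                                  ≈⟨ e ⟩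
          θ.⟦ Q bs ⟧ +ₚ lin x ^ₚ q *ₚ S         ≈⟨ P.+-cong θQ (P.*-congʳ lin^q) ⟩
          C (c ⁻¹) ^ₚ M *ₚ lin x ^ₚ M *ₚ θ.⟦ T ⟧ +ₚ lin x ^ₚ M *ₚ lin x ^ₚ (q ℕ.∸ M) *ₚ S
            ≈⟨ ringₚ 5 (λ k l t r s → k :* l :* t :+ l :* r :* s := l :* (k :* t :+ r :* s)) P.refl (C (c ⁻¹) ^ₚ M) (lin x ^ₚ M) θ.⟦ T ⟧ (lin x ^ₚ (q ℕ.∸ M)) S ⟩
          lin x ^ₚ M *ₚ (C (c ⁻¹) ^ₚ M *ₚ θ.⟦ T ⟧ +ₚ lin x ^ₚ (q ℕ.∸ M) *ₚ S) ∎)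
          where
          lin^q : lin x ^ₚ q ≈ₚ lin x ^ₚ M *ₚ lin x ^ₚ (q ℕ.∸ M)
          lin^q = P.trans (P.reflexive (cong (lin x ^ₚ_) (sym (ℕₚ.m+[n∸m]≡n M≤q)))) (^ₚ-homo-* (lin x) M (q ℕ.∸ M))
          θQ : θ.⟦ Q bs ⟧ ≈ₚ C (c ⁻¹) ^ₚ M *ₚ lin x ^ₚ M *ₚ θ.⟦ T ⟧
          θQ = begin
            θ.⟦ Q bs ⟧                     ≈⟨ θ.⟦⟧-cong eT ⟩
            θ.⟦ B.X ^ᴮ M B.*ₚ T ⟧          ≈⟨ θ.*-homo (B.X ^ᴮ M) T ⟩
            θ.⟦ B.X ^ᴮ M ⟧ *ₚ θ.⟦ T ⟧      ≈⟨ P.*-congʳ (P.trans (θ.^-homo B.X M) (^ₚ-cong M (Evaluation.ev-X (constants ∘ʰ evalHom x) ζ))) ⟩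
            ζ ^ₚ M *ₚ θ.⟦ T ⟧              ≈⟨ P.*-congʳ (^ₚ-distrib-* (C (c ⁻¹)) (lin x) M) ⟩
            C (c ⁻¹) ^ₚ M *ₚ lin x ^ₚ M *ₚ θ.⟦ T ⟧ ∎

module StepanovBound (K : FiniteField) {p : ℕ} (pr : Prime p) (n : ℕ) (q≡ : FiniteField.size K ≡ p ℕ.^ n)
                     (h : ℕ) (0<h : 0 ℕ.< h) (q≡2h+1 : FiniteField.size K ≡ suc (h ℕ.+ h)) where
  open Field K
  open FieldPoly K
  open Stepanov K pr n q≡ h q≡2h+1
  open Inverse enumeration using (to; from; strictlyInverseˡ; strictlyInverseʳ)

  1<q : 1 ℕ.< q
  1<q = ≡.subst (1 ℕ.<_) (sym q≡2h+1) (s≤s (ℕₚ.≤-trans 0<h (ℕₚ.m≤m+n h h)))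

  -- Numbering the lists of given length by `Fin` makes the pigeonhole principle for finite sets
  -- applicable to tuples of polynomials.
  vec : ∀ n → Fin (q ℕ.^ n) → Poly
  vec zero    i = []
  vec (suc n) i = to (proj₁ (remQuot {q} (q ℕ.^ n) i)) ∷ vec n (proj₂ (remQuot {q} (q ℕ.^ n) i))

  length-vec : ∀ n i → length (vec n i) ≡ n
  length-vec zero    i = refl
  length-vec (suc n) i = cong suc (length-vec n _)

  vec-injective : ∀ n i j → vec n i ≈ₚ vec n j → i ≡ j
  vec-injective zero    zero zero e = refl
  vec-injective (suc n) i    j    e = remQuot-injective {q} (q ℕ.^ n) i j
    (cong₂ _,_ (trans (sym (strictlyInverseʳ _)) (trans (cong from (at e 0)) (strictlyInverseʳ _)))
               (vec-injective n _ _ (mk λ a → at e (suc a))))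

  ≈-from-difference : ∀ {x y} → x +ₚ P.- y ≈ₚ [] → x ≈ₚ y
  ≈-from-difference {x} {y} z = P.trans (ringₚ 2 (λ x y → x := x :- y :+ y) P.refl x y) (P.trans (P.+-congʳ z) (P.+-identityˡ y))

  module _ (A : ℕ) where
    private
      N = q ℕ.^ suc A

    block : Fin (N ℕ.* N) → Block
    block i = vec (suc A) (proj₁ (remQuot {N} N i)) , vec (suc A) (proj₂ (remQuot {N} N i))

    blocks : ∀ J → Fin ((N ℕ.* N) ℕ.^ J) → List Block
    blocks zero    i = []
    blocks (suc J) i = block (proj₁ (remQuot {N ℕ.* N} ((N ℕ.* N) ℕ.^ J) i)) ∷ blocks J (proj₂ (remQuot {N ℕ.* N} ((N ℕ.* N) ℕ.^ J) i))

    _⊝_ : Block → Block → Block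
    (a , b) ⊝ (a′ , b′) = a +ₚ P.- a′ , b +ₚ P.- b′

    differences : ∀ J → (i j : Fin ((N ℕ.* N) ℕ.^ J)) → List Block
    differences J i j = List.zipWith _⊝_ (blocks J i) (blocks J j)

    length-differences : ∀ J i j → length (differences J i j) ≡ J
    length-differences zero    i j = refl
    length-differences (suc J) i j = cong suc (length-differences J _ _)

    module _ (f : Poly) where
      Short-⊝ : ∀ i j → Short f A (block i ⊝ block j)
      Short-⊝ i j = short _ _ , short _ _
        where
        short : ∀ i j → length (vec (suc A) i +ₚ P.- vec (suc A) j) ℕ.≤ suc A
        short i j = length-+ (vec (suc A) i) _ (ℕₚ.≤-reflexive (length-vec (suc A) i)) (length-neg _ (ℕₚ.≤-reflexive (length-vec (suc A) j)))

      Short-differences : ∀ J i j → All (Short f A) (differences J i j)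
      Short-differences zero    i j = []
      Short-differences (suc J) i j = Short-⊝ _ _ ∷ Short-differences J _ _

      block-injective : ∀ i j → Zero f (block i ⊝ block j) → i ≡ j
      block-injective i j (e , e′) = remQuot-injective {N} N i j
        (cong₂ _,_ (vec-injective (suc A) _ _ (≈-from-difference e)) (vec-injective (suc A) _ _ (≈-from-difference e′)))

      differences-injective : ∀ J i j → All (Zero f) (differences J i j) → i ≡ j
      differences-injective zero    zero zero _        = refl
      differences-injective (suc J) i    j    (z ∷ zs) = remQuot-injective {N ℕ.* N} ((N ℕ.* N) ℕ.^ J) i j
        (cong₂ _,_ (block-injective _ _ z) (differences-injective J _ _ zs))

      module _ (k : ℕ) (lf : length f ℕ.≤ k) (ε : Carrier) where
        open Expansion f k lf ε
        open Filtration KR k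
        private
          module Y = Hom (Evaluation.evHom ι Y)

        -- Linearity of Q in the blocks: two tuples on which the low coefficients of Q agree yield,
        -- by subtraction, a tuple on which they vanish.
        Q-differences : ∀ J i j → Q (differences J i j) B.≈ₚ Q (blocks J i) B.+ₚ BR.- Q (blocks J j)
        Q-differences zero    i j = BR.sym (BR.-‿inverseʳ [])
        Q-differences (suc J) i j = begin
          Q (differences (suc J) i j)
            ≈⟨ BR.+-cong
                 (BR.+-cong (Y.sub-homo a a′) (BR.*-congˡ (BR.*-congʳ (Y.sub-homo b b′))))
                 (BR.*-congˡ (Q-differences J _ _)) ⟩
          ((Y.⟦ a ⟧ B.+ₚ BR.- Y.⟦ a′ ⟧) B.+ₚ B.C (C ε) B.*ₚ ((Y.⟦ b ⟧ B.+ₚ BR.- Y.⟦ b′ ⟧) B.*ₚ V)) B.+ₚ B.C X B.*ₚ (Q bs B.+ₚ BR.- Q bs′)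
            ≈⟨ ringᴮ 9 (λ a a′ e b b′ v x q q′ → ((a :- a′) :+ e :* ((b :- b′) :* v)) :+ x :* (q :- q′)
                 := ((a :+ e :* (b :* v)) :+ x :* q) :- ((a′ :+ e :* (b′ :* v)) :+ x :* q′)) BR.refl
                 Y.⟦ a ⟧ Y.⟦ a′ ⟧ (B.C (C ε)) Y.⟦ b ⟧ Y.⟦ b′ ⟧ V (B.C X) (Q bs) (Q bs′) ⟩
          Q (blocks (suc J) i) B.+ₚ BR.- Q (blocks (suc J) j) ∎
          where
          open import Relation.Binary.Reasoning.Setoid BR.setoid
          open IntegerSolver B.polyRing using () renaming (solve to ringᴮ)
          rᵢ = remQuot {N ℕ.* N} ((N ℕ.* N) ℕ.^ J) i
          rⱼ = remQuot {N ℕ.* N} ((N ℕ.* N) ℕ.^ J) j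
          a = proj₁ (block (proj₁ rᵢ))
          b = proj₂ (block (proj₁ rᵢ))
          a′ = proj₁ (block (proj₁ rⱼ))
          b′ = proj₂ (block (proj₁ rⱼ))
          bs = blocks J (proj₂ rᵢ)
          bs′ = blocks J (proj₂ rⱼ)

        -- Siegel's lemma over a finite field: more unknowns than equations.
        auxiliary : ∀ J M → M ℕ.* suc (suc A ℕ.+ J ℕ.+ M ℕ.* k) ℕ.< J ℕ.* (suc A ℕ.+ suc A) →
          ∃ λ bs → length bs ≡ J × All (Short f A) bs × ¬ All (Zero f) bs × (∀ l → l ℕ.< M → B.coef (Q bs) l ≈ₚ [])
        auxiliary J M few = differences J i j , length-differences J i j , Short-differences J i j
          , (λ z → Finₚ.<⇒≢ (proj₁ (proj₂ (proj₂ hole))) (differences-injective J i j z))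
          , λ l l<M → mk λ a → vanish l l<M a (a ℕₚ.<? e)
          where
          -- By `Filt-Q` the coefficient of Z^l in Q has degree at most A + 1 + J + lk; for l < M
          -- this leaves at most `e` equations each. The unknowns are the J · 2(A + 1) coefficients
          -- of the blocks.
          e = suc (suc A ℕ.+ J ℕ.+ M ℕ.* k)
          entry : Fin ((N ℕ.* N) ℕ.^ J) → Fin M → Fin e → Fin q
          entry i l a = from (coef (B.coef (Q (blocks J i)) (toℕ l)) (toℕ a))
          encode : Fin ((N ℕ.* N) ℕ.^ J) → Fin ((q ℕ.^ e) ℕ.^ M)
          encode i = funToFin (λ l → funToFin (entry i l))
          count : (q ℕ.^ e) ℕ.^ M ℕ.< (N ℕ.* N) ℕ.^ J
          count = ≡.subst₂ ℕ._<_
            (trans (cong (q ℕ.^_) (ℕₚ.*-comm M e)) (sym (ℕₚ.^-*-assoc q e M)))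
            (trans (cong (q ℕ.^_) (ℕₚ.*-comm J (suc A ℕ.+ suc A))) (trans (sym (ℕₚ.^-*-assoc q (suc A ℕ.+ suc A) J)) (cong (ℕ._^ J) (ℕₚ.^-distribˡ-+-* q (suc A) (suc A)))))
            (ℕₚ.^-monoʳ-< q 1<q few)
          hole = Finₚ.pigeonhole count encode
          i = proj₁ hole
          j = proj₁ (proj₂ hole)
          same : ∀ l a → l ℕ.< M → a ℕ.< e → coef (B.coef (Q (blocks J i)) l) a ≡ coef (B.coef (Q (blocks J j)) l) a
          same l a l<M a<e = ≡.subst₂ (λ l a → coef (B.coef (Q (blocks J i)) l) a ≡ coef (B.coef (Q (blocks J j)) l) a)
            (Finₚ.toℕ-fromℕ< l<M) (Finₚ.toℕ-fromℕ< a<e)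
            (trans (sym (strictlyInverseˡ _)) (trans (cong to
              (funToFin-injective (entry i (fromℕ< l<M)) (entry j (fromℕ< l<M))
                (funToFin-injective (λ l → funToFin (entry i l)) (λ l → funToFin (entry j l)) (proj₂ (proj₂ (proj₂ hole))) (fromℕ< l<M)) (fromℕ< a<e))) (strictlyInverseˡ _)))
          vanish : ∀ l → l ℕ.< M → ∀ a → Dec (a ℕ.< e) → coef (B.coef (Q (differences J i j)) l) a ≡ 0#
          vanish l l<M a (yes a<e) = trans
            (at (P.trans (B.at (Q-differences J i j) l) (P.trans (B.coef-+ (Q (blocks J i)) _ l) (P.+-congˡ (B.coef-neg (Q (blocks J j)) l)))) a)
            (trans (coef-+ (B.coef (Q (blocks J i)) l) _ a) (trans (cong (coef (B.coef (Q (blocks J i)) l) a +_) (coef-neg (B.coef (Q (blocks J j)) l) a)) (≡-0 (same l a l<M a<e))))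
          vanish l l<M a (no a≮e) = Deg<-length (B.coef (Q (differences J i j)) l)
            (ℕₚ.≤-trans (Filt-coef (Q (differences J i j)) (Filt-Q A _ (Short-differences J i j)) l)
              (s≤s (ℕₚ.+-mono-≤ (ℕₚ.≤-reflexive (cong (suc A ℕ.+_) (length-differences J i j))) (ℕₚ.*-monoˡ-≤ k (ℕₚ.<⇒≤ l<M)))))
            a (ℕₚ.≮⇒≥ a≮e)

  -- Otherwise R, of degree at most hm + A + Jq and divisible by (X - x)^M for every x in the list,
  -- would be zero, against `nonvanishing`.
  stepanov : ∀ f m A J M → length f ℕ.≤ suc m → (H : Quadratic) (g : Poly) → f ≈ₚ quad H *ₚ g → Coprime (quad H) g → coef f 0 ≢ 0# →
    M ℕ.≤ q → A ℕ.+ A ℕ.+ m ℕ.< q → M ℕ.* suc (suc A ℕ.+ J ℕ.+ M ℕ.* suc m) ℕ.< J ℕ.* (suc A ℕ.+ suc A) →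
    ∀ ε → ε ≢ 0# → ∀ xs → Unique xs → All (λ x → eval x f ^ h ≡ ε) xs →
    length xs ℕ.* M ℕ.≤ h ℕ.* m ℕ.+ A ℕ.+ J ℕ.* q
  stepanov f m A J M lf H g f≈ cop f0≢0 M≤q A-bound few ε ε≢0 xs un χs with auxiliary A f (suc m) lf ε J M few
  ... | bs , refl , short , nonzero , vanish = ℕₚ.≮⇒≥ λ large → nonzero
    (Nonvanishing.nonvanishing f m A lf A-bound H g f≈ cop f0≢0 bs short
      (many-roots M xs un _ (R f bs)
        (All.map (λ {x} χx → Expansion.Specialise.vanishing f (suc m) lf ε 0<h ε≢0 x χx M bs M≤q vanish) χs)
        (Deg<-length (R f bs) (length-R f m A lf bs short))
        large))

-- The quadratic character for q ≡ 3 (mod 4)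

module QuadraticCharacter (K : FiniteField) (k : ℕ) (q≡4k+3 : FiniteField.size K ≡ 3 ℕ.+ k ℕ.* 4) where
  open Field K
  open FiniteFieldTheory K
  open Inverse enumeration using (to; from; strictlyInverseˡ; strictlyInverseʳ)
  open import Algebra.Properties.Semiring.Mult semiring using (×-homo-+) renaming (_×_ to _⊗_)

  h : ℕ
  h = suc (k ℕ.+ k)

  q≡2h+1 : size ≡ suc (h ℕ.+ h)
  q≡2h+1 = trans q≡4k+3 (lemma k)
    where
    lemma : ∀ k → 3 ℕ.+ k ℕ.* 4 ≡ suc (suc (k ℕ.+ k) ℕ.+ suc (k ℕ.+ k))
    lemma = ℕ-Solver.solve-∀

  two≢0 : 1# + 1# ≢ 0#
  two≢0 z = 0≢1 (trans (sym size⊗1) (trans (cong (_⊗ 1#) q≡2h+1) (trans (cong (1# +_) (trans (×-homo-+ 1# h h) 2y≡0)) (+-identityʳ 1#))))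
    where
    y = h ⊗ 1#
    2y≡0 : y + y ≡ 0#
    2y≡0 = trans (ring 1 (λ y → y :+ y := (κ 1 :+ κ 1) :* y) refl y) (trans (cong (_* y) z) (zeroˡ y))

  elements-unique : Unique elements
  elements-unique = Uniqueₚ.tabulate⁺ (λ {i} {j} e → trans (sym (strictlyInverseʳ i)) (trans (cong from e) (strictlyInverseʳ j)))

  ∈-elements : ∀ x → x ∈ elements
  ∈-elements x = ≡.subst (_∈ elements) (strictlyInverseˡ x) (∈-tabulate⁺ (from x))

  χ : Carrier → Carrier
  χ x = x ^ h

  χ-* : ∀ x y → χ (x * y) ≡ χ x * χ y
  χ-* x y = ^-distrib-* x y h

  χ-0 : χ 0# ≡ 0#
  χ-0 = zeroˡ _

  -1≢0 : - 1# ≢ 0#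
  -1≢0 = -x≢0 (λ e → 0≢1 (sym e))

  1≢-1 : 1# ≢ - 1#
  1≢-1 e = two≢0 (trans (cong (1# +_) e) (-‿inverseʳ 1#))

  χ² : ∀ {x} → x ≢ 0# → χ x * χ x ≡ 1#
  χ² {x} x≢0 = *-cancelˡ x≢0 (trans (cong (x *_) (sym (^-homo-* x h h))) (trans (cong (x ^_) (sym q≡2h+1)) (trans (fermat x) (sym (*-identityʳ x)))))

  ±1-from-square : ∀ {y} → y * y ≡ 1# → y ≡ 1# ⊎ y ≡ - 1#
  ±1-from-square {y} e with y ≟ 1#
  ... | yes y≡1 = inj₁ y≡1
  ... | no y≢1  = inj₂ (-≡0 (trans (ring 1 (λ y → y :- :- κ 1 := y :+ κ 1) refl y)
    (*-zero (λ z → y≢1 (-≡0 z)) (trans (ring 1 (λ y → (y :- κ 1) :* (y :+ κ 1) := y :* y :- κ 1) refl y) (≡-0 e)))))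

  χ-±1 : ∀ {x} → x ≢ 0# → χ x ≡ 1# ⊎ χ x ≡ - 1#
  χ-±1 x≢0 = ±1-from-square (χ² x≢0)

  χ-square : ∀ {x} → x ≢ 0# → χ (x * x) ≡ 1#
  χ-square {x} x≢0 = trans (χ-* x x) (χ² x≢0)

  -- The exponent h = 2k + 1 is odd; here q ≡ 3 (mod 4) enters.
  χ-neg1 : χ (- 1#) ≡ - 1#
  χ-neg1 = trans (cong (- 1# *_) (trans (^-homo-* (- 1#) k k) (trans (sym (^-distrib-* (- 1#) (- 1#) k)) (trans (cong (_^ k) (ring 0 (:- κ 1 :* :- κ 1 := κ 1) refl)) (1^ k))))) (*-identityʳ _)
    where
    1^ : ∀ n → 1# ^ n ≡ 1#
    1^ zero    = refl
    1^ (suc n) = trans (*-identityˡ _) (1^ n)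

  χ-neg : ∀ x → χ (- x) ≡ - χ x
  χ-neg x = trans (cong χ (ring 1 (λ x → :- x := :- κ 1 :* x) refl x)) (trans (χ-* (- 1#) x) (trans (cong (_* χ x) χ-neg1) (ring 1 (λ y → :- κ 1 :* y := :- y) refl (χ x))))

  -- Since 2(k + 1) = h + 1, the square of x^(k + 1) is x · x^h.
  χ-sqrt : ∀ {x} → χ x ≡ 1# → ∃ λ y → y * y ≡ x
  χ-sqrt {x} e = x ^ suc k , trans (sym (^-homo-* x (suc k) (suc k))) (trans (cong (x ^_) (cong suc (ℕₚ.+-suc k k))) (trans (cong (x *_) e) (*-identityʳ x)))

  -- Euler's criterion; that character 1 implies being a square follows from the explicit root of
  -- `χ-sqrt`.
  η≡χ : ∀ x → η x ≡ χ x
  η≡χ x with x ≟ 0#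
  ... | yes refl = sym χ-0
  ... | no x≢0 with any? (λ y → (y * y) ≟ x) elements
  ...   | yes a = sym (trans (cong χ (sym (proj₂ (Any.satisfied a)))) (χ-square y≢0))
    where
    y≢0 : proj₁ (Any.satisfied a) ≢ 0#
    y≢0 z = x≢0 (trans (sym (proj₂ (Any.satisfied a))) (trans (cong₂ _*_ z z) (zeroˡ 0#)))
  ...   | no ¬a with χ-±1 x≢0
  ...     | inj₂ e = sym e
  ...     | inj₁ e with χ-sqrt e
  ...       | y , yy≡x = ⊥-elim (¬a (Any.map (λ { refl → yy≡x }) (∈-elements y)))

  -- The values of χ lie in the field, where a sum of them is known only modulo p. For estimates
  -- they are copied into ℤ.
  σ : Carrier → ℤ
  σ x with x ≟ 0#
  ... | yes _ = 0ℤ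
  ... | no _ with χ x ≟ 1#
  ...   | yes _ = 1ℤ
  ...   | no _  = -1ℤ

  data Sign (x : Carrier) : Set where
    null  : x ≡ 0#                  → σ x ≡ 0ℤ  → Sign x
    plus  : x ≢ 0# → χ x ≡ 1#       → σ x ≡ 1ℤ  → Sign x
    minus : x ≢ 0# → χ x ≡ - 1#     → σ x ≡ -1ℤ → Sign x

  sign : ∀ x → Sign x
  sign x with x ≟ 0# in e₀
  ... | yes x≡0 = null x≡0 σ≡
    where
    σ≡ : σ x ≡ 0ℤ
    σ≡ rewrite e₀ = refl
  ... | no x≢0 with χ x ≟ 1# in e₁
  ...   | yes χ≡1 = plus x≢0 χ≡1 σ≡
    where
    σ≡ : σ x ≡ 1ℤ
    σ≡ rewrite e₀ | e₁ = refl
  ...   | no χ≢1 with χ-±1 x≢0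
  ...     | inj₁ χ≡1  = ⊥-elim (χ≢1 χ≡1)
  ...     | inj₂ χ≡-1 = minus x≢0 χ≡-1 σ≡
    where
    σ≡ : σ x ≡ -1ℤ
    σ≡ rewrite e₀ | e₁ = refl

  σ-* : ∀ x y → σ (x * y) ≡ σ x ℤ.* σ y
  σ-* x y with sign x | sign y | sign (x * y)
  ... | null refl e | _ | s rewrite e = zero-case s
    where
    zero-case : Sign (0# * y) → σ (0# * y) ≡ 0ℤ ℤ.* σ y
    zero-case (null _ e)    = e
    zero-case (plus n _ _)  = ⊥-elim (n (zeroˡ y))
    zero-case (minus n _ _) = ⊥-elim (n (zeroˡ y))
  ... | plus n _ e | null refl e′ | null _ e″ rewrite e | e′ | e″ = refl
  ... | plus n _ e | null refl e′ | plus m _ _ = ⊥-elim (m (zeroʳ x))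
  ... | plus n _ e | null refl e′ | minus m _ _ = ⊥-elim (m (zeroʳ x))
  ... | minus n _ e | null refl e′ | null _ e″ rewrite e | e′ | e″ = refl
  ... | minus n _ e | null refl e′ | plus m _ _ = ⊥-elim (m (zeroʳ x))
  ... | minus n _ e | null refl e′ | minus m _ _ = ⊥-elim (m (zeroʳ x))
  ... | plus n _ _ | plus m _ _ | null z _ = ⊥-elim (*≢0 n m z)
  ... | plus n _ _ | minus m _ _ | null z _ = ⊥-elim (*≢0 n m z)
  ... | minus n _ _ | plus m _ _ | null z _ = ⊥-elim (*≢0 n m z)
  ... | minus n _ _ | minus m _ _ | null z _ = ⊥-elim (*≢0 n m z)
  ... | plus _ a e | plus _ b e′ | plus _ _ e″ rewrite e | e′ | e″ = refl
  ... | plus _ a e | plus _ b e′ | minus _ c _ = ⊥-elim (1≢-1 (trans (sym (*-identityˡ 1#)) (trans (sym (cong₂ _*_ a b)) (trans (sym (χ-* x y)) c))))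
  ... | plus _ a e | minus _ b e′ | minus _ _ e″ rewrite e | e′ | e″ = refl
  ... | plus _ a e | minus _ b e′ | plus _ c _ = ⊥-elim (1≢-1 (trans (sym c) (trans (χ-* x y) (trans (cong₂ _*_ a b) (*-identityˡ _)))))
  ... | minus _ a e | plus _ b e′ | minus _ _ e″ rewrite e | e′ | e″ = refl
  ... | minus _ a e | plus _ b e′ | plus _ c _ = ⊥-elim (1≢-1 (trans (sym c) (trans (χ-* x y) (trans (cong₂ _*_ a b) (*-identityʳ _)))))
  ... | minus _ a e | minus _ b e′ | plus _ _ e″ rewrite e | e′ | e″ = refl
  ... | minus _ a e | minus _ b e′ | minus _ c _ = ⊥-elim (1≢-1 (trans (ring 0 (κ 1 := :- κ 1 :* :- κ 1) refl) (trans (sym (cong₂ _*_ a b)) (trans (sym (χ-* x y)) c))))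

-- Bounds for character sums

∑ : ∀ {A : Set} → (A → ℤ) → List A → ℤ
∑ F []       = 0ℤ
∑ F (x ∷ xs) = F x ℤ.+ ∑ F xs

∑-cong : ∀ {A : Set} {F G : A → ℤ} → (∀ x → F x ≡ G x) → ∀ xs → ∑ F xs ≡ ∑ G xs
∑-cong e []       = ≡.refl
∑-cong e (x ∷ xs) = ≡.cong₂ ℤ._+_ (e x) (∑-cong e xs)

∑-linear : ∀ {A : Set} (F G : A → ℤ) c xs → ∑ (λ x → F x ℤ.+ c ℤ.* G x) xs ≡ ∑ F xs ℤ.+ c ℤ.* ∑ G xs
∑-linear F G c []       = lemma c
  where
  lemma : ∀ c → 0ℤ ≡ 0ℤ ℤ.+ c ℤ.* 0ℤ
  lemma = ℤ-Solver.solve-∀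
∑-linear F G c (x ∷ xs) = ≡.trans (≡.cong (ℤ._+_ (F x ℤ.+ c ℤ.* G x)) (∑-linear F G c xs)) (lemma (F x) (G x) c (∑ F xs) (∑ G xs))
  where
  lemma : ∀ a b c s t → (a ℤ.+ c ℤ.* b) ℤ.+ (s ℤ.+ c ℤ.* t) ≡ (a ℤ.+ s) ℤ.+ c ℤ.* (b ℤ.+ t)
  lemma = ℤ-Solver.solve-∀

∑-1 : ∀ {A : Set} (xs : List A) → ∑ (λ _ → 1ℤ) xs ≡ pos (length xs)
∑-1 []       = ≡.refl
∑-1 (x ∷ xs) = ≡.cong (ℤ._+_ 1ℤ) (∑-1 xs)

∣⊖∣≤ : ∀ m n T → m ℕ.≤ n ℕ.+ T → n ℕ.≤ m ℕ.+ T → ℤ.∣ m ℤ.⊖ n ∣ ℕ.≤ T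
∣⊖∣≤ m n T m≤ n≤ with ℕₚ.≤-total m n
... | inj₁ m≤n = ≡.subst (ℕ._≤ T) (≡.sym (ℤₚ.∣⊖∣-≤ m≤n)) (ℕₚ.m≤n+o⇒m∸n≤o n m n≤)
... | inj₂ n≤m = ≡.subst (ℕ._≤ T) (≡.trans (≡.sym (ℤₚ.∣⊖∣-≤ n≤m)) (ℤₚ.∣m⊖n∣≡∣n⊖m∣ n m)) (ℕₚ.m≤n+o⇒m∸n≤o m n m≤)

-- A sum of χ(f) over the field, deg f ≤ 32, is at most errorTerm / 2μ in absolute value.
opaque
  errorTerm : ℕ → ℕ → ℕ
  errorTerm q μ = 65 ℕ.* q ℕ.+ 64 ℕ.* μ

  errorTerm-def : ∀ q μ → 65 ℕ.* q ℕ.+ 64 ℕ.* μ ≡ errorTerm q μ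
  errorTerm-def q μ = ≡.refl

module CharacterSum (K : FiniteField) {p : ℕ} (pr : Prime p) (n : ℕ) (q≡ : FiniteField.size K ≡ p ℕ.^ n)
                    (k : ℕ) (q≡4k+3 : FiniteField.size K ≡ 3 ℕ.+ k ℕ.* 4) where
  open Field K
  open FieldPoly K
  open QuadraticCharacter K k q≡4k+3
  open StepanovBound K pr n q≡ h (s≤s z≤n) q≡2h+1 using (stepanov)

  module _ (F : Carrier → Carrier) where
    pos? = λ x → χ (F x) ≟ 1#
    neg? = λ x → χ (F x) ≟ (- 1#)
    zero? = λ x → F x ≟ 0#

    #₊ #₋ #₀ : List Carrier → ℕ
    #₊ xs = length (filter pos? xs)
    #₋ xs = length (filter neg? xs)
    #₀ xs = length (filter zero? xs)

    count-signs : ∀ xs → ∑ (σ ∘ F) xs ≡ pos (#₊ xs) ℤ.- pos (#₋ xs) × length xs ≡ #₊ xs ℕ.+ #₋ xs ℕ.+ #₀ xs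
    count-signs []       = refl , refl
    count-signs (x ∷ xs) with count-signs xs | sign (F x)
    ... | e₁ , e₂ | null z s
      rewrite Listₚ.filter-reject pos? {x} {xs} (λ e → 0≢1 (trans (sym χ-0) (trans (cong χ (sym z)) e)))
            | Listₚ.filter-reject neg? {x} {xs} (λ e → -1≢0 (trans (sym e) (trans (cong χ z) χ-0)))
            | Listₚ.filter-accept zero? {x} {xs} z
            | s | e₁ = ℤₚ.+-identityˡ _ , trans (cong suc e₂) (sym (ℕₚ.+-suc _ _))
    ... | e₁ , e₂ | plus nz c s
      rewrite Listₚ.filter-accept pos? {x} {xs} c
            | Listₚ.filter-reject neg? {x} {xs} (λ e → 1≢-1 (trans (sym c) e))
            | Listₚ.filter-reject zero? {x} {xs} nz
            | s | e₁ = lemma (pos (#₊ xs)) (pos (#₋ xs)) , cong suc e₂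
      where
      lemma : ∀ a b → 1ℤ ℤ.+ (a ℤ.- b) ≡ (1ℤ ℤ.+ a) ℤ.- b
      lemma = ℤ-Solver.solve-∀
    ... | e₁ , e₂ | minus nz c s
      rewrite Listₚ.filter-reject pos? {x} {xs} (λ e → 1≢-1 (trans (sym e) c))
            | Listₚ.filter-accept neg? {x} {xs} c
            | Listₚ.filter-reject zero? {x} {xs} nz
            | s | e₁ = lemma (pos (#₊ xs)) (pos (#₋ xs)) , trans (cong suc e₂) (cong (ℕ._+ #₀ xs) (sym (ℕₚ.+-suc (#₊ xs) (#₋ xs))))
      where
      lemma : ∀ a b → -1ℤ ℤ.+ (a ℤ.- b) ≡ a ℤ.- (1ℤ ℤ.+ b)
      lemma = ℤ-Solver.solve-∀

  length-elements : length elements ≡ size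
  length-elements = Listₚ.length-tabulate _

  module _ (μ A : ℕ) (h≡ : h ≡ 16 ℕ.+ A) (2μ≤q : μ ℕ.+ μ ℕ.≤ size) (few : μ ℕ.* (17 ℕ.+ 67 ℕ.* μ) ℕ.< 16 ℕ.* suc A) where
    private
      M = μ ℕ.+ μ

      T = errorTerm size μ

      -- The inequality 2A + 32 < q = 2h + 1, required for R ≠ 0, explains A = h - 16: this is the
      -- largest value allowed.
      A-bound : A ℕ.+ A ℕ.+ 32 ℕ.< size
      A-bound = ℕₚ.≤-reflexive (trans (lemma A) (sym (trans q≡2h+1 (cong (λ h → suc (h ℕ.+ h)) h≡))))
        where
        lemma : ∀ A → (1 ℕ.+ A ℕ.+ A ℕ.+ 32) ≡ (1 ℕ.+ (16 ℕ.+ A) ℕ.+ (16 ℕ.+ A))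
        lemma = ℕ-Solver.solve-∀

      -- For order of vanishing 2μ and μ + 16 blocks the terms 2μ(A + 1) on the two sides cancel,
      -- and the surplus of 16 blocks has to pay for the rest. With a surplus s the largest possible
      -- μ grows like √s and the error like (33 + 2s) / μ; the quotient (33 + 2s) / √s is least at s
      -- = 16.5.
      unknowns : M ℕ.* suc (suc A ℕ.+ (μ ℕ.+ 16) ℕ.+ M ℕ.* 33) ℕ.< (μ ℕ.+ 16) ℕ.* (suc A ℕ.+ suc A)
      unknowns = ≡.subst₂ ℕ._<_ (lemma₁ μ A) (lemma₂ μ A) (ℕₚ.+-monoʳ-< (2 ℕ.* (μ ℕ.* suc A)) (ℕₚ.*-monoʳ-< 2 few))
        where
        lemma₁ : ∀ μ A → 2 ℕ.* (μ ℕ.* (1 ℕ.+ A)) ℕ.+ 2 ℕ.* (μ ℕ.* (17 ℕ.+ 67 ℕ.* μ)) ≡ (μ ℕ.+ μ) ℕ.* (1 ℕ.+ (1 ℕ.+ A) ℕ.+ (μ ℕ.+ 16) ℕ.+ (μ ℕ.+ μ) ℕ.* 33)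
        lemma₁ = ℕ-Solver.solve-∀
        lemma₂ : ∀ μ A → 2 ℕ.* (μ ℕ.* (1 ℕ.+ A)) ℕ.+ 2 ℕ.* (16 ℕ.* (1 ℕ.+ A)) ≡ (μ ℕ.+ 16) ℕ.* ((1 ℕ.+ A) ℕ.+ (1 ℕ.+ A))
        lemma₂ = ℕ-Solver.solve-∀

      -- Here a, b, c count the arguments with character ε, -ε and 0. An upper bound for a alone
      -- suffices for one on a - b: its main term μq is half of M(a + b + c), so doubling the bound
      -- and subtracting Ma leaves Mb plus the error.
      balance : ∀ a b c → a ℕ.+ b ℕ.+ c ≡ size → c ℕ.≤ 32 → a ℕ.* M ℕ.≤ h ℕ.* 32 ℕ.+ A ℕ.+ (μ ℕ.+ 16) ℕ.* size → M ℕ.* a ℕ.≤ M ℕ.* b ℕ.+ T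
      balance a b c e c≤ bound = ℕₚ.+-cancelˡ-≤ (M ℕ.* a) _ _ (begin
        M ℕ.* a ℕ.+ M ℕ.* a                                           ≡⟨ lemma₁ M a ⟩
        2 ℕ.* (a ℕ.* M)                                               ≤⟨ ℕₚ.*-monoʳ-≤ 2 bound ⟩
        2 ℕ.* (h ℕ.* 32 ℕ.+ A ℕ.+ (μ ℕ.+ 16) ℕ.* size)                ≡⟨ lemma₂ h A μ size ⟩
        (64 ℕ.* h ℕ.+ 2 ℕ.* A) ℕ.+ (32 ℕ.* size ℕ.+ M ℕ.* size)       ≤⟨ ℕₚ.+-monoˡ-≤ (32 ℕ.* size ℕ.+ M ℕ.* size) small ⟩
        33 ℕ.* size ℕ.+ (32 ℕ.* size ℕ.+ M ℕ.* size)                  ≡⟨ cong (λ s → 33 ℕ.* size ℕ.+ (32 ℕ.* size ℕ.+ M ℕ.* s)) (sym e) ⟩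
        33 ℕ.* size ℕ.+ (32 ℕ.* size ℕ.+ M ℕ.* (a ℕ.+ b ℕ.+ c))       ≡⟨ lemma₃ size M a b c ⟩
        M ℕ.* a ℕ.+ (M ℕ.* b ℕ.+ (65 ℕ.* size ℕ.+ M ℕ.* c))           ≤⟨ ℕₚ.+-monoʳ-≤ (M ℕ.* a) (ℕₚ.+-monoʳ-≤ (M ℕ.* b) (ℕₚ.+-monoʳ-≤ (65 ℕ.* size) (ℕₚ.*-monoʳ-≤ M c≤))) ⟩
        M ℕ.* a ℕ.+ (M ℕ.* b ℕ.+ (65 ℕ.* size ℕ.+ M ℕ.* 32))          ≡⟨ cong (λ s → M ℕ.* a ℕ.+ (M ℕ.* b ℕ.+ s)) (trans (cong (65 ℕ.* size ℕ.+_) (lemma₄ μ)) (errorTerm-def size μ)) ⟩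
        M ℕ.* a ℕ.+ (M ℕ.* b ℕ.+ T)                                   ∎)
        where
        open ℕₚ.≤-Reasoning
        lemma₁ : ∀ M a → M ℕ.* a ℕ.+ M ℕ.* a ≡ 2 ℕ.* (a ℕ.* M)
        lemma₁ = ℕ-Solver.solve-∀
        lemma₂ : ∀ h A μ q → 2 ℕ.* (h ℕ.* 32 ℕ.+ A ℕ.+ (μ ℕ.+ 16) ℕ.* q) ≡ (64 ℕ.* h ℕ.+ 2 ℕ.* A) ℕ.+ (32 ℕ.* q ℕ.+ (μ ℕ.+ μ) ℕ.* q)
        lemma₂ = ℕ-Solver.solve-∀
        lemma₃ : ∀ q M a b c → 33 ℕ.* q ℕ.+ (32 ℕ.* q ℕ.+ M ℕ.* (a ℕ.+ b ℕ.+ c)) ≡ M ℕ.* a ℕ.+ (M ℕ.* b ℕ.+ (65 ℕ.* q ℕ.+ M ℕ.* c))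
        lemma₃ = ℕ-Solver.solve-∀
        lemma₄ : ∀ μ → (μ ℕ.+ μ) ℕ.* 32 ≡ 64 ℕ.* μ
        lemma₄ = ℕ-Solver.solve-∀
        lemma₅ : ∀ h → 33 ℕ.* (1 ℕ.+ h ℕ.+ h) ≡ 64 ℕ.* h ℕ.+ 2 ℕ.* h ℕ.+ 33
        lemma₅ = ℕ-Solver.solve-∀
        small : 64 ℕ.* h ℕ.+ 2 ℕ.* A ℕ.≤ 33 ℕ.* size
        small = begin
          64 ℕ.* h ℕ.+ 2 ℕ.* A           ≤⟨ ℕₚ.+-monoʳ-≤ (64 ℕ.* h) (ℕₚ.*-monoʳ-≤ 2 (≡.subst (A ℕ.≤_) (sym h≡) (ℕₚ.m≤n+m A 16))) ⟩
          64 ℕ.* h ℕ.+ 2 ℕ.* h           ≤⟨ ℕₚ.m≤m+n _ 33 ⟩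
          64 ℕ.* h ℕ.+ 2 ℕ.* h ℕ.+ 33    ≡⟨ sym (lemma₅ h) ⟩
          33 ℕ.* suc (h ℕ.+ h)           ≡⟨ cong (33 ℕ.*_) (sym q≡2h+1) ⟩
          33 ℕ.* size                    ∎

    few-zeros : ∀ f → length f ℕ.≤ 33 → coef f 0 ≢ 0# → #₀ (λ x → eval x f) elements ℕ.≤ 32
    few-zeros f lf f0≢0 = ℕₚ.≤-pred (roots-bound (Uniqueₚ.filter⁺ (zero? (λ x → eval x f)) elements-unique) 33 f (Deg<-length f lf)
      (λ z → f0≢0 (at z 0)) (Allₚ.all-filter (zero? (λ x → eval x f)) elements))

    char-sum-bound : ∀ f → length f ℕ.≤ 33 → (H : Quadratic) (g : Poly) → f ≈ₚ quad H *ₚ g → Coprime (quad H) g → coef f 0 ≢ 0# →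
                     ℤ.∣ pos M ℤ.* ∑ (λ x → σ (eval x f)) elements ∣ ℕ.≤ errorTerm size μ
    char-sum-bound f lf H g f≈ cop f0≢0 = ≡.subst (λ z → ℤ.∣ z ∣ ℕ.≤ T) (sym rewrite-sum)
        (∣⊖∣≤ (M ℕ.* a) (M ℕ.* b) T
          (balance a b c total c≤ (bound 1# (λ e → 0≢1 (sym e)) _ (Uniqueₚ.filter⁺ (pos? F) elements-unique) (Allₚ.all-filter (pos? F) elements)))
          (balance b a c (trans (cong (ℕ._+ c) (ℕₚ.+-comm b a)) total) c≤ (bound (- 1#) -1≢0 _ (Uniqueₚ.filter⁺ (neg? F) elements-unique) (Allₚ.all-filter (neg? F) elements))))
      where
      F = λ x → eval x f
      a = #₊ F elements
      b = #₋ F elements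
      c = #₀ F elements
      c≤ = few-zeros f lf f0≢0
      total : a ℕ.+ b ℕ.+ c ≡ size
      total = trans (sym (proj₂ (count-signs F elements))) length-elements
      bound : ∀ ε → ε ≢ 0# → ∀ xs → Unique xs → All (λ x → eval x f ^ h ≡ ε) xs → length xs ℕ.* M ℕ.≤ h ℕ.* 32 ℕ.+ A ℕ.+ (μ ℕ.+ 16) ℕ.* size
      bound = stepanov f 32 A (μ ℕ.+ 16) M lf H g f≈ cop f0≢0 2μ≤q A-bound unknowns
      rewrite-sum : pos M ℤ.* ∑ (λ x → σ (eval x f)) elements ≡ (M ℕ.* a) ℤ.⊖ (M ℕ.* b)
      rewrite-sum = trans (cong (pos M ℤ.*_) (proj₁ (count-signs F elements)))
        (trans (lemma (pos M) (pos a) (pos b)) (trans (cong₂ ℤ._-_ (sym (ℤₚ.pos-* M a)) (sym (ℤₚ.pos-* M b))) (ℤₚ.m-n≡m⊖n (M ℕ.* a) (M ℕ.* b))))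
        where
        lemma : ∀ m a b → m ℤ.* (a ℤ.- b) ≡ m ℤ.* a ℤ.- m ℤ.* b
        lemma = ℤ-Solver.solve-∀

-- Points with prescribed signs

module Independence (K : FiniteField) {p : ℕ} (pr : Prime p) (n : ℕ) (q≡ : FiniteField.size K ≡ p ℕ.^ n)
                    (k : ℕ) (q≡4k+3 : FiniteField.size K ≡ 3 ℕ.+ k ℕ.* 4) where
  open Field K
  open FieldPoly K
  open QuadraticCharacter K k q≡4k+3
  open CharacterSum K pr n q≡ k q≡4k+3

  -- With the common denominator d = 1 + x², the sign of ℓ H is that of quad H / d.
  d : Poly
  d = 1# ∷ 0# ∷ 1# ∷ []

  ℓ : Quadratic → Poly
  ℓ H = quad H *ₚ d

  Condition : Set
  Condition = Quadratic × ℤ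

  -- A nonzero constant term is required of every f to which Stepanov's method is applied.
  -- Coprimality with d keeps `quad H` a simple factor of products in which d occurs repeatedly.
  Admissible : Condition → Set
  Admissible (H , ε) = Quadratic.a₀ H ≢ 0# × Coprime (quad H) d × ℤ.∣ ε ∣ ≡ 1

  Independent : Condition → Condition → Set
  Independent (H , _) (H′ , _) = Coprime (quad H) (quad H′)

  -- Away from the zeros of the polynomials ℓ H, this is 2^n times the indicator function of the
  -- points satisfying all n conditions.
  weight : List Condition → Carrier → ℤ
  weight []             x = 1ℤ
  weight ((H , ε) ∷ cs) x = (1ℤ ℤ.+ ε ℤ.* σ (eval x (ℓ H))) ℤ.* weight cs x

  -- A partially expanded sum: g is the product of the factors chosen so far, `cs` are the
  -- conditions still to be expanded.
  S : List Condition → Poly → ℤ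
  S cs g = ∑ (λ x → σ (eval x g) ℤ.* weight cs x) elements

  S₀ : List Condition → ℤ
  S₀ cs = ∑ (weight cs) elements

  S-step : ∀ H ε cs g → S ((H , ε) ∷ cs) g ≡ S cs g ℤ.+ ε ℤ.* S cs (g *ₚ ℓ H)
  S-step H ε cs g = trans (∑-cong pointwise elements) (∑-linear _ _ ε elements)
    where
    lemma : ∀ g e l w → g ℤ.* ((1ℤ ℤ.+ e ℤ.* l) ℤ.* w) ≡ g ℤ.* w ℤ.+ e ℤ.* (g ℤ.* l ℤ.* w)
    lemma = ℤ-Solver.solve-∀
    pointwise : ∀ x → σ (eval x g) ℤ.* ((1ℤ ℤ.+ ε ℤ.* σ (eval x (ℓ H))) ℤ.* weight cs x)
                    ≡ σ (eval x g) ℤ.* weight cs x ℤ.+ ε ℤ.* (σ (eval x (g *ₚ ℓ H)) ℤ.* weight cs x)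
    pointwise x = trans (lemma (σ (eval x g)) ε (σ (eval x (ℓ H))) (weight cs x))
      (cong (λ z → σ (eval x g) ℤ.* weight cs x ℤ.+ ε ℤ.* (z ℤ.* weight cs x)) (sym (trans (cong σ (eval-* x g (ℓ H))) (σ-* _ _))))

  S₀-step : ∀ H ε cs → S₀ ((H , ε) ∷ cs) ≡ S₀ cs ℤ.+ ε ℤ.* S cs (ℓ H)
  S₀-step H ε cs = trans (∑-cong pointwise elements) (∑-linear _ _ ε elements)
    where
    lemma : ∀ e l w → (1ℤ ℤ.+ e ℤ.* l) ℤ.* w ≡ w ℤ.+ e ℤ.* (l ℤ.* w)
    lemma = ℤ-Solver.solve-∀
    pointwise : ∀ x → (1ℤ ℤ.+ ε ℤ.* σ (eval x (ℓ H))) ℤ.* weight cs x ≡ weight cs x ℤ.+ ε ℤ.* (σ (eval x (ℓ H)) ℤ.* weight cs x)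
    pointwise x = lemma ε (σ (eval x (ℓ H))) (weight cs x)

  length-*ℓ : ∀ {m} g H → length g ℕ.≤ suc m → length (g *ₚ ℓ H) ℕ.≤ suc (m ℕ.+ 4)
  length-*ℓ g H lg = length-* g (ℓ H) lg (length-* {2} {2} (quad H) d ℕₚ.≤-refl ℕₚ.≤-refl)

  coef-*-0 : ∀ {f g} → coef f 0 ≢ 0# → coef g 0 ≢ 0# → coef (f *ₚ g) 0 ≢ 0#
  coef-*-0 {f} {g} f0 g0 z = *≢0 f0 g0 (trans (sym (coef-* f g 0)) z)

  ℓ-0 : ∀ H → Quadratic.a₀ H ≢ 0# → coef (ℓ H) 0 ≢ 0#
  ℓ-0 H a₀≢0 = coef-*-0 {quad H} {d} a₀≢0 (λ e → 0≢1 (sym e))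

  product : List Condition → Poly
  product []             = C 1#
  product ((H , _) ∷ cs) = product cs *ₚ ℓ H

  length-product : ∀ cs → length (product cs) ℕ.≤ suc (length cs ℕ.* 4)
  length-product []             = s≤s z≤n
  length-product ((H , _) ∷ cs) = ℕₚ.≤-trans (length-*ℓ (product cs) H (length-product cs)) (s≤s (ℕₚ.≤-reflexive (ℕₚ.+-comm (length cs ℕ.* 4) 4)))

  product-0 : ∀ cs → All Admissible cs → coef (product cs) 0 ≢ 0#
  product-0 []             []               = λ e → 0≢1 (sym e)
  product-0 ((H , _) ∷ cs) ((a , _) ∷ adm) = coef-*-0 {product cs} {ℓ H} (product-0 cs adm) (ℓ-0 H a)

  private
    ∣1+εσ∣≤2 : ∀ ε x → ℤ.∣ ε ∣ ≡ 1 → ℤ.∣ 1ℤ ℤ.+ ε ℤ.* σ x ∣ ℕ.≤ 2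
    ∣1+εσ∣≤2 ε x ∣ε∣ = ℕₚ.≤-trans (ℤₚ.∣i+j∣≤∣i∣+∣j∣ 1ℤ (ε ℤ.* σ x)) (s≤s (≡.subst (ℕ._≤ 1) (sym (ℤₚ.abs-* ε (σ x)))
      (≡.subst (λ z → z ℕ.* ℤ.∣ σ x ∣ ℕ.≤ 1) (sym ∣ε∣) (≡.subst (ℕ._≤ 1) (sym (ℕₚ.*-identityˡ _)) (∣σ∣≤1 (sign x))))))
      where
      ∣σ∣≤1 : Sign x → ℤ.∣ σ x ∣ ℕ.≤ 1
      ∣σ∣≤1 (null _ e)    rewrite e = z≤n
      ∣σ∣≤1 (plus _ _ e)  rewrite e = s≤s z≤n
      ∣σ∣≤1 (minus _ _ e) rewrite e = s≤s z≤n

  ∣weight∣≤ : ∀ cs → All Admissible cs → ∀ x → ℤ.∣ weight cs x ∣ ℕ.≤ 2 ℕ.^ length cs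
  ∣weight∣≤ []             []                   x = s≤s z≤n
  ∣weight∣≤ ((H , ε) ∷ cs) ((_ , _ , ∣ε∣) ∷ adm) x = ≡.subst (ℕ._≤ 2 ℕ.^ suc (length cs)) (sym (ℤₚ.abs-* (1ℤ ℤ.+ ε ℤ.* σ (eval x (ℓ H))) _))
    (ℕₚ.*-mono-≤ (∣1+εσ∣≤2 ε (eval x (ℓ H)) ∣ε∣) (∣weight∣≤ cs adm x))

  Satisfies : Carrier → Condition → Set
  Satisfies x (H , ε) = σ (eval x (ℓ H)) ≡ ε

  private
    unit-signs : ∀ ε x → ℤ.∣ ε ∣ ≡ 1 → x ≢ 0# → σ x ≡ ε ⊎ 1ℤ ℤ.+ ε ℤ.* σ x ≡ 0ℤ
    unit-signs (pos 1)   x refl x≢0 with sign x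
    ... | null z _    = ⊥-elim (x≢0 z)
    ... | plus _ _ e  = inj₁ e
    ... | minus _ _ e rewrite e = inj₂ refl
    unit-signs -[1+ 0 ] x refl x≢0 with sign x
    ... | null z _    = ⊥-elim (x≢0 z)
    ... | plus _ _ e rewrite e = inj₂ refl
    ... | minus _ _ e = inj₁ e

  weight-zero : ∀ cs → All Admissible cs → ∀ x → eval x (product cs) ≢ 0# → All (Satisfies x) cs ⊎ weight cs x ≡ 0ℤ
  weight-zero []             []                    x nz = inj₁ []
  weight-zero ((H , ε) ∷ cs) ((_ , _ , ∣ε∣) ∷ adm) x nz
    with unit-signs ε (eval x (ℓ H)) ∣ε∣ (λ z → nz (trans (eval-* x (product cs) (ℓ H)) (trans (cong (eval x (product cs) *_) z) (zeroʳ _))))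
  ... | inj₂ z rewrite z = inj₂ (ℤₚ.*-zeroˡ (weight cs x))
  ... | inj₁ s with weight-zero cs adm x (λ z → nz (trans (eval-* x (product cs) (ℓ H)) (trans (cong (_* eval x (ℓ H)) z) (zeroˡ _))))
  ...   | inj₁ ss = inj₁ (s ∷ ss)
  ...   | inj₂ z rewrite z = inj₂ (ℤₚ.*-zeroʳ (1ℤ ℤ.+ ε ℤ.* σ (eval x (ℓ H))))

  -- At a point that is neither a zero of `product cs` nor a solution, some factor 1 + εσ is 0. If
  -- the search fails, only zeros contribute, each at most 2^n.
  search : ∀ cs → All Admissible cs → ∀ xs → (∃ λ x → All (Satisfies x) cs) ⊎
           ℤ.∣ ∑ (weight cs) xs ∣ ℕ.≤ #₀ (λ x → eval x (product cs)) xs ℕ.* 2 ℕ.^ length cs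
  search cs adm []       = inj₂ z≤n
  search cs adm (x ∷ xs) with search cs adm xs
  ... | inj₁ found = inj₁ found
  ... | inj₂ bound with eval x (product cs) ≟ 0#
  ...   | yes _ =
          inj₂ (ℕₚ.≤-trans (ℤₚ.∣i+j∣≤∣i∣+∣j∣ (weight cs x) _) (ℕₚ.+-mono-≤ (∣weight∣≤ cs adm x) bound))
  ...   | no nz with weight-zero cs adm x nz
  ...     | inj₁ found = inj₁ (x , found)
  ...     | inj₂ z rewrite z = inj₂ (ℕₚ.≤-trans (ℕₚ.≤-reflexive (cong ℤ.∣_∣ (ℤₚ.+-identityˡ (∑ (weight cs) xs)))) bound)

  module _ (μ A : ℕ) (h≡ : h ≡ 16 ℕ.+ A) (2μ≤q : μ ℕ.+ μ ℕ.≤ size) (few : μ ℕ.* (17 ℕ.+ 67 ℕ.* μ) ℕ.< 16 ℕ.* suc A) where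
    private
      M = μ ℕ.+ μ
      t = errorTerm size μ

      combine : ∀ ε a b {B} → ℤ.∣ ε ∣ ≡ 1 → ℤ.∣ pos M ℤ.* a ∣ ℕ.≤ B → ℤ.∣ pos M ℤ.* b ∣ ℕ.≤ B → ℤ.∣ pos M ℤ.* (a ℤ.+ ε ℤ.* b) ∣ ℕ.≤ 2 ℕ.* B
      combine ε a b {B} ∣ε∣ ba bb = begin
        ℤ.∣ pos M ℤ.* (a ℤ.+ ε ℤ.* b) ∣                          ≡⟨ cong ℤ.∣_∣ (lemma (pos M) a ε b) ⟩
        ℤ.∣ pos M ℤ.* a ℤ.+ ε ℤ.* (pos M ℤ.* b) ∣                ≤⟨ ℤₚ.∣i+j∣≤∣i∣+∣j∣ (pos M ℤ.* a) _ ⟩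
        ℤ.∣ pos M ℤ.* a ∣ ℕ.+ ℤ.∣ ε ℤ.* (pos M ℤ.* b) ∣          ≡⟨ cong (ℤ.∣ pos M ℤ.* a ∣ ℕ.+_) (trans (ℤₚ.abs-* ε _) (trans (cong (ℕ._* ℤ.∣ pos M ℤ.* b ∣) ∣ε∣) (ℕₚ.*-identityˡ _))) ⟩
        ℤ.∣ pos M ℤ.* a ∣ ℕ.+ ℤ.∣ pos M ℤ.* b ∣                  ≤⟨ ℕₚ.+-mono-≤ ba bb ⟩
        B ℕ.+ B                                                  ≡⟨ cong (B ℕ.+_) (sym (ℕₚ.+-identityʳ B)) ⟩
        2 ℕ.* B                                                  ∎
        where
        open ℕₚ.≤-Reasoning
        lemma : ∀ m a e b → m ℤ.* (a ℤ.+ e ℤ.* b) ≡ m ℤ.* a ℤ.+ e ℤ.* (m ℤ.* b)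
        lemma = ℤ-Solver.solve-∀

    -- Each remaining condition is either left out or multiplied into g, which doubles the number of
    -- terms. The factor H, fixed at the first choice, remains simple because everything multiplied
    -- in later is coprime to it. The degree bound m grows by 4 for each condition, within the
    -- budget of 32.
    S-bound : ∀ cs m g H r → length cs ℕ.* 4 ℕ.+ m ℕ.≤ 32 → length g ℕ.≤ suc m → coef g 0 ≢ 0# → g ≈ₚ quad H *ₚ r → Coprime (quad H) r →
              Coprime (quad H) d → All (λ c → Coprime (quad H) (quad (proj₁ c))) cs → All Admissible cs →
              ℤ.∣ pos M ℤ.* S cs g ∣ ℕ.≤ 2 ℕ.^ length cs ℕ.* t
    S-bound [] m g H r m≤ lg g0 g≈ cop copd [] [] = ≡.subst₂ (λ s B → ℤ.∣ pos M ℤ.* s ∣ ℕ.≤ B)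
      (∑-cong (λ x → sym (ℤₚ.*-identityʳ (σ (eval x g)))) elements) (sym (ℕₚ.*-identityˡ t))
      (char-sum-bound μ A h≡ 2μ≤q few g (ℕₚ.≤-trans lg (s≤s m≤)) H r g≈ cop g0)
    S-bound ((H′ , ε) ∷ cs) m g H r m≤ lg g0 g≈ cop copd (cH′ ∷ cHs) ((a₀ , _ , ∣ε∣) ∷ adm) =
      ≡.subst₂ (λ s B → ℤ.∣ pos M ℤ.* s ∣ ℕ.≤ B) (sym (S-step H′ ε cs g)) (sym (ℕₚ.*-assoc 2 (2 ℕ.^ length cs) t))
        (combine ε _ _ ∣ε∣
          (S-bound cs m g H r (ℕₚ.≤-trans (ℕₚ.m≤n+m (length cs ℕ.* 4 ℕ.+ m) 4) m≤) lg g0 g≈ cop copd cHs adm)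
          (S-bound cs (m ℕ.+ 4) (g *ₚ ℓ H′) H (r *ₚ ℓ H′) (≡.subst (ℕ._≤ 32) (lemma (length cs ℕ.* 4) m) m≤) (length-*ℓ g H′ lg)
            (coef-*-0 {g} {ℓ H′} g0 (ℓ-0 H′ a₀)) (P.trans (P.*-congʳ g≈) (P.*-assoc (quad H) r (ℓ H′)))
            (Coprime-* cop (Coprime-* cH′ copd)) copd cHs adm))
      where
      lemma : ∀ l m → 4 ℕ.+ l ℕ.+ m ≡ l ℕ.+ (m ℕ.+ 4)
      lemma = ℕ-Solver.solve-∀

    -- The empty product of characters contributes the main term q. Any other product has a first
    -- factor ℓ H, and its quadratic is the simple factor handed to `S-bound`.
    S₀-bound : ∀ cs → length cs ℕ.* 4 ℕ.≤ 32 → AllPairs Independent cs → All Admissible cs →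
               ℤ.∣ pos M ℤ.* (S₀ cs ℤ.- pos size) ∣ ℕ.≤ 2 ℕ.^ length cs ℕ.* t
    S₀-bound [] l≤ [] [] = ≡.subst (λ s → ℤ.∣ s ∣ ℕ.≤ 1 ℕ.* t) (sym (trans (cong (λ s → pos M ℤ.* (s ℤ.- pos size)) (trans (∑-1 elements) (cong pos length-elements)))
                             (lemma (pos M) (pos size)))) z≤n
      where
      lemma : ∀ m q → m ℤ.* (q ℤ.- q) ≡ 0ℤ
      lemma = ℤ-Solver.solve-∀
    S₀-bound ((H , ε) ∷ cs) l≤ (ind ∷ inds) ((a₀ , copd , ∣ε∣) ∷ adm) =
      ≡.subst₂ (λ s B → ℤ.∣ pos M ℤ.* s ∣ ℕ.≤ B) (sym (trans (cong (ℤ._- pos size) (S₀-step H ε cs)) (lemma (S₀ cs) (ε ℤ.* S cs (ℓ H)) (pos size)))) (sym (ℕₚ.*-assoc 2 (2 ℕ.^ length cs) t))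
        (combine ε _ _ ∣ε∣
          (S₀-bound cs (ℕₚ.≤-trans (ℕₚ.m≤n+m _ 4) l≤) inds adm)
          (S-bound cs 4 (ℓ H) H d (≡.subst (ℕ._≤ 32) (ℕₚ.+-comm 4 (length cs ℕ.* 4)) l≤) (length-* {2} {2} (quad H) d ℕₚ.≤-refl ℕₚ.≤-refl)
            (ℓ-0 H a₀) P.refl copd copd ind adm))
      where
      lemma : ∀ a b q → (a ℤ.+ b) ℤ.- q ≡ (a ℤ.- q) ℤ.+ b
      lemma = ℤ-Solver.solve-∀

    -- Without a suitable point, |S₀| would be at most 32 · 256 = 8192, one multiple of 256 for each
    -- zero of the product, while S₀ differs from q by at most 256 · `t` / M.
    realise : ∀ cs → length cs ℕ.≤ 8 → AllPairs Independent cs → All Admissible cs →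
              256 ℕ.* errorTerm size μ ℕ.+ (μ ℕ.+ μ) ℕ.* 8192 ℕ.< (μ ℕ.+ μ) ℕ.* size → ∃ λ x → All (Satisfies x) cs
    realise cs l≤ inds adm large with search cs adm elements
    ... | inj₁ found = found
    ... | inj₂ bound = ⊥-elim (ℕₚ.<⇒≱ large (begin
        M ℕ.* size                                                                   ≡⟨ ℤₚ.abs-* (pos M) (pos size) ⟨
        ℤ.∣ pos M ℤ.* pos size ∣                                                     ≡⟨ cong ℤ.∣_∣ (lemma (pos M) (pos size) (S₀ cs)) ⟩
        ℤ.∣ ℤ.- (pos M ℤ.* (S₀ cs ℤ.- pos size)) ℤ.+ pos M ℤ.* S₀ cs ∣               ≤⟨ ℤₚ.∣i+j∣≤∣i∣+∣j∣ (ℤ.- (pos M ℤ.* (S₀ cs ℤ.- pos size))) _ ⟩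
        ℤ.∣ ℤ.- (pos M ℤ.* (S₀ cs ℤ.- pos size)) ∣ ℕ.+ ℤ.∣ pos M ℤ.* S₀ cs ∣         ≡⟨ cong₂ ℕ._+_ (ℤₚ.∣-i∣≡∣i∣ (pos M ℤ.* (S₀ cs ℤ.- pos size))) (ℤₚ.abs-* (pos M) (S₀ cs)) ⟩
        ℤ.∣ pos M ℤ.* (S₀ cs ℤ.- pos size) ∣ ℕ.+ M ℕ.* ℤ.∣ S₀ cs ∣                   ≤⟨ ℕₚ.+-mono-≤ (S₀-bound cs (ℕₚ.*-monoˡ-≤ 4 l≤) inds adm) (ℕₚ.*-monoʳ-≤ M bound) ⟩
        2 ℕ.^ length cs ℕ.* t ℕ.+ M ℕ.* (zeros ℕ.* 2 ℕ.^ length cs)                  ≤⟨ ℕₚ.+-mono-≤ (ℕₚ.*-monoˡ-≤ t 2^≤) (ℕₚ.*-monoʳ-≤ M (ℕₚ.*-mono-≤ zeros≤ 2^≤)) ⟩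
        256 ℕ.* t ℕ.+ M ℕ.* 8192                                             ∎))
      where
      open ℕₚ.≤-Reasoning
      lemma : ∀ m q s → m ℤ.* q ≡ ℤ.- (m ℤ.* (s ℤ.- q)) ℤ.+ m ℤ.* s
      lemma = ℤ-Solver.solve-∀
      2^≤ : 2 ℕ.^ length cs ℕ.≤ 256
      2^≤ = ℕₚ.^-monoʳ-≤ 2 l≤
      zeros = #₀ (λ x → eval x (product cs)) elements
      zeros≤ : zeros ℕ.≤ 32
      zeros≤ = few-zeros μ A h≡ 2μ≤q few (product cs) (ℕₚ.≤-trans (length-product cs) (s≤s (ℕₚ.*-monoˡ-≤ 4 l≤))) (product-0 cs adm)

-- The conic and the lines cutting it

-- For σ, τ = ±1, D = 1 + x² and E = σ(1 - x²) + 2τx, the values E / D are, up to sign, the abscissae (τ = σ) or the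
-- ordinates (τ = - σ) of the points of s² + t² = 2, and line is the equation w (E / D) = - γ cleared of denominators.
module Conic (R : Ring) where
  open CommutativeRing R
  open IntegerSolver R
  open import Relation.Binary.Reasoning.Setoid setoid

  D : Carrier → Carrier
  D x = 1# + x * x

  E : Carrier → Carrier → Carrier → Carrier
  E σ τ x = σ * (1# - x * x) + (τ * x + τ * x)

  line : Carrier → Carrier → Carrier → Carrier → Carrier → Carrier
  line w σ τ γ x = γ * D x + w * E σ τ x

  private
    Eᵉ : ∀ {n} → Expr n → Expr n → Expr n → Expr n
    Eᵉ s t x = s :* (κ 1 :- x :* x) :+ (t :* x :+ t :* x)
    Dᵉ : ∀ {n} → Expr n → Expr n
    Dᵉ x = κ 1 :+ x :* x
    four : Carrier
    four = 1# + 1# + 1# + 1#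

    minus-one : ∀ {a} → a ≈ 1# → a - 1# ≈ 0#
    minus-one e = trans (+-congʳ e) (-‿inverseʳ 1#)

  -- Modulo D, where x² = -1, the line becomes 2w(σ + τx). Multiplied by σ and by the conjugate 1 -
  -- στx, this is 2w(1 - x²) = 4w.
  bezout-D : ∀ w σ τ γ x → σ * σ ≈ 1# → τ * τ ≈ 1# →
    (1# - σ * τ * x) * σ * line w σ τ γ x + ((w + w) - (1# - σ * τ * x) * (σ * γ - w)) * D x ≈ four * w
  bezout-D w σ τ γ x σσ ττ = begin
    (1# - σ * τ * x) * σ * line w σ τ γ x + ((w + w) - (1# - σ * τ * x) * (σ * γ - w)) * D x
      ≈⟨ solve 5 (λ w s t g x → (κ 1 :- s :* t :* x) :* s :* (g :* Dᵉ x :+ w :* Eᵉ s t x) :+ ((w :+ w) :- (κ 1 :- s :* t :* x) :* (s :* g :- w)) :* Dᵉ x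
           := κ 4 :* w :+ w :* ((s :* s :- κ 1) :* ((κ 1 :- s :* t :* x) :* (κ 1 :- x :* x) :- κ 2 :* (x :* x) :* (t :* t)) :- κ 2 :* (x :* x) :* (t :* t :- κ 1)))
           refl w σ τ γ x ⟩
    four * w + w * ((σ * σ - 1#) * p - r * (τ * τ - 1#))
      ≈⟨ +-congˡ (*-congˡ (+-cong (*-congʳ (minus-one σσ)) (-‿cong (*-congˡ (minus-one ττ))))) ⟩
    four * w + w * (0# * p - r * 0#)
      ≈⟨ solve 4 (λ a w p r → a :+ w :* (κ 0 :* p :- r :* κ 0) := a) refl (four * w) w p r ⟩
    four * w ∎
    where
    p = (1# - σ * τ * x) * (1# - x * x) - (1# + 1#) * (x * x) * (τ * τ)
    r = (1# + 1#) * (x * x)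

  -- E is linear in (σ, τ), so a multiple of the first line eliminates E from the second, and only D
  -- is left.
  parallel : ∀ w σ τ γ γ′ ρ x → (γ′ - ρ * γ) * D x ≈ (- ρ) * line w σ τ γ x + 1# * line w (ρ * σ) (ρ * τ) γ′ x
  parallel w σ τ γ γ′ ρ x = solve 7 (λ w s t g g′ r x → (g′ :- r :* g) :* Dᵉ x
    := (:- r) :* (g :* Dᵉ x :+ w :* Eᵉ s t x) :+ κ 1 :* (g′ :* Dᵉ x :+ w :* Eᵉ (r :* s) (r :* t) x)) refl w σ τ γ γ′ ρ x

  E² : ∀ σ τ σ′ τ′ x → σ * σ ≈ 1# → τ * τ ≈ 1# → σ′ * σ′ ≈ 1# → τ′ * τ′ ≈ 1# → σ * τ + σ′ * τ′ ≈ 0# →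
       E σ τ x * E σ τ x + E σ′ τ′ x * E σ′ τ′ x ≈ (1# + 1#) * (D x * D x)
  E² σ τ σ′ τ′ x σσ ττ σσ′ ττ′ perp = begin
    E σ τ x * E σ τ x + E σ′ τ′ x * E σ′ τ′ x
      ≈⟨ solve 5 (λ s t s′ t′ x → Eᵉ s t x :* Eᵉ s t x :+ Eᵉ s′ t′ x :* Eᵉ s′ t′ x
           := (s :* s :+ s′ :* s′) :* ((κ 1 :- x :* x) :* (κ 1 :- x :* x)) :+ (t :* t :+ t′ :* t′) :* (κ 4 :* (x :* x)) :+ (s :* t :+ s′ :* t′) :* (κ 4 :* x :* (κ 1 :- x :* x)))
           refl σ τ σ′ τ′ x ⟩
    (σ * σ + σ′ * σ′) * ((1# - x * x) * (1# - x * x)) + (τ * τ + τ′ * τ′) * (four * (x * x)) + (σ * τ + σ′ * τ′) * (four * x * (1# - x * x))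
      ≈⟨ +-cong (+-cong (*-congʳ (+-cong σσ σσ′)) (*-congʳ (+-cong ττ ττ′))) (*-congʳ perp) ⟩
    (1# + 1#) * ((1# - x * x) * (1# - x * x)) + (1# + 1#) * (four * (x * x)) + 0# * (four * x * (1# - x * x))
      ≈⟨ solve 1 (λ x → κ 2 :* ((κ 1 :- x :* x) :* (κ 1 :- x :* x)) :+ κ 2 :* (κ 4 :* (x :* x)) :+ κ 0 :* (κ 4 :* x :* (κ 1 :- x :* x)) := κ 2 :* (Dᵉ x :* Dᵉ x)) refl x ⟩
    (1# + 1#) * (D x * D x) ∎

  -- Both products are differences of squares, (wE - γD)(wE + γD), and E² + E′² = 2D² by `E²`. The
  -- constant in front vanishes exactly when γ² + γ′² = 2w², that is, when the lines meet on the
  -- conic.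
  perpendicular : ∀ w σ τ γ σ′ τ′ γ′ x → σ * σ ≈ 1# → τ * τ ≈ 1# → σ′ * σ′ ≈ 1# → τ′ * τ′ ≈ 1# → σ * τ + σ′ * τ′ ≈ 0# →
    ((1# + 1#) * (w * w) - γ * γ - γ′ * γ′) * (D x * D x)
      ≈ (line w σ τ γ x - (γ + γ) * D x) * line w σ τ γ x + (line w σ′ τ′ γ′ x - (γ′ + γ′) * D x) * line w σ′ τ′ γ′ x
  perpendicular w σ τ γ σ′ τ′ γ′ x σσ ττ σσ′ ττ′ perp = sym (begin
    (line w σ τ γ x - (γ + γ) * D x) * line w σ τ γ x + (line w σ′ τ′ γ′ x - (γ′ + γ′) * D x) * line w σ′ τ′ γ′ x
      ≈⟨ solve 6 (λ w g g′ d e e′ → ((g :* d :+ w :* e) :- (g :+ g) :* d) :* (g :* d :+ w :* e) :+ ((g′ :* d :+ w :* e′) :- (g′ :+ g′) :* d) :* (g′ :* d :+ w :* e′)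
           := w :* w :* (e :* e :+ e′ :* e′) :- (g :* g :+ g′ :* g′) :* (d :* d)) refl w γ γ′ (D x) (E σ τ x) (E σ′ τ′ x) ⟩
    w * w * (E σ τ x * E σ τ x + E σ′ τ′ x * E σ′ τ′ x) - (γ * γ + γ′ * γ′) * (D x * D x)
      ≈⟨ +-congʳ (*-congˡ (E² σ τ σ′ τ′ x σσ ττ σσ′ ττ′ perp)) ⟩
    w * w * ((1# + 1#) * (D x * D x)) - (γ * γ + γ′ * γ′) * (D x * D x)
      ≈⟨ solve 4 (λ w g g′ d → w :* w :* (κ 2 :* (d :* d)) :- (g :* g :+ g′ :* g′) :* (d :* d) := (κ 2 :* (w :* w) :- g :* g :- g′ :* g′) :* (d :* d)) refl w γ γ′ (D x) ⟩
    ((1# + 1#) * (w * w) - γ * γ - γ′ * γ′) * (D x * D x) ∎)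

module Lines (K : FiniteField) {p : ℕ} (pr : Prime p) (n : ℕ) (q≡ : FiniteField.size K ≡ p ℕ.^ n)
             (k : ℕ) (q≡4k+3 : FiniteField.size K ≡ 3 ℕ.+ k ℕ.* 4)
             (w : FiniteField.Carrier K) (w≢0 : w ≢ FiniteField.0# K) where
  open Field K
  open FieldPoly K
  open QuadraticCharacter K k q≡4k+3
  open Independence K pr n q≡ k q≡4k+3 using (d)
  open import Relation.Binary.Reasoning.Setoid P.setoid
  private
    module CK = Conic KR
    module CP = Conic polyRing

  four≢0 : 1# + 1# + 1# + 1# ≢ 0#
  four≢0 z = *≢0 two≢0 two≢0 (trans (ring 0 (κ 2 :* κ 2 := κ 4) refl) z)

  -- On the conic s² + t² = 2w² the parameters 0 and ∞ give points with coordinates ±w. The field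
  -- `γγ≢ww` says that the line avoids them, so the outer coefficients of its quadratic are nonzero;
  -- `γγ≢2ww` says that it is not tangent, so the discriminant is nonzero.
  record Line : Set where
    constructor mkLine
    field
      σ′ τ γ : Carrier
      σσ : σ′ * σ′ ≡ 1#
      ττ : τ * τ ≡ 1#
      γγ≢ww : γ * γ - w * w ≢ 0#
      γγ≢2ww : (1# + 1#) * (w * w) - γ * γ ≢ 0#

  quadratic-of : Line → Quadratic
  quadratic-of L = quadratic (w * σ′ + γ) (w * τ + w * τ) (γ - w * σ′) a₂≢0 disc≢0
    where
    open Line L
    product≡ : (γ - w * σ′) * (w * σ′ + γ) ≡ γ * γ - w * w
    product≡ = trans (ring 3 (λ w s g → (g :- w :* s) :* (w :* s :+ g) := g :* g :- w :* w :* (s :* s)) refl w σ′ γ)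
      (cong (λ z → γ * γ - z) (trans (cong (w * w *_) σσ) (*-identityʳ _)))
    a₂≢0 : γ - w * σ′ ≢ 0#
    a₂≢0 = *≢0⁻¹ˡ (λ z → γγ≢ww (trans (sym product≡) z))
    disc≢0 : (w * τ + w * τ) * (w * τ + w * τ) - (1# + 1# + 1# + 1#) * ((w * σ′ + γ) * (γ - w * σ′)) ≢ 0#
    disc≢0 z = *≢0 four≢0 γγ≢2ww (trans (sym (trans
      (ring 4 (λ w s t g → (w :* t :+ w :* t) :* (w :* t :+ w :* t) :- κ 4 :* ((w :* s :+ g) :* (g :- w :* s)) := κ 4 :* (w :* w :* (t :* t) :+ w :* w :* (s :* s) :- g :* g)) refl w σ′ τ γ)
      (trans (cong₂ (λ a b → (1# + 1# + 1# + 1#) * (w * w * a + w * w * b - γ * γ)) ττ σσ)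
        (ring 2 (λ w g → κ 4 :* (w :* w :* κ 1 :+ w :* w :* κ 1 :- g :* g) := κ 4 :* (κ 2 :* (w :* w) :- g :* g)) refl w γ)))) z)

  a₀≢0 : ∀ L → Quadratic.a₀ (quadratic-of L) ≢ 0#
  a₀≢0 L = *≢0⁻¹ˡ (λ z → γγ≢ww (trans (sym (trans (ring 3 (λ w s g → (w :* s :+ g) :* (g :- w :* s) := g :* g :- w :* w :* (s :* s)) refl w σ′ γ)
      (cong (λ z → γ * γ - z) (trans (cong (w * w *_) σσ) (*-identityʳ _))))) z))
    where open Line L

  private
    H : Line → Poly
    H L = quad (quadratic-of L)

    lineₚ : Line → Poly
    lineₚ L = CP.line (C w) (C σ′) (C τ) (C γ) X
      where open Line L

    H≈line : ∀ L → H L ≈ₚ lineₚ L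
    H≈line L = begin
      H L ≈⟨ H≈ (quadratic-of L) ⟩
      C (w * σ′ + γ) +ₚ X *ₚ C (w * τ + w * τ) +ₚ X *ₚ (X *ₚ C (γ - w * σ′))
        ≈⟨ P.+-cong
             (P.+-cong (P.trans (C.+-homo (w * σ′) γ) (P.+-congʳ (C.*-homo w σ′)))
               (P.*-congˡ (P.trans (C.+-homo (w * τ) (w * τ)) (P.+-cong (C.*-homo w τ) (C.*-homo w τ)))))
             (P.*-congˡ (P.*-congˡ (P.trans (C.sub-homo γ (w * σ′)) (P.+-congˡ (P.-‿cong (C.*-homo w σ′)))))) ⟩
      (C w *ₚ C σ′ +ₚ C γ) +ₚ X *ₚ (C w *ₚ C τ +ₚ C w *ₚ C τ) +ₚ X *ₚ (X *ₚ (C γ +ₚ P.- (C w *ₚ C σ′)))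
        ≈⟨ ringₚ 5 (λ w s t g x → (w :* s :+ g) :+ x :* (w :* t :+ w :* t) :+ x :* (x :* (g :- w :* s))
             := g :* (κ 1 :+ x :* x) :+ w :* (s :* (κ 1 :- x :* x) :+ (t :* x :+ t :* x))) P.refl (C w) (C σ′) (C τ) (C γ) X ⟩
      lineₚ L ∎
      where open Line L

    d≈D : d ≈ₚ CP.D X
    d≈D = begin
      d                                    ≈⟨ P.trans (horner 1# (0# ∷ 1# ∷ [])) (P.+-congˡ (P.*-congˡ (horner 0# (C 1#)))) ⟩
      C 1# +ₚ X *ₚ (C 0# +ₚ X *ₚ C 1#)     ≈⟨ P.+-congˡ (P.*-congˡ (P.+-congʳ C.0-homo)) ⟩
      C 1# +ₚ X *ₚ ([] +ₚ X *ₚ C 1#)       ≈⟨ ringₚ 1 (λ x → κ 1 :+ x :* (κ 0 :+ x :* κ 1) := κ 1 :+ x :* x) P.refl X ⟩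
      CP.D X                               ∎

    C≈1 : ∀ {a} → a * a ≡ 1# → C a *ₚ C a ≈ₚ P.1#
    C≈1 {a} e = P.trans (P.sym (C.*-homo a a)) (C.⟦⟧-cong e)

    Coprime-lineD : ∀ L → Coprime (lineₚ L) (CP.D X)
    Coprime-lineD L = Coprime-unit _ _ ((1# + 1# + 1# + 1#) * w) (*≢0 four≢0 w≢0)
      (P.trans (CP.bezout-D (C w) (C σ′) (C τ) (C γ) X (C≈1 σσ) (C≈1 ττ)) (P.sym (P.trans (C.*-homo (1# + 1# + 1# + 1#) w) (P.*-congʳ
        (P.trans (C.+-homo (1# + 1# + 1#) 1#) (P.+-congʳ (P.trans (C.+-homo (1# + 1#) 1#) (P.+-congʳ (C.+-homo 1# 1#)))))))))
      where open Line L

    Coprime-C : ∀ f {c} → c ≢ 0# → Coprime f (C c)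
    Coprime-C f {c} c≢0 = Coprime-unit P.0# P.1# c c≢0 (ringₚ 2 (λ f c → κ 0 :* f :+ κ 1 :* c := c) P.refl f (C c))

    Coprime-respˡ : ∀ {f g r} → f ≈ₚ g → Coprime f r → Coprime g r
    Coprime-respˡ e c = Coprime-sym (Coprime-respʳ e (Coprime-sym c))

  Coprime-d : ∀ L → Coprime (H L) d
  Coprime-d L = Coprime-respˡ (P.sym (H≈line L)) (Coprime-respʳ (P.sym d≈D) (Coprime-lineD L))

  Coprime-parallel : ∀ L L′ ρ → Line.σ′ L′ ≡ ρ * Line.σ′ L → Line.τ L′ ≡ ρ * Line.τ L → Line.γ L′ - ρ * Line.γ L ≢ 0# → Coprime (H L) (H L′)
  Coprime-parallel L L′ ρ σ≡ τ≡ γ≢ = Coprime-respˡ (P.sym (H≈line L)) (Coprime-respʳ (P.sym L′≈)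
      (Coprime-ideal (P.- C ρ) P.1# (Coprime-* (Coprime-C _ γ≢) (Coprime-lineD L))
        (P.trans (P.*-congʳ (P.trans (C.sub-homo (Line.γ L′) (ρ * γ)) (P.+-congˡ (P.-‿cong (C.*-homo ρ γ)))))
          (CP.parallel (C w) (C σ′) (C τ) (C γ) (C (Line.γ L′)) (C ρ) X))))
    where
    open Line L
    L′≈ : H L′ ≈ₚ CP.line (C w) (C ρ *ₚ C σ′) (C ρ *ₚ C τ) (C (Line.γ L′)) X
    L′≈ = P.trans (H≈line L′) (P.+-congˡ (P.*-congˡ (P.+-cong
      (P.*-congʳ (P.trans (C.⟦⟧-cong σ≡) (C.*-homo ρ σ′)))
      (P.+-cong (P.*-congʳ Cτ) (P.*-congʳ Cτ)))))
      where
      Cτ : C (Line.τ L′) ≈ₚ C ρ *ₚ C τ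
      Cτ = P.trans (C.⟦⟧-cong τ≡) (C.*-homo ρ τ)

  Coprime-perpendicular : ∀ L L′ → Line.σ′ L * Line.τ L + Line.σ′ L′ * Line.τ L′ ≡ 0# →
    (1# + 1#) * (w * w) - Line.γ L * Line.γ L - Line.γ L′ * Line.γ L′ ≢ 0# → Coprime (H L) (H L′)
  Coprime-perpendicular L L′ perp γ≢ = Coprime-respˡ (P.sym (H≈line L)) (Coprime-respʳ (P.sym (H≈line L′))
      (Coprime-ideal _ _ (Coprime-* (Coprime-C _ γ≢) (Coprime-* (Coprime-lineD L) (Coprime-lineD L)))
        (P.trans (P.*-congʳ hom)
          (CP.perpendicular (C w) (C σ′) (C τ) (C γ) (C L′.σ′) (C L′.τ) (C L′.γ) X (C≈1 σσ) (C≈1 ττ) (C≈1 L′.σσ) (C≈1 L′.ττ) perpₚ))))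
    where
    open Line L
    module L′ = Line L′
    perpₚ : C σ′ *ₚ C τ +ₚ C L′.σ′ *ₚ C L′.τ ≈ₚ P.0#
    perpₚ = P.trans (P.+-cong (P.sym (C.*-homo σ′ τ)) (P.sym (C.*-homo L′.σ′ L′.τ)))
      (P.trans (P.sym (C.+-homo (σ′ * τ) (L′.σ′ * L′.τ))) (P.trans (C.⟦⟧-cong perp) C.0-homo))
    hom : C ((1# + 1#) * (w * w) - γ * γ - L′.γ * L′.γ) ≈ₚ (P.1# +ₚ P.1#) *ₚ (C w *ₚ C w) +ₚ P.- (C γ *ₚ C γ) +ₚ P.- (C L′.γ *ₚ C L′.γ)
    hom = P.trans (C.sub-homo ((1# + 1#) * (w * w) - γ * γ) (L′.γ * L′.γ)) (P.+-cong
      (P.trans (C.sub-homo ((1# + 1#) * (w * w)) (γ * γ)) (P.+-cong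
        (P.trans (C.*-homo (1# + 1#) (w * w)) (P.*-cong (C.+-homo 1# 1#) (C.*-homo w w)))
        (P.-‿cong (C.*-homo γ γ))))
      (P.-‿cong (C.*-homo L′.γ L′.γ)))

  eval-line : ∀ L x → eval x (H L) ≡ CK.line w (Line.σ′ L) (Line.τ L) (Line.γ L) x
  eval-line L x = ring 5 (λ w s t g x → (w :* s :+ g) :+ x :* ((w :* t :+ w :* t) :+ x :* ((g :- w :* s) :+ x :* κ 0))
    := g :* (κ 1 :+ x :* x) :+ w :* (s :* (κ 1 :- x :* x) :+ (t :* x :+ t :* x))) refl w (Line.σ′ L) (Line.τ L) (Line.γ L) x

  eval-d : ∀ x → eval x d ≡ CK.D x
  eval-d x = ring 1 (λ x → κ 1 :+ x :* (κ 0 :+ x :* (κ 1 :+ x :* κ 0)) := κ 1 :+ x :* x) refl x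

-- Lower bound: a difference with four solutions

module FourSolutions (K : FiniteField) {p : ℕ} (pr : Prime p) (n : ℕ) (q≡ : FiniteField.size K ≡ p ℕ.^ n)
                     (k : ℕ) (q≡4k+3 : FiniteField.size K ≡ 3 ℕ.+ k ℕ.* 4) where
  open Field K
  open QuadraticCharacter K k q≡4k+3
  open FieldPoly K
  open Independence K pr n q≡ k q≡4k+3
  private module CK = Conic KR

  data PM : Set where
    ⊞ ⊟ : PM

  val : PM → Carrier
  val ⊞ = 1#
  val ⊟ = - 1#

  val² : ∀ s → val s * val s ≡ 1#
  val² ⊞ = *-identityˡ 1#
  val² ⊟ = ring 0 (:- κ 1 :* :- κ 1 := κ 1) refl

  val≢0 : ∀ s → val s ≢ 0#
  val≢0 s = *≢0⁻¹ˡ (λ z → 0≢1 (trans (sym z) (val² s)))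

  flip : PM → PM
  flip ⊞ = ⊟
  flip ⊟ = ⊞

  σ≡1⇒χ : ∀ {x} → σ x ≡ 1ℤ → χ x ≡ 1#
  σ≡1⇒χ {x} e with sign x
  ... | null _ e′    with () ← trans (sym e) e′
  ... | plus _ c _   = c
  ... | minus _ _ e′ with () ← trans (sym e) e′

  σ≡-1⇒χ : ∀ {x} → σ x ≡ -1ℤ → χ x ≡ - 1#
  σ≡-1⇒χ {x} e with sign x
  ... | null _ e′    with () ← trans (sym e) e′
  ... | plus _ _ e′  with () ← trans (sym e) e′
  ... | minus _ c _  = c

  σ² : ∀ {x} → x ≢ 0# → σ x ℤ.* σ x ≡ 1ℤ
  σ² {x} x≢0 with sign x
  ... | null z _    = ⊥-elim (x≢0 z)
  ... | plus _ _ e  rewrite e = refl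
  ... | minus _ _ e rewrite e = refl

  σ-χ : ∀ {s t} → s ≢ 0# → t ≢ 0# → χ s ≡ χ t → σ s ≡ σ t
  σ-χ {s} {t} s≢0 t≢0 e with sign s | sign t
  ... | null a _    | _           = ⊥-elim (s≢0 a)
  ... | _           | null a _    = ⊥-elim (t≢0 a)
  ... | plus _ _ a  | plus _ _ b  = trans a (sym b)
  ... | minus _ _ a | minus _ _ b = trans a (sym b)
  ... | plus _ a _  | minus _ b _ = ⊥-elim (1≢-1 (trans (sym a) (trans e b)))
  ... | minus _ a _ | plus _ b _  = ⊥-elim (1≢-1 (trans (sym b) (trans (sym e) a)))

  1+x²≢0 : ∀ x → 1# + x * x ≢ 0#
  1+x²≢0 x z with x ≟ 0#
  ... | yes refl = 0≢1 (sym (trans (ring 0 (κ 1 := κ 1 :+ κ 0 :* κ 0) refl) z))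
  ... | no x≢0   = 1≢-1 (trans (sym (χ-square x≢0)) (trans (cong χ xx≡-1) χ-neg1))
    where
    xx≡-1 : x * x ≡ - 1#
    xx≡-1 = trans (ring 1 (λ x → x :* x := (κ 1 :+ x :* x) :- κ 1) refl x) (trans (cong (_- 1#) z) (+-identityˡ _))

  module _ (u : Carrier) (u≢0 : u ≢ 0#) (1+u≢0 : 1# + u ≢ 0#) (1-u≢0 : 1# - u ≢ 0#)
           (1+3u≢0 : 1# + three * u ≢ 0#) (1-3u≢0 : 1# - three * u ≢ 0#) (χ≡ : χ (1# + u) ≡ χ (1# - u))
           (w : Carrier) (ww : w * w ≡ (1# + u) * (1# - u)) where
    private
      w≢0 : w ≢ 0#
      w≢0 z = *≢0 1+u≢0 1-u≢0 (trans (sym ww) (trans (cong (_* w) z) (zeroˡ w)))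

      open Lines K pr n q≡ k q≡4k+3 w w≢0

      a : PM → Carrier
      a b = 1# + val b * u

      a⁺ : a ⊞ ≡ 1# + u
      a⁺ = cong (1# +_) (*-identityˡ u)

      a⁻ : a ⊟ ≡ 1# - u
      a⁻ = ring 1 (λ u → κ 1 :+ (:- κ 1) :* u := κ 1 :- u) refl u

      a≢0 : ∀ b → a b ≢ 0#
      a≢0 ⊞ z = 1+u≢0 (trans (sym a⁺) z)
      a≢0 ⊟ z = 1-u≢0 (trans (sym a⁻) z)

      1-3bu≢0 : ∀ b → 1# - three * (val b * u) ≢ 0#
      1-3bu≢0 ⊞ z = 1-3u≢0 (trans (cong (λ v → 1# - three * v) (sym (*-identityˡ u))) z)
      1-3bu≢0 ⊟ z = 1+3u≢0 (trans (ring 2 (λ t u → κ 1 :+ t :* u := κ 1 :- t :* (:- κ 1 :* u)) refl three u) z)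

      two-u≢0 : (1# + 1#) * u ≢ 0#
      two-u≢0 = *≢0 two≢0 u≢0

      module _ (ν b : PM) where
        γ = val ν * a b

        γγ : γ * γ ≡ a b * a b
        γγ = trans (ring 2 (λ v a → v :* a :* (v :* a) := v :* v :* (a :* a)) refl (val ν) (a b)) (trans (cong (_* (a b * a b)) (val² ν)) (*-identityˡ _))

        γγ≢ww′ : γ * γ - w * w ≢ 0#
        γγ≢ww′ z = *≢0 (*≢0 (val≢0 b) two-u≢0) (a≢0 b) (trans (sym (trans (cong₂ _-_ γγ ww) (expand b))) z)
          where
          expand : ∀ b → a b * a b - (1# + u) * (1# - u) ≡ val b * ((1# + 1#) * u) * a b
          expand ⊞ = ring 1 (λ u → (κ 1 :+ κ 1 :* u) :* (κ 1 :+ κ 1 :* u) :- (κ 1 :+ u) :* (κ 1 :- u) := κ 1 :* (κ 2 :* u) :* (κ 1 :+ κ 1 :* u)) refl u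
          expand ⊟ = ring 1 (λ u → (κ 1 :+ :- κ 1 :* u) :* (κ 1 :+ :- κ 1 :* u) :- (κ 1 :+ u) :* (κ 1 :- u) := :- κ 1 :* (κ 2 :* u) :* (κ 1 :+ :- κ 1 :* u)) refl u

        -- For w² = 1 - u² the left side factors as (1 + bu)(1 - 3bu): tangency is what u = ±1/3
        -- would cause.
        γγ≢2ww′ : (1# + 1#) * (w * w) - γ * γ ≢ 0#
        γγ≢2ww′ z = *≢0 (a≢0 b) (1-3bu≢0 b) (trans (sym (trans (cong₂ (λ m n → (1# + 1#) * m - n) ww γγ) (expand b))) z)
          where
          expand : ∀ b → (1# + 1#) * ((1# + u) * (1# - u)) - a b * a b ≡ a b * (1# - three * (val b * u))
          expand ⊞ = ring 1 (λ u → κ 2 :* ((κ 1 :+ u) :* (κ 1 :- u)) :- (κ 1 :+ κ 1 :* u) :* (κ 1 :+ κ 1 :* u) := (κ 1 :+ κ 1 :* u) :* (κ 1 :- κ 3 :* (κ 1 :* u))) refl u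
          expand ⊟ = ring 1 (λ u → κ 2 :* ((κ 1 :+ u) :* (κ 1 :- u)) :- (κ 1 :+ :- κ 1 :* u) :* (κ 1 :+ :- κ 1 :* u) := (κ 1 :+ :- κ 1 :* u) :* (κ 1 :- κ 3 :* (:- κ 1 :* u))) refl u

      -- The zero set of ν(1 + bu) + ρz, where z is the coordinate selected by π: abscissa for `⊞`,
      -- ordinate for `⊟`.
      line : (π ρ ν b : PM) → Line
      line π ρ ν b = mkLine (val ρ) (val π * val ρ) (γ ν b) (val² ρ)
        (trans (ring 2 (λ v a → v :* a :* (v :* a) := v :* v :* (a :* a)) refl (val π) (val ρ)) (trans (cong₂ _*_ (val² π) (val² ρ)) (*-identityˡ 1#)))
        (γγ≢ww′ ν b) (γγ≢2ww′ ν b)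

      quad-line : (π ρ ν b : PM) → Quadratic
      quad-line π ρ ν b = quadratic-of (line π ρ ν b)

      -- With ρ, ρ′ and b, b′ compared, the distance of the lines is up to sign 2u (only b differs),
      -- 2(1 + bu) (only ρ differs) or 2 (both differ).
      parallel : ∀ π ν {ρ b ρ′ b′} → (ρ , b) ≢ (ρ′ , b′) → Coprime (quad (quad-line π ρ ν b)) (quad (quad-line π ρ′ ν b′))
      parallel π ν {ρ} {b} {ρ′} {b′} ne = Coprime-parallel (line π ρ ν b) (line π ρ′ ν b′) (val ρ′ * val ρ) σ≡
        (trans (cong (val π *_) σ≡) (ring 3 (λ p k r → p :* (k :* r) := k :* (p :* r)) refl (val π) (val ρ′ * val ρ) (val ρ)))
        (λ z → *≢0 (val≢0 ν) (distinct ρ b ρ′ b′ ne)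
          (trans (ring 4 (λ v k a a′ → v :* (a′ :- k :* a) := v :* a′ :- k :* (v :* a)) refl (val ν) (val ρ′ * val ρ) (a b) (a b′)) z))
        where
        σ≡ : val ρ′ ≡ val ρ′ * val ρ * val ρ
        σ≡ = trans (sym (*-identityʳ _)) (trans (cong (val ρ′ *_) (sym (val² ρ))) (sym (*-assoc _ _ _)))
        0-2u : ∀ {z} → z ≡ - ((1# + 1#) * u) → z ≢ 0#
        0-2u e z = -x≢0 two-u≢0 (trans (sym e) z)
        distinct : ∀ ρ b ρ′ b′ → (ρ , b) ≢ (ρ′ , b′) → a b′ - val ρ′ * val ρ * a b ≢ 0#
        distinct ⊞ ⊞ ⊞ ⊞ n _ = n refl
        distinct ⊞ ⊟ ⊞ ⊟ n _ = n refl
        distinct ⊟ ⊞ ⊟ ⊞ n _ = n refl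
        distinct ⊟ ⊟ ⊟ ⊟ n _ = n refl
        distinct ⊞ ⊞ ⊞ ⊟ n = 0-2u (ring 1 (λ u → (κ 1 :+ :- κ 1 :* u) :- κ 1 :* κ 1 :* (κ 1 :+ κ 1 :* u) := :- (κ 2 :* u)) refl u)
        distinct ⊟ ⊞ ⊟ ⊟ n = 0-2u (ring 1 (λ u → (κ 1 :+ :- κ 1 :* u) :- :- κ 1 :* :- κ 1 :* (κ 1 :+ κ 1 :* u) := :- (κ 2 :* u)) refl u)
        distinct ⊞ ⊟ ⊞ ⊞ n z = two-u≢0 (trans (ring 1 (λ u → κ 2 :* u := (κ 1 :+ κ 1 :* u) :- κ 1 :* κ 1 :* (κ 1 :+ :- κ 1 :* u)) refl u) z)
        distinct ⊟ ⊟ ⊟ ⊞ n z = two-u≢0 (trans (ring 1 (λ u → κ 2 :* u := (κ 1 :+ κ 1 :* u) :- :- κ 1 :* :- κ 1 :* (κ 1 :+ :- κ 1 :* u)) refl u) z)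
        distinct ⊞ ⊞ ⊟ ⊞ n z = *≢0 two≢0 1+u≢0 (trans (ring 1 (λ u → κ 2 :* (κ 1 :+ u) := (κ 1 :+ κ 1 :* u) :- :- κ 1 :* κ 1 :* (κ 1 :+ κ 1 :* u)) refl u) z)
        distinct ⊟ ⊞ ⊞ ⊞ n z = *≢0 two≢0 1+u≢0 (trans (ring 1 (λ u → κ 2 :* (κ 1 :+ u) := (κ 1 :+ κ 1 :* u) :- κ 1 :* :- κ 1 :* (κ 1 :+ κ 1 :* u)) refl u) z)
        distinct ⊞ ⊟ ⊟ ⊟ n z = *≢0 two≢0 1-u≢0 (trans (ring 1 (λ u → κ 2 :* (κ 1 :- u) := (κ 1 :+ :- κ 1 :* u) :- :- κ 1 :* κ 1 :* (κ 1 :+ :- κ 1 :* u)) refl u) z)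
        distinct ⊟ ⊟ ⊞ ⊟ n z = *≢0 two≢0 1-u≢0 (trans (ring 1 (λ u → κ 2 :* (κ 1 :- u) := (κ 1 :+ :- κ 1 :* u) :- κ 1 :* :- κ 1 :* (κ 1 :+ :- κ 1 :* u)) refl u) z)
        distinct ⊞ ⊞ ⊟ ⊟ n z = two≢0 (trans (ring 1 (λ u → κ 2 := (κ 1 :+ :- κ 1 :* u) :- :- κ 1 :* κ 1 :* (κ 1 :+ κ 1 :* u)) refl u) z)
        distinct ⊟ ⊞ ⊞ ⊟ n z = two≢0 (trans (ring 1 (λ u → κ 2 := (κ 1 :+ :- κ 1 :* u) :- κ 1 :* :- κ 1 :* (κ 1 :+ κ 1 :* u)) refl u) z)
        distinct ⊞ ⊟ ⊟ ⊞ n z = two≢0 (trans (ring 1 (λ u → κ 2 := (κ 1 :+ κ 1 :* u) :- :- κ 1 :* κ 1 :* (κ 1 :+ :- κ 1 :* u)) refl u) z)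
        distinct ⊟ ⊟ ⊞ ⊞ n z = two≢0 (trans (ring 1 (λ u → κ 2 := (κ 1 :+ κ 1 :* u) :- κ 1 :* :- κ 1 :* (κ 1 :+ :- κ 1 :* u)) refl u) z)

      -- The lines meet off the conic: 2w² minus the squares of the two constants is -4u(1 + u),
      -- 4u(1 - u) or -4u².
      perpendicular : ∀ ν ν′ {ρ b ρ′ b′} → Coprime (quad (quad-line ⊞ ρ ν b)) (quad (quad-line ⊟ ρ′ ν′ b′))
      perpendicular ν ν′ {ρ} {b} {ρ′} {b′} = Coprime-perpendicular (line ⊞ ρ ν b) (line ⊟ ρ′ ν′ b′)
        (trans (ring 2 (λ r r′ → r :* (κ 1 :* r) :+ r′ :* (:- κ 1 :* r′) := r :* r :- r′ :* r′) refl (val ρ) (val ρ′)) (trans (cong₂ _-_ (val² ρ) (val² ρ′)) (-‿inverseʳ 1#)))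
        (λ z → value b b′ (trans (sym (trans (cong₂ (λ m n → m - γ ν b * γ ν b - n) (cong ((1# + 1#) *_) ww) (γγ ν′ b′)) (cong (λ m → (1# + 1#) * ((1# + u) * (1# - u)) - m - a b′ * a b′) (γγ ν b)))) z))
        where
        4uu≢0 : (1# + 1#) * u * ((1# + 1#) * u) ≢ 0#
        4uu≢0 = *≢0 two-u≢0 two-u≢0
        value : ∀ b b′ → (1# + 1#) * ((1# + u) * (1# - u)) - a b * a b - a b′ * a b′ ≢ 0#
        value ⊞ ⊞ z = -x≢0 (*≢0 (*≢0 two≢0 two-u≢0) 1+u≢0) (trans (ring 1 (λ u → :- (κ 2 :* (κ 2 :* u) :* (κ 1 :+ u))
          := κ 2 :* ((κ 1 :+ u) :* (κ 1 :- u)) :- (κ 1 :+ κ 1 :* u) :* (κ 1 :+ κ 1 :* u) :- (κ 1 :+ κ 1 :* u) :* (κ 1 :+ κ 1 :* u)) refl u) z)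
        value ⊟ ⊟ z = *≢0 (*≢0 two≢0 two-u≢0) 1-u≢0 (trans (ring 1 (λ u → κ 2 :* (κ 2 :* u) :* (κ 1 :- u)
          := κ 2 :* ((κ 1 :+ u) :* (κ 1 :- u)) :- (κ 1 :+ :- κ 1 :* u) :* (κ 1 :+ :- κ 1 :* u) :- (κ 1 :+ :- κ 1 :* u) :* (κ 1 :+ :- κ 1 :* u)) refl u) z)
        value ⊞ ⊟ z = -x≢0 4uu≢0 (trans (ring 1 (λ u → :- (κ 2 :* u :* (κ 2 :* u))
          := κ 2 :* ((κ 1 :+ u) :* (κ 1 :- u)) :- (κ 1 :+ κ 1 :* u) :* (κ 1 :+ κ 1 :* u) :- (κ 1 :+ :- κ 1 :* u) :* (κ 1 :+ :- κ 1 :* u)) refl u) z)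
        value ⊟ ⊞ z = -x≢0 4uu≢0 (trans (ring 1 (λ u → :- (κ 2 :* u :* (κ 2 :* u))
          := κ 2 :* ((κ 1 :+ u) :* (κ 1 :- u)) :- (κ 1 :+ :- κ 1 :* u) :* (κ 1 :+ :- κ 1 :* u) :- (κ 1 :+ κ 1 :* u) :* (κ 1 :+ κ 1 :* u)) refl u) z)

      -- For uy = ρz + ν the form ν(1 + bu) + ρz equals u(y + νb). Hence these signs make y + ν a
      -- non-square and y - ν a square. With ν = -1 for the abscissa and ν = 1 for the ordinate, the
      -- first gives y + 1 a square and y - 1 a non-square, the second the opposite.
      ε : PM → ℤ
      ε ⊞ = ℤ.- σ u
      ε ⊟ = σ u

      ∣ε∣ : ∀ b → ℤ.∣ ε b ∣ ≡ 1
      ∣ε∣ b with sign u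
      ∣ε∣ b | null z _ = ⊥-elim (u≢0 z)
      ∣ε∣ ⊞ | plus _ _ e rewrite e = refl
      ∣ε∣ ⊟ | plus _ _ e rewrite e = refl
      ∣ε∣ ⊞ | minus _ _ e rewrite e = refl
      ∣ε∣ ⊟ | minus _ _ e rewrite e = refl

      ε-distinct : ε ⊞ ≢ ε ⊟
      ε-distinct e with sign u
      ... | null a _ = u≢0 a
      ... | plus _ _ a rewrite a with () ← e
      ... | minus _ _ a rewrite a with () ← e

      Index : Set
      Index = PM × PM × PM

      condition : Index → Condition
      condition (π , ρ , b) = quad-line π ρ (flip π) b , ε b

      indices : List Index
      indices = (⊞ , ⊞ , ⊞) ∷ (⊞ , ⊞ , ⊟) ∷ (⊞ , ⊟ , ⊞) ∷ (⊞ , ⊟ , ⊟) ∷ (⊟ , ⊞ , ⊞) ∷ (⊟ , ⊞ , ⊟) ∷ (⊟ , ⊟ , ⊞) ∷ (⊟ , ⊟ , ⊟) ∷ []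

      indices-unique : Unique indices
      indices-unique =
          ((λ ()) ∷ (λ ()) ∷ (λ ()) ∷ (λ ()) ∷ (λ ()) ∷ (λ ()) ∷ (λ ()) ∷ [])
        ∷ ((λ ()) ∷ (λ ()) ∷ (λ ()) ∷ (λ ()) ∷ (λ ()) ∷ (λ ()) ∷ [])
        ∷ ((λ ()) ∷ (λ ()) ∷ (λ ()) ∷ (λ ()) ∷ (λ ()) ∷ [])
        ∷ ((λ ()) ∷ (λ ()) ∷ (λ ()) ∷ (λ ()) ∷ [])
        ∷ ((λ ()) ∷ (λ ()) ∷ (λ ()) ∷ [])
        ∷ ((λ ()) ∷ (λ ()) ∷ [])
        ∷ ((λ ()) ∷ [])
        ∷ [] ∷ []

      at-index : ∀ {P : Index → Set} → All P indices → ∀ i → P i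
      at-index (a ∷ _) (⊞ , ⊞ , ⊞) = a
      at-index (_ ∷ a ∷ _) (⊞ , ⊞ , ⊟) = a
      at-index (_ ∷ _ ∷ a ∷ _) (⊞ , ⊟ , ⊞) = a
      at-index (_ ∷ _ ∷ _ ∷ a ∷ _) (⊞ , ⊟ , ⊟) = a
      at-index (_ ∷ _ ∷ _ ∷ _ ∷ a ∷ _) (⊟ , ⊞ , ⊞) = a
      at-index (_ ∷ _ ∷ _ ∷ _ ∷ _ ∷ a ∷ _) (⊟ , ⊞ , ⊟) = a
      at-index (_ ∷ _ ∷ _ ∷ _ ∷ _ ∷ _ ∷ a ∷ _) (⊟ , ⊟ , ⊞) = a
      at-index (_ ∷ _ ∷ _ ∷ _ ∷ _ ∷ _ ∷ _ ∷ a ∷ _) (⊟ , ⊟ , ⊟) = a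

      admissible : ∀ i → Admissible (condition i)
      admissible (π , ρ , b) = a₀≢0 (line π ρ (flip π) b) , Coprime-d (line π ρ (flip π) b) , ∣ε∣ b

      independent : ∀ {i j} → i ≢ j → Independent (condition i) (condition j)
      independent {⊞ , ρ , b} {⊞ , ρ′ , b′} ne = parallel ⊞ ⊟ {ρ} {b} {ρ′} {b′} (λ { refl → ne refl })
      independent {⊟ , ρ , b} {⊟ , ρ′ , b′} ne = parallel ⊟ ⊞ {ρ} {b} {ρ′} {b′} (λ { refl → ne refl })
      independent {⊞ , ρ , b} {⊟ , ρ′ , b′} ne = perpendicular ⊟ ⊞ {ρ} {b} {ρ′} {b′}
      independent {⊟ , ρ , b} {⊞ , ρ′ , b′} ne = Coprime-sym (perpendicular ⊟ ⊞ {ρ′} {b′} {ρ} {b})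

    module Solutions (x : Carrier) (sat : ∀ π ρ b → σ (eval x (ℓ (quad-line π ρ (flip π) b))) ≡ ε b) where
      private
        D = 1# + x * x

        D≢0 : D ≢ 0#
        D≢0 = 1+x²≢0 x

        z : PM → Carrier
        z π = w * CK.E 1# (val π) x * D ⁻¹

        Dz : ∀ π → D * z π ≡ w * CK.E 1# (val π) x
        Dz π = trans (ring 3 (λ d e i → d :* (e :* i) := d :* i :* e) refl D (w * CK.E 1# (val π) x) (D ⁻¹)) (trans (cong (_* (w * CK.E 1# (val π) x)) (inverseʳ D D≢0)) (*-identityˡ _))

        value : ∀ π ρ ν b → eval x (ℓ (quad-line π ρ ν b)) ≡ D * D * (γ ν b + val ρ * z π)
        value π ρ ν b = begin
          eval x (ℓ (quad-line π ρ ν b))                       ≡⟨ eval-* x (quad (quad-line π ρ ν b)) d ⟩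
          eval x (quad (quad-line π ρ ν b)) * eval x d         ≡⟨ cong₂ _*_ (eval-line (line π ρ ν b) x) (eval-d x) ⟩
          CK.line w (val ρ) (val π * val ρ) (γ ν b) x * D      ≡⟨ ring 5 (λ w r p g x → (g :* (κ 1 :+ x :* x) :+ w :* (r :* (κ 1 :- x :* x) :+ (p :* r :* x :+ p :* r :* x))) :* (κ 1 :+ x :* x)
               := (g :* (κ 1 :+ x :* x) :+ r :* (w :* (κ 1 :* (κ 1 :- x :* x) :+ (p :* x :+ p :* x)))) :* (κ 1 :+ x :* x)) refl w (val ρ) (val π) (γ ν b) x ⟩
          (γ ν b * D + val ρ * (w * CK.E 1# (val π) x)) * D    ≡⟨ cong (λ e → (γ ν b * D + val ρ * e) * D) (sym (Dz π)) ⟩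
          (γ ν b * D + val ρ * (D * z π)) * D                  ≡⟨ ring 4 (λ g d r z → (g :* d :+ r :* (d :* z)) :* d := d :* d :* (g :+ r :* z)) refl (γ ν b) D (val ρ) (z π) ⟩
          D * D * (γ ν b + val ρ * z π)                        ∎
          where open ≡.≡-Reasoning

        form : PM → PM → PM → Carrier
        form π ρ b = γ (flip π) b + val ρ * z π

        sgn : ∀ π ρ b → σ (form π ρ b) ≡ ε b
        sgn π ρ b = trans (sym (trans (cong σ (value π ρ (flip π) b)) (trans (σ-* (D * D) (form π ρ b)) (trans (cong (ℤ._* σ (form π ρ b)) (trans (σ-* D D) (σ² D≢0))) (ℤₚ.*-identityˡ _)))))
          (sat π ρ b)

        circle : z ⊞ * z ⊞ + z ⊟ * z ⊟ ≡ (1# + 1#) * (w * w)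
        circle = *-cancelˡ (*≢0 D≢0 D≢0) (begin
          D * D * (z ⊞ * z ⊞ + z ⊟ * z ⊟)                                    ≡⟨ ring 3 (λ d y z → d :* d :* (y :* y :+ z :* z) := d :* y :* (d :* y) :+ d :* z :* (d :* z)) refl D (z ⊞) (z ⊟) ⟩
          D * z ⊞ * (D * z ⊞) + D * z ⊟ * (D * z ⊟)                          ≡⟨ cong₂ (λ a b → a * a + b * b) (Dz ⊞) (Dz ⊟) ⟩
          w * e₁ * (w * e₁) + w * e₂ * (w * e₂)                              ≡⟨ ring 3 (λ w a b → w :* a :* (w :* a) :+ w :* b :* (w :* b) := w :* w :* (a :* a :+ b :* b)) refl w e₁ e₂ ⟩
          w * w * (e₁ * e₁ + e₂ * e₂)                                        ≡⟨ cong (w * w *_) (CK.E² 1# 1# 1# (- 1#) x (val² ⊞) (val² ⊞) (val² ⊞) (val² ⊟) (ring 0 (κ 1 :* κ 1 :+ κ 1 :* :- κ 1 := κ 0) refl)) ⟩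
          w * w * ((1# + 1#) * (D * D))                                      ≡⟨ ring 2 (λ w d → w :* w :* (κ 2 :* (d :* d)) := d :* d :* (κ 2 :* (w :* w))) refl w D ⟩
          D * D * ((1# + 1#) * (w * w))                                      ∎)
          where
          open ≡.≡-Reasoning
          e₁ = CK.E 1# (val ⊞) x
          e₂ = CK.E 1# (val ⊟) x

        y : PM → PM → Carrier
        y π ρ = (val ρ * z π + val (flip π)) * u ⁻¹

        uy : ∀ π ρ → u * y π ρ ≡ val ρ * z π + val (flip π)
        uy π ρ = trans (ring 3 (λ u v i → u :* (v :* i) := u :* i :* v) refl u (val ρ * z π + val (flip π)) (u ⁻¹)) (trans (cong (_* (val ρ * z π + val (flip π))) (inverseʳ u u≢0)) (*-identityˡ _))

        σuσ[u⁻¹] : σ u ℤ.* σ (u ⁻¹) ≡ 1ℤ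
        σuσ[u⁻¹] = trans (sym (σ-* u (u ⁻¹))) (trans (cong σ (inverseʳ u u≢0)) (trans (sym (cong σ (*-identityˡ 1#))) (trans (σ-* 1# 1#) (σ² (λ e → 0≢1 (sym e))))))

        shifted : ∀ π ρ b → σ (y π ρ + val (flip π) * val b) ≡ ε b ℤ.* σ (u ⁻¹)
        shifted π ρ b = trans (cong σ (*-cancelˡ u≢0 (begin
            u * (y π ρ + ν * val b)                     ≡⟨ ring 4 (λ u y v b → u :* (y :+ v :* b) := u :* y :+ v :* (b :* u)) refl u (y π ρ) ν (val b) ⟩
            u * y π ρ + ν * (val b * u)                 ≡⟨ cong (_+ ν * (val b * u)) (uy π ρ) ⟩
            val ρ * z π + ν + ν * (val b * u)           ≡⟨ ring 3 (λ r v c → r :+ v :+ v :* c := v :* (κ 1 :+ c) :+ r) refl (val ρ * z π) ν (val b * u) ⟩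
            form π ρ b                                  ≡⟨ sym (*-identityˡ _) ⟩
            1# * form π ρ b                             ≡⟨ cong (_* form π ρ b) (sym (inverseʳ u u≢0)) ⟩
            u * u ⁻¹ * form π ρ b                       ≡⟨ ring 3 (λ u i f → u :* i :* f := u :* (f :* i)) refl u (u ⁻¹) (form π ρ b) ⟩
            u * (form π ρ b * u ⁻¹)                     ∎)))
          (trans (σ-* _ _) (cong (ℤ._* σ (u ⁻¹)) (sgn π ρ b)))
          where
          open ≡.≡-Reasoning
          ν = val (flip π)

        σ-minus : ∀ π ρ → σ (y π ρ + val (flip π) * val ⊞) ≡ -1ℤ
        σ-minus π ρ = trans (shifted π ρ ⊞) (trans (sym (ℤₚ.neg-distribˡ-* (σ u) (σ (u ⁻¹)))) (cong ℤ.-_ σuσ[u⁻¹]))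

        σ-plus : ∀ π ρ → σ (y π ρ + val (flip π) * val ⊟) ≡ 1ℤ
        σ-plus π ρ = trans (shifted π ρ ⊟) σuσ[u⁻¹]

        χ-C⁺ : ∀ ρ → χ (y ⊞ ρ + 1#) ≡ 1#
        χ-C⁺ ρ = trans (cong χ (ring 1 (λ y → y :+ κ 1 := y :+ :- κ 1 :* :- κ 1) refl (y ⊞ ρ))) (σ≡1⇒χ (σ-plus ⊞ ρ))

        χ-C⁻ : ∀ ρ → χ (y ⊞ ρ - 1#) ≡ - 1#
        χ-C⁻ ρ = trans (cong χ (ring 1 (λ y → y :- κ 1 := y :+ :- κ 1 :* κ 1) refl (y ⊞ ρ))) (σ≡-1⇒χ (σ-minus ⊞ ρ))

        χ-D⁺ : ∀ ρ → χ (y ⊟ ρ + 1#) ≡ - 1#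
        χ-D⁺ ρ = trans (cong χ (ring 1 (λ y → y :+ κ 1 := y :+ κ 1 :* κ 1) refl (y ⊟ ρ))) (σ≡-1⇒χ (σ-minus ⊟ ρ))

        χ-D⁻ : ∀ ρ → χ (y ⊟ ρ - 1#) ≡ 1#
        χ-D⁻ ρ = trans (cong χ (ring 1 (λ y → y :- κ 1 := y :+ κ 1 :* :- κ 1) refl (y ⊟ ρ))) (σ≡1⇒χ (σ-plus ⊟ ρ))

        F-value : ∀ {t c} → χ t ≡ c → F₂ u t ≡ t * t * (1# + u * c)
        F-value {t} e = cong (λ c → t * t * (1# + u * c)) (trans (η≡χ t) e)

        difference : ∀ y {c c′} → χ (y + 1#) ≡ c → χ (y - 1#) ≡ c′ →
          F₂ u ((y - 1#) + (1# + 1#)) - F₂ u (y - 1#) ≡ (y + 1#) * (y + 1#) * (1# + u * c) - (y - 1#) * (y - 1#) * (1# + u * c′)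
        difference y e e′ = cong₂ _-_ (trans (cong (F₂ u) (ring 1 (λ y → (y :- κ 1) :+ κ 2 := y :+ κ 1) refl y)) (F-value e)) (F-value e′)

        -- Multiplied by u, the difference is 2s² - 2 + 2u² for the first two solutions and -2t² + 2
        -- - 2u² for the other two. Requiring these to agree is the origin of the conic s² + t² =
        -- 2(1 - u²).
        N = (1# + 1#) * (z ⊞ * z ⊞) - (1# + 1#) + (1# + 1#) * (u * u)

      b₀ : Carrier
      b₀ = N * u ⁻¹

      private
        from-multiple : ∀ {t} → u * t ≡ N → t ≡ b₀
        from-multiple {t} e = *-cancelˡ u≢0 (trans e (sym (trans (ring 3 (λ u n i → u :* (n :* i) := u :* i :* n) refl u N (u ⁻¹)) (trans (cong (_* N) (inverseʳ u u≢0)) (*-identityˡ N)))))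

        solution : ∀ π ρ → F₂ u ((y π ρ - 1#) + (1# + 1#)) - F₂ u (y π ρ - 1#) ≡ b₀
        solution ⊞ ρ = trans (difference (y ⊞ ρ) (χ-C⁺ ρ) (χ-C⁻ ρ)) (from-multiple (begin
          u * ((Y + 1#) * (Y + 1#) * (1# + u * 1#) - (Y - 1#) * (Y - 1#) * (1# + u * - 1#))
            ≡⟨ ring 2 (λ u y → u :* ((y :+ κ 1) :* (y :+ κ 1) :* (κ 1 :+ u :* κ 1) :- (y :- κ 1) :* (y :- κ 1) :* (κ 1 :+ u :* :- κ 1))
                 := κ 2 :* (u :* y :* (u :* y)) :+ κ 4 :* (u :* y) :+ κ 2 :* (u :* u)) refl u Y ⟩
          (1# + 1#) * (u * Y * (u * Y)) + (1# + 1# + 1# + 1#) * (u * Y) + (1# + 1#) * (u * u)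
            ≡⟨ cong (λ v → (1# + 1#) * (v * v) + (1# + 1# + 1# + 1#) * v + (1# + 1#) * (u * u)) (uy ⊞ ρ) ⟩
          (1# + 1#) * (V * V) + (1# + 1# + 1# + 1#) * V + (1# + 1#) * (u * u)
            ≡⟨ ring 3 (λ r z u → κ 2 :* ((r :* z :+ :- κ 1) :* (r :* z :+ :- κ 1)) :+ κ 4 :* (r :* z :+ :- κ 1) :+ κ 2 :* (u :* u)
                 := κ 2 :* (r :* r :* (z :* z)) :- κ 2 :+ κ 2 :* (u :* u)) refl (val ρ) (z ⊞) u ⟩
          (1# + 1#) * (val ρ * val ρ * (z ⊞ * z ⊞)) - (1# + 1#) + (1# + 1#) * (u * u)
            ≡⟨ cong (λ v → (1# + 1#) * v - (1# + 1#) + (1# + 1#) * (u * u)) (trans (cong (_* (z ⊞ * z ⊞)) (val² ρ)) (*-identityˡ _)) ⟩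
          N ∎))
          where
          open ≡.≡-Reasoning
          Y = y ⊞ ρ
          V = val ρ * z ⊞ + - 1#
        solution ⊟ ρ = trans (difference (y ⊟ ρ) (χ-D⁺ ρ) (χ-D⁻ ρ)) (from-multiple (begin
          u * ((Y + 1#) * (Y + 1#) * (1# + u * - 1#) - (Y - 1#) * (Y - 1#) * (1# + u * 1#))
            ≡⟨ ring 2 (λ u y → u :* ((y :+ κ 1) :* (y :+ κ 1) :* (κ 1 :+ u :* :- κ 1) :- (y :- κ 1) :* (y :- κ 1) :* (κ 1 :+ u :* κ 1))
                 := :- (κ 2 :* (u :* y :* (u :* y))) :+ κ 4 :* (u :* y) :- κ 2 :* (u :* u)) refl u Y ⟩
          - ((1# + 1#) * (u * Y * (u * Y))) + (1# + 1# + 1# + 1#) * (u * Y) - (1# + 1#) * (u * u)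
            ≡⟨ cong (λ v → - ((1# + 1#) * (v * v)) + (1# + 1# + 1# + 1#) * v - (1# + 1#) * (u * u)) (uy ⊟ ρ) ⟩
          - ((1# + 1#) * (V * V)) + (1# + 1# + 1# + 1#) * V - (1# + 1#) * (u * u)
            ≡⟨ ring 4 (λ r z u y → :- (κ 2 :* ((r :* z :+ κ 1) :* (r :* z :+ κ 1))) :+ κ 4 :* (r :* z :+ κ 1) :- κ 2 :* (u :* u)
                 := κ 2 :* (y :* y) :- κ 2 :* (y :* y :+ r :* r :* (z :* z)) :+ κ 2 :- κ 2 :* (u :* u)) refl (val ρ) (z ⊟) u (z ⊞) ⟩
          (1# + 1#) * (z ⊞ * z ⊞) - (1# + 1#) * (z ⊞ * z ⊞ + val ρ * val ρ * (z ⊟ * z ⊟)) + (1# + 1#) - (1# + 1#) * (u * u)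
            ≡⟨ cong (λ v → (1# + 1#) * (z ⊞ * z ⊞) - (1# + 1#) * v + (1# + 1#) - (1# + 1#) * (u * u))
                 (trans (cong (z ⊞ * z ⊞ +_) (trans (cong (_* (z ⊟ * z ⊟)) (val² ρ)) (*-identityˡ _))) (trans circle (cong ((1# + 1#) *_) ww))) ⟩
          (1# + 1#) * (z ⊞ * z ⊞) - (1# + 1#) * ((1# + 1#) * ((1# + u) * (1# - u))) + (1# + 1#) - (1# + 1#) * (u * u)
            ≡⟨ ring 2 (λ y u → κ 2 :* (y :* y) :- κ 2 :* (κ 2 :* ((κ 1 :+ u) :* (κ 1 :- u))) :+ κ 2 :- κ 2 :* (u :* u) := κ 2 :* (y :* y) :- κ 2 :+ κ 2 :* (u :* u)) refl (z ⊞) u ⟩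
          N ∎))
          where
          open ≡.≡-Reasoning
          Y = y ⊟ ρ
          V = val ρ * z ⊟ + 1#

        -- A double root would have form π ρ b = ±(1 + b u), but 1 + u and 1 - u have the same character.
        z≢0 : ∀ π → z π ≢ 0#
        z≢0 π z≡0 = ε-distinct (trans (sym (sgn π ⊞ ⊞)) (trans same (sgn π ⊞ ⊟)))
          where
          form≡ : ∀ b → form π ⊞ b ≡ γ (flip π) b
          form≡ b = trans (cong (λ v → γ (flip π) b + 1# * v) z≡0) (ring 1 (λ g → g :+ κ 1 :* κ 0 := g) refl (γ (flip π) b))
          γ≢0 : ∀ b → γ (flip π) b ≢ 0#
          γ≢0 b = *≢0 (val≢0 (flip π)) (a≢0 b)
          same : σ (form π ⊞ ⊞) ≡ σ (form π ⊞ ⊟)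
          same = trans (cong σ (form≡ ⊞)) (trans (σ-χ (γ≢0 ⊞) (γ≢0 ⊟) (trans (χ-* _ _) (trans (cong (χ (val (flip π)) *_) (trans (cong χ a⁺) (trans χ≡ (cong χ (sym a⁻))))) (sym (χ-* _ _))))) (sym (cong σ (form≡ ⊟))))

        roots-distinct : ∀ π → y π ⊞ ≢ y π ⊟
        roots-distinct π e = z≢0 π (*-zero two≢0 (trans
          (ring 2 (λ z v → κ 2 :* z := (κ 1 :* z :+ v) :- (:- κ 1 :* z :+ v)) refl (z π) (val (flip π)))
          (≡-0 (trans (sym (uy π ⊞)) (trans (cong (u *_) e) (uy π ⊟))))))

        types-distinct : ∀ ρ ρ′ → y ⊞ ρ ≢ y ⊟ ρ′
        types-distinct ρ ρ′ e = 1≢-1 (trans (sym (χ-C⁺ ρ)) (trans (cong (λ t → χ (t + 1#)) e) (χ-D⁺ ρ′)))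

        pred-≢ : ∀ {s t} → s ≢ t → s - 1# ≢ t - 1#
        pred-≢ {s} {t} n e = n (trans (ring 1 (λ s → s := (s :- κ 1) :+ κ 1) refl s) (trans (cong (_+ 1#) e) (ring 1 (λ t → (t :- κ 1) :+ κ 1 := t) refl t)))

      solutions : List Carrier
      solutions = y ⊞ ⊞ - 1# ∷ y ⊞ ⊟ - 1# ∷ y ⊟ ⊞ - 1# ∷ y ⊟ ⊟ - 1# ∷ []

      solutions-unique : Unique solutions
      solutions-unique = (pred-≢ (roots-distinct ⊞) ∷ pred-≢ (types-distinct ⊞ ⊞) ∷ pred-≢ (types-distinct ⊞ ⊟) ∷ [])
        ∷ (pred-≢ (types-distinct ⊟ ⊞) ∷ pred-≢ (types-distinct ⊟ ⊟) ∷ []) ∷ (pred-≢ (roots-distinct ⊟) ∷ []) ∷ [] ∷ []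

      solutions-solve : All (λ x → F₂ u (x + (1# + 1#)) - F₂ u x ≡ b₀) solutions
      solutions-solve = solution ⊞ ⊞ ∷ solution ⊞ ⊟ ∷ solution ⊟ ⊞ ∷ solution ⊟ ⊟ ∷ []

    four-solutions : ∀ μ A (h≡ : h ≡ 16 ℕ.+ A) (2μ≤q : μ ℕ.+ μ ℕ.≤ size) (few : μ ℕ.* (17 ℕ.+ 67 ℕ.* μ) ℕ.< 16 ℕ.* suc A) →
      256 ℕ.* errorTerm size μ ℕ.+ (μ ℕ.+ μ) ℕ.* 8192 ℕ.< (μ ℕ.+ μ) ℕ.* size →
      ∃ λ b → ∃ λ xs → Unique xs × length xs ≡ 4 × All (λ x → F₂ u (x + (1# + 1#)) - F₂ u x ≡ b) xs
    four-solutions μ A h≡ 2μ≤q few large = b₀ , solutions , solutions-unique , refl , solutions-solve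
      where
      pairs : AllPairs (λ i j → Independent (condition i) (condition j)) indices
      pairs = AllPairs.map (λ {i} {j} → independent {i} {j}) indices-unique
      point = realise μ A h≡ 2μ≤q few (map condition indices) ℕₚ.≤-refl
        (AllPairsₚ.map⁺ {f = condition} {xs = indices} pairs) (Allₚ.map⁺ {xs = indices} {f = condition} (All.universal admissible indices)) large
      open Solutions (proj₁ point) (λ π ρ b → at-index {λ i → Satisfies (proj₁ point) (condition i)} (Allₚ.map⁻ {xs = indices} {f = condition} (proj₂ point)) (π , ρ , b))

-- Upper bound: at most four solutions

at-most-one : ∀ {A : Set} {P : A → Set} → (∀ {x y} → P x → P y → x ≡ y) → ∀ xs → Unique xs → All P xs →
              length xs ≡ 0 ⊎ length xs ≡ 1 × ∃ P
at-most-one same []           _             _            = inj₁ ≡.refl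
at-most-one same (x ∷ [])     _             (px ∷ _)     = inj₂ (≡.refl , x , px)
at-most-one same (x ∷ y ∷ xs) ((n ∷ _) ∷ _) (px ∷ py ∷ _) = ⊥-elim (n (same px py))

at-most-two : ∀ {A : Set} {P : A → Set} → (∀ {x y z} → P x → P y → P z → x ≢ y → x ≢ z → y ≡ z) → ∀ xs → Unique xs → All P xs →
              length xs ℕ.≤ 1 ⊎ length xs ≡ 2 × ∃₂ λ x y → x ≢ y × P x × P y
at-most-two same []               _                             _                   = inj₁ z≤n
at-most-two same (x ∷ [])         _                             _                   = inj₁ (s≤s z≤n)
at-most-two same (x ∷ y ∷ [])     ((n ∷ _) ∷ _)                 (px ∷ py ∷ _)       = inj₂ (≡.refl , x , y , n , px , py)
at-most-two same (x ∷ y ∷ z ∷ xs) ((n ∷ m ∷ _) ∷ (k ∷ _) ∷ _)   (px ∷ py ∷ pz ∷ _)  = ⊥-elim (k (same px py pz n m))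

-- The signs of y + 1 and y - 1, or y = ±1.
Kind : Set
Kind = Fin 6

pattern ⊕⊕ = 0F
pattern ⊖⊖ = 1F
pattern ⊕⊖ = 2F
pattern ⊖⊕ = 3F
pattern Z⁺ = 4F
pattern Z⁻ = 5F

module _ {X : Set} (kind : X → Kind) where
  ofKind : Kind → List X → List X
  ofKind t = filter (λ x → kind x Finₚ.≟ t)

  # : Kind → List X → ℕ
  # t xs = length (ofKind t xs)

  length-by-kind : ∀ xs → length xs ≡ # ⊕⊕ xs ℕ.+ (# ⊖⊖ xs ℕ.+ (# ⊕⊖ xs ℕ.+ (# ⊖⊕ xs ℕ.+ (# Z⁺ xs ℕ.+ # Z⁻ xs))))
  length-by-kind []       = ≡.refl
  length-by-kind (x ∷ xs) with kind x | length-by-kind xs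
  ... | ⊕⊕  | e = ≡.cong suc e
  ... | ⊖⊖  | e = ≡.trans (≡.cong suc e) (≡.sym (ℕₚ.+-suc (# ⊕⊕ xs) _))
  ... | ⊕⊖  | e = ≡.trans (≡.cong suc e) (≡.trans (≡.sym (ℕₚ.+-suc (# ⊕⊕ xs) _)) (≡.cong (# ⊕⊕ xs ℕ.+_) (≡.sym (ℕₚ.+-suc (# ⊖⊖ xs) _))))
  ... | ⊖⊕  | e = ≡.trans (≡.cong suc e) (≡.trans (≡.sym (ℕₚ.+-suc (# ⊕⊕ xs) _)) (≡.cong (# ⊕⊕ xs ℕ.+_) (≡.trans (≡.sym (ℕₚ.+-suc (# ⊖⊖ xs) _))
                   (≡.cong (# ⊖⊖ xs ℕ.+_) (≡.sym (ℕₚ.+-suc (# ⊕⊖ xs) _))))))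
  ... | Z⁺ | e = ≡.trans (≡.cong suc e) (≡.trans (≡.sym (ℕₚ.+-suc (# ⊕⊕ xs) _)) (≡.cong (# ⊕⊕ xs ℕ.+_) (≡.trans (≡.sym (ℕₚ.+-suc (# ⊖⊖ xs) _))
                   (≡.cong (# ⊖⊖ xs ℕ.+_) (≡.trans (≡.sym (ℕₚ.+-suc (# ⊕⊖ xs) _)) (≡.cong (# ⊕⊖ xs ℕ.+_) (≡.sym (ℕₚ.+-suc (# ⊖⊕ xs) _))))))))
  ... | Z⁻ | e = ≡.trans (≡.cong suc e) (≡.trans (≡.sym (ℕₚ.+-suc (# ⊕⊕ xs) _)) (≡.cong (# ⊕⊕ xs ℕ.+_) (≡.trans (≡.sym (ℕₚ.+-suc (# ⊖⊖ xs) _))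
                   (≡.cong (# ⊖⊖ xs ℕ.+_) (≡.trans (≡.sym (ℕₚ.+-suc (# ⊕⊖ xs) _)) (≡.cong (# ⊕⊖ xs ℕ.+_) (≡.trans (≡.sym (ℕₚ.+-suc (# ⊖⊕ xs) _))
                     (≡.cong (# ⊖⊕ xs ℕ.+_) (≡.sym (ℕₚ.+-suc (# Z⁺ xs) _))))))))))

module UpperBound (K : FiniteField) (k : ℕ) (q≡4k+3 : FiniteField.size K ≡ 3 ℕ.+ k ℕ.* 4) where
  open Field K
  open QuadraticCharacter K k q≡4k+3

  private
    two four : Carrier
    two = 1# + 1#
    four = 1# + 1# + 1# + 1#

    four≢0 : four ≢ 0#
    four≢0 z = *≢0 two≢0 two≢0 (trans (ring 0 (κ 2 :* κ 2 := κ 4) refl) z)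

  Signs : Kind → Carrier → Set
  Signs ⊕⊕  y = χ (y + 1#) ≡ 1# × χ (y - 1#) ≡ 1#
  Signs ⊖⊖  y = χ (y + 1#) ≡ - 1# × χ (y - 1#) ≡ - 1#
  Signs ⊕⊖  y = χ (y + 1#) ≡ 1# × χ (y - 1#) ≡ - 1#
  Signs ⊖⊕  y = χ (y + 1#) ≡ - 1# × χ (y - 1#) ≡ 1#
  Signs Z⁺ y = y ≡ 1#
  Signs Z⁻ y = y ≡ - 1#

  classify : ∀ y → Σ Kind λ t → Signs t y
  classify y with y ≟ 1# | y ≟ (- 1#)
  ... | yes e | _     = Z⁺ , e
  ... | no _  | yes e = Z⁻ , e
  ... | no n  | no m  with χ-±1 {y + 1#} (λ z → m (-≡0 (trans (ring 1 (λ y → y :- :- κ 1 := y :+ κ 1) refl y) z))) | χ-±1 {y - 1#} (λ z → n (-≡0 z))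
  ...   | inj₁ a | inj₁ b = ⊕⊕ , a , b
  ...   | inj₂ a | inj₂ b = ⊖⊖ , a , b
  ...   | inj₁ a | inj₂ b = ⊕⊖ , a , b
  ...   | inj₂ a | inj₁ b = ⊖⊕ , a , b

  kind : Carrier → Kind
  kind y = proj₁ (classify y)

  module _ (v : Carrier) (v≢0 : v ≢ 0#) (1+v≢0 : 1# + v ≢ 0#) (1-v≢0 : 1# - v ≢ 0#) (χ≡ : χ (1# + v) ≡ χ (1# - v)) (c : Carrier) where
    Solution : Carrier → Set
    Solution y = F₂ v (y + 1#) - F₂ v (y - 1#) ≡ four * c

    private
      e g : Carrier
      e = χ (1# + v)
      g = χ (two * v)

      -- A solution of type ⊕⊕ forces χ L₁ = χ L₂ = e, one of type ⊖⊖ forces χ L₃ = χ L₄ = - e, two of type ⊕⊖ force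
      -- χ L₁ = χ L₄ = - g and two of type ⊖⊕ force χ L₂ = χ L₃ = g; five solutions contradict these constraints.
      L₁ L₂ L₃ L₄ : Carrier
      L₁ = c - (1# + v)
      L₂ = c + (1# + v)
      L₃ = c - (1# - v)
      L₄ = c + (1# - v)

      ≢neg : ∀ {x} → x ≢ 0# → x ≢ - x
      ≢neg {x} x≢0 eq = *≢0 two≢0 x≢0 (trans (ring 1 (λ x → κ 2 :* x := x :- :- x) refl x) (≡-0 eq))

      χ≢0 : ∀ {x} → x ≢ 0# → χ x ≢ 0#
      χ≢0 = ^≢0 h

      e≢0 : e ≢ 0#
      e≢0 = χ≢0 1+v≢0

      g≢0 : g ≢ 0#
      g≢0 = χ≢0 (*≢0 two≢0 v≢0)

      F-value : ∀ {t s} → χ t ≡ s → F₂ v t ≡ t * t * (1# + v * s)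
      F-value {t} eq = cong (λ s → t * t * (1# + v * s)) (trans (η≡χ t) eq)

      equation : ∀ {y s s′} → Solution y → χ (y + 1#) ≡ s → χ (y - 1#) ≡ s′ →
                 (y + 1#) * (y + 1#) * (1# + v * s) - (y - 1#) * (y - 1#) * (1# + v * s′) ≡ four * c
      equation sol a b = trans (sym (cong₂ _-_ (F-value a) (F-value b))) sol

      Eqn : Kind → Carrier → Set
      Eqn ⊕⊕  y = (1# + v) * y ≡ c
      Eqn ⊖⊖  y = (1# - v) * y ≡ c
      Eqn ⊕⊖  y = v * (y * y) + two * y + v ≡ two * c
      Eqn ⊖⊕  y = two * y - v * (y * y) - v ≡ two * c
      Eqn Z⁺ y = 1# + v * χ two ≡ c
      Eqn Z⁻ y = v * χ two - 1# ≡ c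

      solve-equation : ∀ t {y} → Signs t y → Solution y → Eqn t y
      solve-equation ⊕⊕ {y} (a , b) sol = *-cancelˡ four≢0 (trans (ring 2 (λ v y → κ 4 :* ((κ 1 :+ v) :* y)
        := (y :+ κ 1) :* (y :+ κ 1) :* (κ 1 :+ v :* κ 1) :- (y :- κ 1) :* (y :- κ 1) :* (κ 1 :+ v :* κ 1)) refl v y) (equation sol a b))
      solve-equation ⊖⊖ {y} (a , b) sol = *-cancelˡ four≢0 (trans (ring 2 (λ v y → κ 4 :* ((κ 1 :- v) :* y)
        := (y :+ κ 1) :* (y :+ κ 1) :* (κ 1 :+ v :* :- κ 1) :- (y :- κ 1) :* (y :- κ 1) :* (κ 1 :+ v :* :- κ 1)) refl v y) (equation sol a b))
      solve-equation ⊕⊖ {y} (a , b) sol = *-cancelˡ two≢0 (trans (ring 2 (λ v y → κ 2 :* (v :* (y :* y) :+ κ 2 :* y :+ v)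
        := (y :+ κ 1) :* (y :+ κ 1) :* (κ 1 :+ v :* κ 1) :- (y :- κ 1) :* (y :- κ 1) :* (κ 1 :+ v :* :- κ 1)) refl v y)
        (trans (equation sol a b) (ring 1 (λ c → κ 4 :* c := κ 2 :* (κ 2 :* c)) refl c)))
      solve-equation ⊖⊕ {y} (a , b) sol = *-cancelˡ two≢0 (trans (ring 2 (λ v y → κ 2 :* (κ 2 :* y :- v :* (y :* y) :- v)
        := (y :+ κ 1) :* (y :+ κ 1) :* (κ 1 :+ v :* :- κ 1) :- (y :- κ 1) :* (y :- κ 1) :* (κ 1 :+ v :* κ 1)) refl v y)
        (trans (equation sol a b) (ring 1 (λ c → κ 4 :* c := κ 2 :* (κ 2 :* c)) refl c)))
      solve-equation Z⁺ refl sol = *-cancelˡ four≢0 (trans (ring 3 (λ v s t → κ 4 :* (κ 1 :+ v :* s)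
        := (κ 1 :+ κ 1) :* (κ 1 :+ κ 1) :* (κ 1 :+ v :* s) :- (κ 1 :- κ 1) :* (κ 1 :- κ 1) :* (κ 1 :+ v :* t)) refl v (χ two) _) (equation sol refl refl))
      solve-equation Z⁻ refl sol = *-cancelˡ four≢0 (trans (ring 3 (λ v s t → κ 4 :* (v :* s :- κ 1)
        := (:- κ 1 :+ κ 1) :* (:- κ 1 :+ κ 1) :* (κ 1 :+ v :* t) :- (:- κ 1 :- κ 1) :* (:- κ 1 :- κ 1) :* (κ 1 :+ v :* :- s)) refl v (χ two) _)
        (equation sol refl (trans (cong χ (ring 0 (:- κ 1 :- κ 1 := :- κ 2) refl)) (χ-neg two))))

      χ-product : ∀ {a b s} x y → a ≡ x * y → χ x ≡ s → χ y ≡ b → χ a ≡ s * b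
      χ-product x y refl p q = trans (χ-* x y) (cong₂ _*_ p q)

      -- Inserting c = (1 + v)y gives L₁ = (1 + v)(y - 1) and L₂ = (1 + v)(y + 1), where the
      -- characters of y ± 1 are 1.
      A-signs : ∀ {y} → Signs ⊕⊕ y → Eqn ⊕⊕ y → χ L₁ ≡ e × χ L₂ ≡ e
      A-signs {y} (a , b) refl =
          trans (χ-product (1# + v) (y - 1#) (ring 2 (λ v y → (κ 1 :+ v) :* y :- (κ 1 :+ v) := (κ 1 :+ v) :* (y :- κ 1)) refl v y) refl b) (*-identityʳ e)
        , trans (χ-product (1# + v) (y + 1#) (ring 2 (λ v y → (κ 1 :+ v) :* y :+ (κ 1 :+ v) := (κ 1 :+ v) :* (y :+ κ 1)) refl v y) refl a) (*-identityʳ e)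

      x*-1 : ∀ x → x * - 1# ≡ - x
      x*-1 x = ring 1 (λ x → x :* :- κ 1 := :- x) refl x

      B-signs : ∀ {y} → Signs ⊖⊖ y → Eqn ⊖⊖ y → χ L₃ ≡ - e × χ L₄ ≡ - e
      B-signs {y} (a , b) refl =
          trans (χ-product (1# - v) (y - 1#) (ring 2 (λ v y → (κ 1 :- v) :* y :- (κ 1 :- v) := (κ 1 :- v) :* (y :- κ 1)) refl v y) (sym χ≡) b) (x*-1 e)
        , trans (χ-product (1# - v) (y + 1#) (ring 2 (λ v y → (κ 1 :- v) :* y :+ (κ 1 :- v) := (κ 1 :- v) :* (y :+ κ 1)) refl v y) (sym χ≡) a) (x*-1 e)

      χ-match : ∀ {t L} → χ (t * L) ≡ 1# → χ L ≡ χ t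
      χ-match {t} {L} eq = *-cancelˡ t≢0 (trans (sym (χ-* t L)) (trans eq (sym (χ² {t} (λ z → t≢0 (trans (cong χ z) χ-0))))))
        where
        t≢0 : χ t ≢ 0#
        t≢0 z = 0≢1 (trans (sym (trans (χ-* t L) (trans (cong (_* χ L) z) (zeroˡ _)))) eq)

      χ-pair : ∀ {s} a b → s * s ≡ 1# → χ a ≡ s → χ b ≡ s → χ (v * v * (a * b)) ≡ 1#
      χ-pair {s} a b ss p q = trans (χ-* (v * v) (a * b)) (trans (cong₂ _*_ (χ-square v≢0) (trans (χ-* a b) (trans (cong₂ _*_ p q) ss))) (*-identityˡ 1#))

      [-1]² : - 1# * - 1# ≡ 1#
      [-1]² = ring 0 (:- κ 1 :* :- κ 1 := κ 1) refl

      -- Vieta's formula for the sum of the roots: subtract the two equations and divide by y - z.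
      C-sum : ∀ {y z} → Eqn ⊕⊖ y → Eqn ⊕⊖ z → y ≢ z → v * (y + z) ≡ - two
      C-sum {y} {z} p q n = -≡0 (*-zero (λ w → n (-≡0 w)) (trans
        (ring 3 (λ v y z → (y :- z) :* (v :* (y :+ z) :- :- κ 2) := (v :* (y :* y) :+ κ 2 :* y :+ v) :- (v :* (z :* z) :+ κ 2 :* z :+ v)) refl v y z)
        (≡-0 (trans p (sym q)))))

      D-sum : ∀ {y z} → Eqn ⊖⊕ y → Eqn ⊖⊕ z → y ≢ z → v * (y + z) ≡ two
      D-sum {y} {z} p q n = sym (-≡0 (*-zero (λ w → n (-≡0 w)) (trans
        (ring 3 (λ v y z → (y :- z) :* (κ 2 :- v :* (y :+ z)) := (κ 2 :* y :- v :* (y :* y) :- v) :- (κ 2 :* z :- v :* (z :* z) :- v)) refl v y z)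
        (≡-0 (trans p (sym q))))))

      sum-cancel : ∀ {x y z s} → v * (x + y) ≡ s → v * (x + z) ≡ s → y ≡ z
      sum-cancel {x} {y} {z} p q = trans (ring 2 (λ x y → y := (x :+ y) :- x) refl x y)
        (trans (cong (_- x) (*-cancelˡ v≢0 (trans p (sym q)))) (ring 2 (λ x z → (x :+ z) :- x := z) refl x z))

      -- Vieta's formulas give v²(y - 1)(z - 1) = -2v L₁ and v²(y + 1)(z + 1) = -2v L₄. On the left
      -- the two roots contribute equal characters, so the value is 1, and both Lᵢ have the
      -- character of -2v, which is -g because -1 is a non-square.
      C-signs : ∀ {y z} → y ≢ z → Signs ⊕⊖ y → Signs ⊕⊖ z → Eqn ⊕⊖ y → Eqn ⊕⊖ z → χ L₁ ≡ - g × χ L₄ ≡ - g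
      C-signs {y} {z} n (a , b) (a′ , b′) p q =
          trans (χ-match (trans (cong χ (sym at⁻)) (χ-pair (y - 1#) (z - 1#) [-1]² b b′))) (χ-neg (two * v))
        , trans (χ-match (trans (cong χ (sym at⁺)) (χ-pair (y + 1#) (z + 1#) (*-identityˡ 1#) a a′))) (χ-neg (two * v))
        where
        S = C-sum p q n
        at⁻ : v * v * ((y - 1#) * (z - 1#)) ≡ - (two * v) * L₁
        at⁻ = trans (ring 4 (λ v y z c → v :* v :* ((y :- κ 1) :* (z :- κ 1))
             := :- (κ 2 :* v) :* (c :- (κ 1 :+ v)) :+ v :* ((y :- κ 1) :* (v :* (y :+ z) :- :- κ 2) :- ((v :* (y :* y) :+ κ 2 :* y :+ v) :- κ 2 :* c))) refl v y z c)
          (trans (cong₂ (λ m r → - (two * v) * L₁ + v * ((y - 1#) * m - r)) (≡-0 S) (≡-0 p)) (ring 3 (λ w v y → w :+ v :* ((y :- κ 1) :* κ 0 :- κ 0) := w) refl _ v y))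
        at⁺ : v * v * ((y + 1#) * (z + 1#)) ≡ - (two * v) * L₄
        at⁺ = trans (ring 4 (λ v y z c → v :* v :* ((y :+ κ 1) :* (z :+ κ 1))
             := :- (κ 2 :* v) :* (c :+ (κ 1 :- v)) :+ v :* ((y :+ κ 1) :* (v :* (y :+ z) :- :- κ 2) :- ((v :* (y :* y) :+ κ 2 :* y :+ v) :- κ 2 :* c))) refl v y z c)
          (trans (cong₂ (λ m r → - (two * v) * L₄ + v * ((y + 1#) * m - r)) (≡-0 S) (≡-0 p)) (ring 3 (λ w v y → w :+ v :* ((y :+ κ 1) :* κ 0 :- κ 0) := w) refl _ v y))

      D-signs : ∀ {y z} → y ≢ z → Signs ⊖⊕ y → Signs ⊖⊕ z → Eqn ⊖⊕ y → Eqn ⊖⊕ z → χ L₂ ≡ g × χ L₃ ≡ g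
      D-signs {y} {z} n (a , b) (a′ , b′) p q =
          χ-match (trans (cong χ (sym at⁺)) (χ-pair (y + 1#) (z + 1#) [-1]² a a′))
        , χ-match (trans (cong χ (sym at⁻)) (χ-pair (y - 1#) (z - 1#) (*-identityˡ 1#) b b′))
        where
        S = D-sum p q n
        at⁻ : v * v * ((y - 1#) * (z - 1#)) ≡ two * v * L₃
        at⁻ = trans (ring 4 (λ v y z c → v :* v :* ((y :- κ 1) :* (z :- κ 1))
             := κ 2 :* v :* (c :- (κ 1 :- v)) :+ v :* ((y :- κ 1) :* (v :* (y :+ z) :- κ 2) :+ ((κ 2 :* y :- v :* (y :* y) :- v) :- κ 2 :* c))) refl v y z c)
          (trans (cong₂ (λ m r → two * v * L₃ + v * ((y - 1#) * m + r)) (≡-0 S) (≡-0 p)) (ring 3 (λ w v y → w :+ v :* ((y :- κ 1) :* κ 0 :+ κ 0) := w) refl _ v y))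
        at⁺ : v * v * ((y + 1#) * (z + 1#)) ≡ two * v * L₂
        at⁺ = trans (ring 4 (λ v y z c → v :* v :* ((y :+ κ 1) :* (z :+ κ 1))
             := κ 2 :* v :* (c :+ (κ 1 :+ v)) :+ v :* ((y :+ κ 1) :* (v :* (y :+ z) :- κ 2) :+ ((κ 2 :* y :- v :* (y :* y) :- v) :- κ 2 :* c))) refl v y z c)
          (trans (cong₂ (λ m r → two * v * L₂ + v * ((y + 1#) * m + r)) (≡-0 S) (≡-0 p)) (ring 3 (λ w v y → w :+ v :* ((y :+ κ 1) :* κ 0 :+ κ 0) := w) refl _ v y))

      Has : Kind → Carrier → Set
      Has t y = Signs t y × Eqn t y

      same-A : ∀ {y z} → Has ⊕⊕ y → Has ⊕⊕ z → y ≡ z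
      same-A (_ , p) (_ , q) = *-cancelˡ 1+v≢0 (trans p (sym q))

      same-B : ∀ {y z} → Has ⊖⊖ y → Has ⊖⊖ z → y ≡ z
      same-B (_ , p) (_ , q) = *-cancelˡ 1-v≢0 (trans p (sym q))

      same-C : ∀ {x y z} → Has ⊕⊖ x → Has ⊕⊖ y → Has ⊕⊖ z → x ≢ y → x ≢ z → y ≡ z
      same-C (_ , p) (_ , q) (_ , r) n m = sum-cancel (C-sum p q n) (C-sum p r m)

      same-D : ∀ {x y z} → Has ⊖⊕ x → Has ⊖⊕ y → Has ⊖⊕ z → x ≢ y → x ≢ z → y ≡ z
      same-D (_ , p) (_ , q) (_ , r) n m = sum-cancel (D-sum p q n) (D-sum p r m)

      same-Z⁺ : ∀ {y z} → Has Z⁺ y → Has Z⁺ z → y ≡ z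
      same-Z⁺ (p , _) (q , _) = trans p (sym q)

      same-Z⁻ : ∀ {y z} → Has Z⁻ y → Has Z⁻ z → y ≡ z
      same-Z⁻ (p , _) (q , _) = trans p (sym q)

      module Contradictions where
        CD-A : χ L₁ ≡ e → χ L₂ ≡ e → χ L₁ ≡ - g → χ L₂ ≡ g → ⊥
        CD-A a b p r = ≢neg g≢0 (trans (sym r) (trans b (trans (sym a) p)))

        CD-B : χ L₃ ≡ - e → χ L₄ ≡ - e → χ L₃ ≡ g → χ L₄ ≡ - g → ⊥
        CD-B a b p r = ≢neg g≢0 (trans (sym p) (trans a (trans (sym b) r)))

        AB-C : χ L₁ ≡ e → χ L₄ ≡ - e → χ L₁ ≡ - g → χ L₄ ≡ - g → ⊥
        AB-C a b p r = ≢neg e≢0 (trans (sym a) (trans p (trans (sym r) b)))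

        AB-D : χ L₂ ≡ e → χ L₃ ≡ - e → χ L₂ ≡ g → χ L₃ ≡ g → ⊥
        AB-D a b p r = ≢neg e≢0 (trans (sym a) (trans p (trans (sym r) b)))

      -- The two points y = ±1 force one of the Lᵢ to vanish, and the others to be explicit.
      module Boundary where
        ≡χ0 : ∀ {L s} → L ≡ 0# → χ L ≡ s → s ≢ 0# → ⊥
        ≡χ0 z p n = n (trans (sym p) (trans (cong χ z) χ-0))

        χ-double : ∀ {L s} t → χ two ≡ s → L ≡ two * t → χ L ≡ s * χ t
        χ-double t p q = trans (cong χ q) (trans (χ-* two t) (cong (_* χ t) p))

        χ-double⁻ : ∀ {L s} t → χ two ≡ s → L ≡ - (two * t) → χ L ≡ - (s * χ t)
        χ-double⁻ t p q = trans (cong χ q) (trans (χ-neg (two * t)) (cong -_ (trans (χ-* two t) (cong (_* χ t) p))))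

        -e≢0 : - e ≢ 0#
        -e≢0 = -x≢0 e≢0

        -g≢0 : - g ≢ 0#
        -g≢0 = -x≢0 g≢0

        c-value : ∀ {s} → χ two ≡ s → 1# + v * χ two ≡ c → c ≡ 1# + v * s
        c-value p q = trans (sym q) (cong (λ s → 1# + v * s) p)

        c-value⁻ : ∀ {s} → χ two ≡ s → v * χ two - 1# ≡ c → c ≡ v * s - 1#
        c-value⁻ p q = trans (sym q) (cong (λ s → v * s - 1#) p)

      module Counting (ys : List Carrier) (un : Unique ys) (sols : All Solution ys) where
        N : Kind → ℕ
        N t = # kind t ys

        members : ∀ t → All (Has t) (ofKind kind t ys)
        members t = All.zipWith (λ {y} (eq , sol) → let s = ≡.subst (λ t → Signs t y) eq (proj₂ (classify y)) in s , solve-equation t s sol)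
          (Allₚ.all-filter (λ y → kind y Finₚ.≟ t) ys , Allₚ.filter⁺ (λ y → kind y Finₚ.≟ t) sols)

        unique : ∀ t → Unique (ofKind kind t ys)
        unique t = Uniqueₚ.filter⁺ (λ y → kind y Finₚ.≟ t) un

        nA = at-most-one same-A (ofKind kind ⊕⊕ ys) (unique ⊕⊕) (members ⊕⊕)
        nB = at-most-one same-B (ofKind kind ⊖⊖ ys) (unique ⊖⊖) (members ⊖⊖)
        nC = at-most-two same-C (ofKind kind ⊕⊖ ys) (unique ⊕⊖) (members ⊕⊖)
        nD = at-most-two same-D (ofKind kind ⊖⊕ ys) (unique ⊖⊕) (members ⊖⊕)
        nZ⁺ = at-most-one same-Z⁺ (ofKind kind Z⁺ ys) (unique Z⁺) (members Z⁺)
        nZ⁻ = at-most-one same-Z⁻ (ofKind kind Z⁻ ys) (unique Z⁻) (members Z⁻)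

        total : ∀ a b c d z z′ → N ⊕⊕ ℕ.≤ a → N ⊖⊖ ℕ.≤ b → N ⊕⊖ ℕ.≤ c → N ⊖⊕ ℕ.≤ d → N Z⁺ ℕ.≤ z → N Z⁻ ℕ.≤ z′ →
                a ℕ.+ (b ℕ.+ (c ℕ.+ (d ℕ.+ (z ℕ.+ z′)))) ≡ 4 → length ys ℕ.≤ 4
        total a b c d z z′ p₁ p₂ p₃ p₄ p₅ p₆ s = ℕₚ.≤-trans (ℕₚ.≤-reflexive (length-by-kind kind ys))
          (ℕₚ.≤-trans (ℕₚ.+-mono-≤ p₁ (ℕₚ.+-mono-≤ p₂ (ℕₚ.+-mono-≤ p₃ (ℕₚ.+-mono-≤ p₄ (ℕₚ.+-mono-≤ p₅ p₆))))) (ℕₚ.≤-reflexive s))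

        data One (t : Kind) (P : Set) : Set where
          none : N t ℕ.≤ 0 → One t P
          one  : N t ℕ.≤ 1 → P → One t P

        data Two (t : Kind) (P : Set) : Set where
          one : N t ℕ.≤ 1 → Two t P
          pair : N t ℕ.≤ 2 → P → Two t P

        ≤2 : ∀ {t P} → Two t P → N t ℕ.≤ 2
        ≤2 (one p)    = ℕₚ.m≤n⇒m≤1+n p
        ≤2 (pair p _) = p

        oneA : One ⊕⊕ (χ L₁ ≡ e × χ L₂ ≡ e)
        oneA = [ (λ p → none (ℕₚ.≤-reflexive p)) , (λ (p , _ , s , q) → one (ℕₚ.≤-reflexive p) (A-signs s q)) ]′ nA

        oneB : One ⊖⊖ (χ L₃ ≡ - e × χ L₄ ≡ - e)
        oneB = [ (λ p → none (ℕₚ.≤-reflexive p)) , (λ (p , _ , s , q) → one (ℕₚ.≤-reflexive p) (B-signs s q)) ]′ nB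

        twoC : Two ⊕⊖ (χ L₁ ≡ - g × χ L₄ ≡ - g)
        twoC = [ one , (λ (p , _ , _ , n , (s , q) , (s′ , q′)) → pair (ℕₚ.≤-reflexive p) (C-signs n s s′ q q′)) ]′ nC

        twoD : Two ⊖⊕ (χ L₂ ≡ g × χ L₃ ≡ g)
        twoD = [ one , (λ (p , _ , _ , n , (s , q) , (s′ , q′)) → pair (ℕₚ.≤-reflexive p) (D-signs n s s′ q q′)) ]′ nD

        oneZ⁺ : One Z⁺ (1# + v * χ (1# + 1#) ≡ c)
        oneZ⁺ = [ (λ p → none (ℕₚ.≤-reflexive p)) , (λ (p , _ , _ , q) → one (ℕₚ.≤-reflexive p) q) ]′ nZ⁺

        oneZ⁻ : One Z⁻ (v * χ (1# + 1#) - 1# ≡ c)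
        oneZ⁻ = [ (λ p → none (ℕₚ.≤-reflexive p)) , (λ (p , _ , _ , q) → one (ℕₚ.≤-reflexive p) q) ]′ nZ⁻

        open Contradictions
        open Boundary

        -- Apart from y = ±1, five solutions would consist at least of one equal-sign solution and
        -- both pairs, or of both equal-sign solutions and a pair; the prescribed characters
        -- conflict. A solution y = 1 or y = -1 (both at once would give 2 = 0) determines c through
        -- χ(2). Then one Lᵢ is 0, which rules out one equal-sign kind and one pair, and another Lᵢ
        -- is ±2(1 ± v), whose character refutes the only combination of five that is left.
        decide : One ⊕⊕ (χ L₁ ≡ e × χ L₂ ≡ e) → One ⊖⊖ (χ L₃ ≡ - e × χ L₄ ≡ - e) → Two ⊕⊖ (χ L₁ ≡ - g × χ L₄ ≡ - g) → Two ⊖⊕ (χ L₂ ≡ g × χ L₃ ≡ g) →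
                 One Z⁺ (1# + v * χ (1# + 1#) ≡ c) → One Z⁻ (v * χ (1# + 1#) - 1# ≡ c) → χ (1# + 1#) ≡ 1# ⊎ χ (1# + 1#) ≡ - 1# → length ys ℕ.≤ 4
        decide (none a) (none b) c d (none z) (none z′) _ = total 0 0 2 2 0 0 a b (≤2 c) (≤2 d) z z′ refl
        decide (one a _) (none b) (one c) d (none z) (none z′) _ = total 1 0 1 2 0 0 a b c (≤2 d) z z′ refl
        decide (one a _) (none b) (pair c _) (one d) (none z) (none z′) _ = total 1 0 2 1 0 0 a b c d z z′ refl
        decide (one _ (l₁ , l₂)) (none _) (pair _ (m₁ , _)) (pair _ (m₂ , _)) (none z) (none z′) _ = ⊥-elim (CD-A l₁ l₂ m₁ m₂)
        decide (none a) (one b _) (one c) d (none z) (none z′) _ = total 0 1 1 2 0 0 a b c (≤2 d) z z′ refl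
        decide (none a) (one b _) (pair c _) (one d) (none z) (none z′) _ = total 0 1 2 1 0 0 a b c d z z′ refl
        decide (none _) (one _ (l₃ , l₄)) (pair _ (_ , m₄)) (pair _ (_ , m₃)) (none z) (none z′) _ = ⊥-elim (CD-B l₃ l₄ m₃ m₄)
        decide (one a _) (one b _) (one c) (one d) (none z) (none z′) _ = total 1 1 1 1 0 0 a b c d z z′ refl
        decide (one _ (l₁ , _)) (one _ (_ , l₄)) (pair _ (m₁ , m₄)) _ (none z) (none z′) _ = ⊥-elim (AB-C l₁ l₄ m₁ m₄)
        decide (one _ (_ , l₂)) (one _ (l₃ , _)) _ (pair _ (m₂ , m₃)) (none z) (none z′) _ = ⊥-elim (AB-D l₂ l₃ m₂ m₃)
        decide _ _ _ _ (one z r) (one z′ r′) _ = ⊥-elim (two≢0 (trans (ring 1 (λ w → κ 2 := (κ 1 :+ w) :- (w :- κ 1)) refl (v * χ (1# + 1#))) (≡-0 (trans r (sym r′)))))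
        decide (one _ (l₁ , _)) _ _ _ (one z r) (none z′) (inj₁ χ2) = ⊥-elim (≡χ0 (trans (cong (_- (1# + v)) (c-value χ2 r)) (ring 1 (λ v → (κ 1 :+ v :* κ 1) :- (κ 1 :+ v) := κ 0) refl v)) l₁ e≢0)
        decide (none _) _ (pair _ (m₁ , _)) _ (one z r) (none z′) (inj₁ χ2) = ⊥-elim (≡χ0 (trans (cong (_- (1# + v)) (c-value χ2 r)) (ring 1 (λ v → (κ 1 :+ v :* κ 1) :- (κ 1 :+ v) := κ 0) refl v)) m₁ -g≢0)
        decide (none a) (none b) (one c) d (one z r) (none z′) (inj₁ χ2) = total 0 0 1 2 1 0 a b c (≤2 d) z z′ refl
        decide (none a) (one b _) (one c) (one d) (one z r) (none z′) (inj₁ χ2) = total 0 1 1 1 1 0 a b c d z z′ refl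
        decide (none _) (one _ (l₃ , _)) (one _) (pair _ (m₂ , m₃)) (one z r) (none z′) (inj₁ χ2) = ⊥-elim (≢neg e≢0 (trans (trans (sym (*-identityˡ e)) (trans (sym (χ-double (1# + v) χ2 (trans (cong (_+ (1# + v)) (c-value χ2 r)) (ring 1 (λ v → (κ 1 :+ v :* κ 1) :+ (κ 1 :+ v) := κ 2 :* (κ 1 :+ v)) refl v)))) m₂)) (trans (sym m₃) l₃)))
        decide _ (one _ (l₃ , _)) _ _ (one z r) (none z′) (inj₂ χ2) = ⊥-elim (≡χ0 (trans (cong (_- (1# - v)) (c-value χ2 r)) (ring 1 (λ v → (κ 1 :+ v :* :- κ 1) :- (κ 1 :- v) := κ 0) refl v)) l₃ -e≢0)
        decide _ (none _) _ (pair _ (_ , m₃)) (one z r) (none z′) (inj₂ χ2) = ⊥-elim (≡χ0 (trans (cong (_- (1# - v)) (c-value χ2 r)) (ring 1 (λ v → (κ 1 :+ v :* :- κ 1) :- (κ 1 :- v) := κ 0) refl v)) m₃ g≢0)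
        decide (none a) (none b) c (one d) (one z r) (none z′) (inj₂ χ2) = total 0 0 2 1 1 0 a b (≤2 c) d z z′ refl
        decide (one a _) (none b) (one c) (one d) (one z r) (none z′) (inj₂ χ2) = total 1 0 1 1 1 0 a b c d z z′ refl
        decide (one _ (l₁ , _)) (none _) (pair _ (m₁ , m₄)) (one _) (one z r) (none z′) (inj₂ χ2) = ⊥-elim (≢neg e≢0 (trans (trans (sym l₁) (trans m₁ (sym m₄)))
              (trans (χ-double (1# - v) χ2 (trans (cong (_+ (1# - v)) (c-value χ2 r)) (ring 1 (λ v → (κ 1 :+ v :* :- κ 1) :+ (κ 1 :- v) := κ 2 :* (κ 1 :- v)) refl v)))
                (trans (cong (- 1# *_) (sym χ≡)) (ring 1 (λ e → :- κ 1 :* e := :- e) refl e)))))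
        decide _ (one _ (_ , l₄)) _ _ (none z) (one z′ r) (inj₁ χ2) = ⊥-elim (≡χ0 (trans (cong (_+ (1# - v)) (c-value⁻ χ2 r)) (ring 1 (λ v → (v :* κ 1 :- κ 1) :+ (κ 1 :- v) := κ 0) refl v)) l₄ -e≢0)
        decide _ (none _) (pair _ (_ , m₄)) _ (none z) (one z′ r) (inj₁ χ2) = ⊥-elim (≡χ0 (trans (cong (_+ (1# - v)) (c-value⁻ χ2 r)) (ring 1 (λ v → (v :* κ 1 :- κ 1) :+ (κ 1 :- v) := κ 0) refl v)) m₄ -g≢0)
        decide (none a) (none b) (one c) d (none z) (one z′ r) (inj₁ χ2) = total 0 0 1 2 0 1 a b c (≤2 d) z z′ refl
        decide (one a _) (none b) (one c) (one d) (none z) (one z′ r) (inj₁ χ2) = total 1 0 1 1 0 1 a b c d z z′ refl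
        decide (one _ (_ , l₂)) (none _) (one _) (pair _ (m₂ , m₃)) (none z) (one z′ r) (inj₁ χ2) = ⊥-elim (≢neg e≢0 (trans (trans (sym l₂) (trans m₂ (sym m₃)))
              (trans (χ-double⁻ (1# - v) χ2 (trans (cong (_- (1# - v)) (c-value⁻ χ2 r)) (ring 1 (λ v → (v :* κ 1 :- κ 1) :- (κ 1 :- v) := :- (κ 2 :* (κ 1 :- v))) refl v)))
                (cong -_ (trans (*-identityˡ _) (sym χ≡))))))
        decide (one _ (_ , l₂)) _ _ _ (none z) (one z′ r) (inj₂ χ2) = ⊥-elim (≡χ0 (trans (cong (_+ (1# + v)) (c-value⁻ χ2 r)) (ring 1 (λ v → (v :* :- κ 1 :- κ 1) :+ (κ 1 :+ v) := κ 0) refl v)) l₂ e≢0)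
        decide (none _) _ _ (pair _ (m₂ , _)) (none z) (one z′ r) (inj₂ χ2) = ⊥-elim (≡χ0 (trans (cong (_+ (1# + v)) (c-value⁻ χ2 r)) (ring 1 (λ v → (v :* :- κ 1 :- κ 1) :+ (κ 1 :+ v) := κ 0) refl v)) m₂ g≢0)
        decide (none a) (none b) c (one d) (none z) (one z′ r) (inj₂ χ2) = total 0 0 2 1 0 1 a b (≤2 c) d z z′ refl
        decide (none a) (one b _) (one c) (one d) (none z) (one z′ r) (inj₂ χ2) = total 0 1 1 1 0 1 a b c d z z′ refl
        decide (none _) (one _ (_ , l₄)) (pair _ (m₁ , m₄)) (one _) (none z) (one z′ r) (inj₂ χ2) = ⊥-elim (≢neg e≢0 (trans
              (trans (ring 1 (λ e → e := :- (:- κ 1 :* e)) refl e)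
                (sym (χ-double⁻ (1# + v) χ2 (trans (cong (_- (1# + v)) (c-value⁻ χ2 r)) (ring 1 (λ v → (v :* :- κ 1 :- κ 1) :- (κ 1 :+ v) := :- (κ 2 :* (κ 1 :+ v))) refl v)))))
              (trans m₁ (trans (sym m₄) l₄))))

        at-most-four : length ys ℕ.≤ 4
        at-most-four = decide oneA oneB twoC twoD oneZ⁺ oneZ⁻ (χ-±1 two≢0)

    solutions≤4 : ∀ ys → Unique ys → All Solution ys → length ys ℕ.≤ 4
    solutions≤4 = Counting.at-most-four

-- From solutions to the differential uniformity

unique-⊆-length : ∀ {A : Set} (xs ys : List A) → Unique xs → All (_∈ ys) xs → length xs ℕ.≤ length ys
unique-⊆-length []       ys _         _          = z≤n
unique-⊆-length (x ∷ xs) ys (x∉ ∷ un) (x∈ ∷ xs∈) with ∈-∃++ x∈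
... | as , bs , ≡.refl = ℕₚ.≤-trans (s≤s (unique-⊆-length xs (as ++ bs) un (shrink x∉ xs∈)))
    (ℕₚ.≤-reflexive (≡.trans (≡.cong suc (Listₚ.length-++ as)) (≡.trans (≡.sym (ℕₚ.+-suc (length as) (length bs))) (≡.sym (Listₚ.length-++ as)))))
  where
  without : ∀ {y} → x ≢ y → y ∈ as ++ x ∷ bs → y ∈ as ++ bs
  without n m with ∈-++⁻ as m
  ... | inj₁ l           = ∈-++⁺ˡ l
  ... | inj₂ (here e)    = ⊥-elim (n (≡.sym e))
  ... | inj₂ (there r)   = ∈-++⁺ʳ as r
  shrink : ∀ {zs} → All (x ≢_) zs → All (_∈ as ++ x ∷ bs) zs → All (_∈ as ++ bs) zs
  shrink []       []       = []
  shrink (n ∷ ns) (m ∷ ms) = without n m ∷ shrink ns ms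

maximum-≤ : ∀ {n} xs → All (ℕ._≤ n) xs → foldr ℕ._⊔_ 0 xs ℕ.≤ n
maximum-≤ []       []       = z≤n
maximum-≤ (x ∷ xs) (p ∷ ps) = ℕₚ.⊔-lub p (maximum-≤ xs ps)

≤-maximum : ∀ {x} xs → x ∈ xs → x ℕ.≤ foldr ℕ._⊔_ 0 xs
≤-maximum (x ∷ xs) (here ≡.refl) = ℕₚ.m≤m⊔n x _
≤-maximum (x ∷ xs) (there m)     = ℕₚ.≤-trans (≤-maximum xs m) (ℕₚ.m≤n⊔m x _)

-- few requires μ < √(8q / 67) and large requires μ > 256 · 65 / 2 = 8320; μ = 9000 suits every q ≥ 27535².
module Numerics (q h : ℕ) (q≡2h+1 : q ≡ suc (h ℕ.+ h)) (q≥ : 758176225 ℕ.≤ q) where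
  private
    16≤h : 16 ℕ.≤ h
    16≤h = ℕₚ.≮⇒≥ λ h<16 → ℕₚ.<⇒≱ (ℕₚ.≤-<-trans (ℕₚ.≤-reflexive q≡2h+1) (s≤s (ℕₚ.+-mono-< h<16 h<16)))
      (ℕₚ.≤-trans (ℕₚ.≤ᵇ⇒≤ 33 758176225 tt) q≥)

  A : ℕ
  A = h ℕ.∸ 16

  h≡ : h ≡ 16 ℕ.+ A
  h≡ = ≡.sym (ℕₚ.m+[n∸m]≡n 16≤h)

  2μ≤q : 9000 ℕ.+ 9000 ℕ.≤ q
  2μ≤q = ℕₚ.≤-trans (ℕₚ.≤ᵇ⇒≤ 18000 758176225 tt) q≥

  private
    q≡ : q ≡ 33 ℕ.+ (A ℕ.+ A)
    q≡ = ≡.trans q≡2h+1 (≡.cong suc (≡.trans (≡.cong (λ z → z ℕ.+ z) h≡)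
      (≡.trans (ℕₚ.+-assoc 16 A (16 ℕ.+ A)) (≡.trans (≡.cong (16 ℕ.+_) (≡.trans (≡.sym (ℕₚ.+-assoc A 16 A)) (≡.trans (≡.cong (ℕ._+ A) (ℕₚ.+-comm A 16)) (ℕₚ.+-assoc 16 A A)))) (≡.sym (ℕₚ.+-assoc 16 16 (A ℕ.+ A)))))))

    A-large : 379088096 ℕ.≤ A
    A-large = ℕₚ.≮⇒≥ λ A< → ℕₚ.<⇒≱ (ℕₚ.≤-<-trans (ℕₚ.≤-reflexive q≡) (ℕₚ.+-monoʳ-< 33 (ℕₚ.+-mono-< A< A<))) q≥

  few : 9000 ℕ.* (17 ℕ.+ 67 ℕ.* 9000) ℕ.< 16 ℕ.* suc A
  few = ℕₚ.<-≤-trans (ℕₚ.<ᵇ⇒< (9000 ℕ.* (17 ℕ.+ 67 ℕ.* 9000)) (16 ℕ.* 379088096) tt) (ℕₚ.*-monoʳ-≤ 16 (ℕₚ.m≤n⇒m≤1+n A-large))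

  large : 256 ℕ.* errorTerm q 9000 ℕ.+ (9000 ℕ.+ 9000) ℕ.* 8192 ℕ.< (9000 ℕ.+ 9000) ℕ.* q
  -- Of the 18000 multiples of q, 256 · 65 = 16640 are used up by the error terms. The other 1360
  -- exceed the constants, which are 147456000 from 256 · 64μ and the same from the zeros.
  large = begin-strict
    256 ℕ.* errorTerm q 9000 ℕ.+ 147456000           ≡⟨ ≡.cong (λ t → 256 ℕ.* t ℕ.+ 147456000) (≡.sym (errorTerm-def q 9000)) ⟩
    256 ℕ.* (65 ℕ.* q ℕ.+ 576000) ℕ.+ 147456000      ≡⟨ ≡.cong (ℕ._+ 147456000) (ℕₚ.*-distribˡ-+ 256 (65 ℕ.* q) 576000) ⟩
    256 ℕ.* (65 ℕ.* q) ℕ.+ 147456000 ℕ.+ 147456000   ≡⟨ ≡.cong (λ t → t ℕ.+ 147456000 ℕ.+ 147456000) (≡.sym (ℕₚ.*-assoc 256 65 q)) ⟩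
    16640 ℕ.* q ℕ.+ 147456000 ℕ.+ 147456000          ≡⟨ ℕₚ.+-assoc (16640 ℕ.* q) 147456000 147456000 ⟩
    16640 ℕ.* q ℕ.+ 294912000                        <⟨ ℕₚ.+-monoʳ-< (16640 ℕ.* q) (ℕₚ.<-≤-trans (ℕₚ.<ᵇ⇒< 294912000 (1360 ℕ.* 758176225) tt) (ℕₚ.*-monoʳ-≤ 1360 q≥)) ⟩
    16640 ℕ.* q ℕ.+ 1360 ℕ.* q                       ≡⟨ ≡.sym (ℕₚ.*-distribʳ-+ q 16640 1360) ⟩
    18000 ℕ.* q                                      ∎
    where open ℕₚ.≤-Reasoning

module Uniformity (K : FiniteField) (k : ℕ) (q≡4k+3 : FiniteField.size K ≡ 3 ℕ.+ k ℕ.* 4) where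
  open Field K
  open QuadraticCharacter K k q≡4k+3
  open UpperBound K k q≡4k+3

  module _ (u : Carrier) (u≢0 : u ≢ 0#) (1+u≢0 : 1# + u ≢ 0#) (1-u≢0 : 1# - u ≢ 0#) (χ≡ : χ (1# + u) ≡ χ (1# - u)) where
    -- The character is multiplicative, so scaling the argument by a nonzero α only changes u into
    -- ±u. The hypotheses on u are symmetric under this change, as `twist` records, and every
    -- nonzero a reduces to the difference 2.
    F-scale : ∀ α z → F₂ u (α * z) ≡ α * α * F₂ (u * χ α) z
    F-scale α z = trans (cong (λ s → α * z * (α * z) * (1# + u * s)) (trans (η≡χ (α * z)) (trans (χ-* α z) (cong (χ α *_) (sym (η≡χ z))))))
      (ring 5 (λ a z u s t → a :* z :* (a :* z) :* (κ 1 :+ u :* (s :* t)) := a :* a :* (z :* z :* (κ 1 :+ u :* s :* t))) refl α z u (χ α) (η z))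

    private
      twist : ∀ s → s ≡ 1# ⊎ s ≡ - 1# → u * s ≢ 0# × 1# + u * s ≢ 0# × 1# - u * s ≢ 0# × χ (1# + u * s) ≡ χ (1# - u * s)
      twist s (inj₁ refl) = subst′ (sym (*-identityʳ u)) (u≢0 , 1+u≢0 , 1-u≢0 , χ≡)
        where
        subst′ : ∀ {v} → u ≡ v → u ≢ 0# × 1# + u ≢ 0# × 1# - u ≢ 0# × χ (1# + u) ≡ χ (1# - u) → v ≢ 0# × 1# + v ≢ 0# × 1# - v ≢ 0# × χ (1# + v) ≡ χ (1# - v)
        subst′ refl p = p
      twist s (inj₂ refl) = (λ z → -x≢0 u≢0 (trans (sym v≡) z)) , (λ z → 1-u≢0 (trans (sym 1+v) z)) , (λ z → 1+u≢0 (trans (sym 1-v) z))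
                          , trans (cong χ 1+v) (trans (sym χ≡) (sym (cong χ 1-v)))
        where
        v≡ : u * - 1# ≡ - u
        v≡ = ring 1 (λ u → u :* :- κ 1 := :- u) refl u
        1+v : 1# + u * - 1# ≡ 1# - u
        1+v = ring 1 (λ u → κ 1 :+ u :* :- κ 1 := κ 1 :- u) refl u
        1-v : 1# - u * - 1# ≡ 1# + u
        1-v = ring 1 (λ u → κ 1 :- u :* :- κ 1 := κ 1 :+ u) refl u

    δ≤4 : ∀ a b → a ≢ 0# → δ (F₂ u) a b ℕ.≤ 4
    δ≤4 a b a≢0 = ℕₚ.≤-trans (ℕₚ.≤-reflexive (sym (Listₚ.length-map φ xs)))
        (solutions≤4 v (proj₁ hyps) (proj₁ (proj₂ hyps)) (proj₁ (proj₂ (proj₂ hyps))) (proj₂ (proj₂ (proj₂ hyps))) c (map φ xs)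
          (Uniqueₚ.map⁺ φ-injective (Uniqueₚ.filter⁺ P? elements-unique)) (Allₚ.map⁺ (All.map (λ {x} → solves x) (Allₚ.all-filter P? elements))))
      where
      P? = λ x → (F₂ u (x + a) - F₂ u x) ≟ b
      xs = filter P? elements
      two = 1# + 1#
      four = 1# + 1# + 1# + 1#
      -- Half of a: with y = x / α + 1 the arguments x and x + a are α(y - 1) and α(y + 1),
      -- symmetric about αy.
      α = a * two ⁻¹
      α+α : α + α ≡ a
      α+α = trans (ring 2 (λ a i → a :* i :+ a :* i := a :* (κ 2 :* i)) refl a (two ⁻¹)) (trans (cong (a *_) (inverseʳ two two≢0)) (*-identityʳ a))
      α≢0 : α ≢ 0#
      α≢0 z = a≢0 (trans (sym α+α) (trans (cong (λ t → t + t) z) (+-identityˡ 0#)))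
      φ : Carrier → Carrier
      φ x = x * α ⁻¹ + 1#
      αα⁻¹ : ∀ x → α * (x * α ⁻¹) ≡ x
      αα⁻¹ x = trans (ring 3 (λ a x i → a :* (x :* i) := a :* i :* x) refl α x (α ⁻¹)) (trans (cong (_* x) (inverseʳ α α≢0)) (*-identityˡ x))
      φ-injective : ∀ {x y} → φ x ≡ φ y → x ≡ y
      φ-injective {x} {y} e = trans (sym (αα⁻¹ x)) (trans (cong (α *_) (trans (ring 1 (λ t → t := (t :+ κ 1) :- κ 1) refl (x * α ⁻¹)) (trans (cong (_- 1#) e) (ring 1 (λ t → (t :+ κ 1) :- κ 1 := t) refl (y * α ⁻¹))))) (αα⁻¹ y))
      v = u * χ α
      hyps = twist (χ α) (χ-±1 α≢0)
      n≢0 : α * α * four ≢ 0#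
      n≢0 = *≢0 (*≢0 α≢0 α≢0) (λ z → *≢0 two≢0 two≢0 (trans (ring 0 (κ 2 :* κ 2 := κ 4) refl) z))
      c = b * (α * α * four) ⁻¹
      solves : ∀ x → F₂ u (x + a) - F₂ u x ≡ b → F₂ v (φ x + 1#) - F₂ v (φ x - 1#) ≡ four * c
      solves x e = *-cancelˡ (*≢0 α≢0 α≢0) (begin
        α * α * (F₂ v (φ x + 1#) - F₂ v (φ x - 1#))               ≡⟨ ring 3 (λ n s t → n :* (s :- t) := n :* s :- n :* t) refl (α * α) _ _ ⟩
        α * α * F₂ v (φ x + 1#) - α * α * F₂ v (φ x - 1#)         ≡⟨ cong₂ _-_ (sym (F-scale α (φ x + 1#))) (sym (F-scale α (φ x - 1#))) ⟩
        F₂ u (α * (φ x + 1#)) - F₂ u (α * (φ x - 1#))             ≡⟨ cong₂ (λ s t → F₂ u s - F₂ u t) upper lower ⟩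
        F₂ u (x + a) - F₂ u x                                     ≡⟨ e ⟩
        b                                                         ≡⟨ sym (*-identityˡ b) ⟩
        1# * b                                                    ≡⟨ cong (_* b) (sym (inverseʳ (α * α * four) n≢0)) ⟩
        α * α * four * (α * α * four) ⁻¹ * b                      ≡⟨ ring 4 (λ n f i b → n :* f :* i :* b := n :* (f :* (b :* i))) refl (α * α) four ((α * α * four) ⁻¹) b ⟩
        α * α * (four * c)                                        ∎)
        where
        open ≡.≡-Reasoning
        upper : α * (φ x + 1#) ≡ x + a
        upper = trans (ring 2 (λ a t → a :* (t :+ κ 1 :+ κ 1) := a :* t :+ (a :+ a)) refl α (x * α ⁻¹)) (cong₂ _+_ (αα⁻¹ x) α+α)
        lower : α * (φ x - 1#) ≡ x
        lower = trans (cong (α *_) (ring 1 (λ t → (t :+ κ 1) :- κ 1 := t) refl (x * α ⁻¹))) (αα⁻¹ x)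

    uniformity≤4 : diffUniformity (F₂ u) ℕ.≤ 4
    uniformity≤4 = maximum-≤ _ (Allₚ.concat⁺ (Allₚ.map⁺ (All.map (λ {a} a≢0 → Allₚ.map⁺ (All.universal (λ b → δ≤4 a b a≢0) elements)) (Allₚ.all-filter (λ a → ¬? (a ≟ 0#)) elements))))

  uniformity≥ : ∀ f a b xs → a ≢ 0# → Unique xs → All (λ x → f (x + a) - f x ≡ b) xs → length xs ℕ.≤ diffUniformity f
  uniformity≥ f a b xs a≢0 un sols = ℕₚ.≤-trans
    (unique-⊆-length xs _ un (All.map (λ {x} e → ∈-filter⁺ (λ x → (f (x + a) - f x) ≟ b) (∈-elements x) e) sols))
    (≤-maximum _ (∈-concatMap⁺ (λ a → map (λ b → δ f a b) elements) (Any.map (λ { refl → ∈-map⁺ (λ b → δ f a b) (∈-elements b) }) (∈-filter⁺ (λ a → ¬? (a ≟ 0#)) (∈-elements a) a≢0))))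

open import Data.Nat using (_^_; _≥_; _%_)

theorem4 : (K : FiniteField) → let open FiniteField K in
    (p n : ℕ) → Prime p → p ≢ 2 → size ≡ p ^ n →
    size % 4 ≡ 3 → size ≥ 27535 ^ 2 →
    (u : Carrier) →
    u ≢ 0# → u ≢ 1# → u ≢ - 1# →
    (p ≢ 3 → u ≢ three ⁻¹ × u ≢ - (three ⁻¹)) →
    η (1# + u) ≡ η (1# - u) →
    diffUniformity (F₂ u) ≡ 4
theorem4 K p n pr _ q≡ q%4≡3 q≥ u u≢0 u≢1 u≢-1 u≢±⅓ η≡ =
  ℕₚ.≤-antisym (uniformity≤4 u u≢0 1+u≢0 1-u≢0 χ≡) (lower four)
  where
  open Field K using (Carrier; _+_; _*_; _-_; -_; 0#; 1#; _⁻¹; size; three; F₂; diffUniformity; 0≢1; inverseʳ; -≡0; *-zero; *-cancelˡ; ring; refl; sym; trans; cong; zeroˡ; zeroʳ; +-identityʳ)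
  k = size ℕ./ 4
  q≡4k+3 : size ≡ 3 ℕ.+ k ℕ.* 4
  q≡4k+3 = trans (m≡m%n+[m/n]*n size 4) (cong (ℕ._+ k ℕ.* 4) q%4≡3)
  open QuadraticCharacter K k q≡4k+3
  open Uniformity K k q≡4k+3
  open Numerics size h q≡2h+1 q≥
  1+u≢0 : 1# + u ≢ 0#
  1+u≢0 z = u≢-1 (-≡0 (trans (ring 1 (λ u → u :- :- κ 1 := κ 1 :+ u) refl u) z))
  1-u≢0 : 1# - u ≢ 0#
  1-u≢0 z = u≢1 (sym (-≡0 z))
  χ≡ : χ (1# + u) ≡ χ (1# - u)
  χ≡ = trans (sym (η≡χ (1# + u))) (trans η≡ (η≡χ (1# - u)))
  three≡0⇒ : ∀ v → three ≡ 0# → 1# + three * v ≢ 0#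
  three≡0⇒ v t z = 0≢1 (sym (trans (sym (trans (cong (λ s → 1# + s * v) t) (trans (cong (1# +_) (zeroˡ v)) (+-identityʳ 1#)))) z))
  1+3v≢0 : ∀ v → (p ≢ 3 → v ≢ - (three ⁻¹)) → 1# + three * v ≢ 0#
  1+3v≢0 v v≢ z with p ℕ.≟ 3
  ... | yes refl = three≡0⇒ v (trans (ring 0 (κ 3 := κ 1 :+ (κ 1 :+ (κ 1 :+ κ 0))) refl) (FiniteFieldTheory.characteristic K n q≡)) z
  ... | no p≢3   = v≢ p≢3 (*-cancelˡ three≢0 (-≡0 (trans (trans (ring 3 (λ t v i → t :* v :- t :* :- i := t :* v :+ t :* i) refl three v (three ⁻¹))
                     (trans (cong (three * v +_) (inverseʳ three three≢0)) (ring 1 (λ s → s :+ κ 1 := κ 1 :+ s) refl (three * v)))) z)))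
    where
    -- If 3 were 0, then 1 + 3v would be 1, against the assumption that it vanishes.
    three≢0 : three ≢ 0#
    three≢0 t = three≡0⇒ v t z
  1-3u≢0 : 1# - three * u ≢ 0#
  1-3u≢0 z = 1+3v≢0 (- u) (λ p≢3 e → proj₁ (u≢±⅓ p≢3) (trans (ring 1 (λ u → u := :- :- u) refl u) (trans (cong -_ e) (ring 1 (λ t → :- :- t := t) refl (three ⁻¹)))))
    (trans (ring 2 (λ t u → κ 1 :+ t :* :- u := κ 1 :- t :* u) refl three u) z)
  -- The equal characters of 1 + u and 1 - u multiply to 1, so the product has a square root. It
  -- scales the conic to s² + t² = 2, which has the rational point (1, 1).
  root : ∃ λ w → w * w ≡ (1# + u) * (1# - u)
  root = χ-sqrt (trans (χ-* (1# + u) (1# - u)) (trans (cong (χ (1# + u) *_) (sym χ≡)) (χ² 1+u≢0)))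
  four : ∃ λ b → ∃ λ xs → Unique xs × length xs ≡ 4 × All (λ x → F₂ u (x + (1# + 1#)) - F₂ u x ≡ b) xs
  four = FourSolutions.four-solutions K pr n q≡ k q≡4k+3 u u≢0 1+u≢0 1-u≢0 (1+3v≢0 u (λ p≢3 → proj₂ (u≢±⅓ p≢3))) 1-3u≢0 χ≡ (proj₁ root) (proj₂ root)
    9000 A h≡ 2μ≤q few large
  lower : (∃ λ b → ∃ λ xs → Unique xs × length xs ≡ 4 × All (λ x → F₂ u (x + (1# + 1#)) - F₂ u x ≡ b) xs) → 4 ℕ.≤ diffUniformity (F₂ u)
  lower (b , xs , un , len , sols) = ≡.subst (ℕ._≤ diffUniformity (F₂ u)) len (uniformity≥ (F₂ u) (1# + 1#) b xs two≢0 un sols)
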